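{- Let $\mathcal{G}=(H,\sigma,\alpha,h_0)$ be a rooted combinatorial map whose underlying graph $G=(V,E)$ has at least one edge, let $v_0$ be its root-vertex, let $T_G$ be its Tutte polynomial and let $[x^i]P(x)$ denote the coefficient of $x^i$ in a polynomial $P$. For every $i\ge 0$: $[x^i]T_G(1+x,2)$ (resp. $[x^i]T_G(1+x,1)$, $[x^i]T_G(1+x,0)$) is the number of orientations (resp. minimal orientations, acyclic orientations) of $G$ having exactly $i+1$ non-empty root-components; and $[x^i]T_G(x,2)$ (resp. $[x^i]T_G(x,1)$, $[x^i]T_G(x,0)$) is the number of $v_0$-connected orientations (resp. minimal $v_0$-connected orientations, acyclic $v_0$-connected orientations) having exactly $i+1$ non-empty root-strong-components.
   Context: Tutte polynomial: $T_G(x,y)=\sum_{S\subseteq E}(x-1)^{c(S)-1}(y-1)^{|S|+c(S)-|V|}$. A rooted combinatorial map is $\mathcal{G}=(H,\sigma,\alpha,h_0)$ with $H$ a finite set of half-edges, $\sigma$ a permutation, $\alpha$ a fixed-point-free involution, $\langle\sigma,\alpha\rangle$ transitive on $H$, root $h_0$; underlying graph: vertices the cycles of $\sigma$, edges the pairs $\{h,\alpha(h)\}$; $v_0$ is the vertex containing $h_0$. Subgraphs are spanning, identified with edge sets. An orientation assigns to each edge $\{h,h'\}$ an ordered pair $(h,h')$ (tail $h$, head $h'$); $v_0$-connected means every vertex is reachable from $v_0$; acyclic means no directed cycle. For a spanning tree $T$: edges in $T$ are internal, others external; the motion function $t(h)=\sigma\alpha(h)$ if the edge of $h$ is internal, $\sigma(h)$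 otherwise, is a cyclic permutation of $H$; the $(\mathcal{G},T)$-order on $H$ is $h_0<t(h_0)<\dots<t^{|H|-1}(h_0)$, edges compared via their smaller half-edge. Fundamental cycle of external $e$: set of $e'$ with $T-e'+e$ a spanning tree; fundamental cocycle of internal $e$: set of $e'$ with $T-e+e'$ a spanning tree; an edge is $(\mathcal{G},T)$-active if minimal in its fundamental cycle/cocycle. $[T^-,T^+]$: subgraphs obtained from $T$ by removing some internal active edges and adding some external active edges; each subgraph lies in exactly one. $\Phi(S)$ for $S\in[T^-,T^+]$: for $e=\{h_1,h_2\}$, $h_1<h_2$, $\Phi(S)(e)=(h_1,h_2)$ if either ($e\in T$ and its fundamental cocycle contains no edge of $S\triangle T$) or ($e\notin T$ and its fundamental cycle contains some edge of $S\triangle T$); otherwise $(h_2,h_1)$; $\Phi$ is a bijection onto orientations. For an orientation $\mathcal{O}$ let $T_{\mathcal{O}}$ be the spanning tree with $\Phi^{ -1}(\mathcal{O})\in[T_{\mathcal{O}}^-,T_{\mathcal{O}}^+]$ and compare edges/half-edges in the $(\mathcal{G},T_{\mathcal{O}})$-order. $\mathcal{O}$ is minimal if no $\mathcal{O}$-directed cycle has a tail as its smallest half-edge. Root-components of $\mathcal{O}$: $V_0$ is the set of vertices reachable from $v_0$; if $W_k=V_0\cup\dots\cup V_k\ne V$, let $e_k$ be the minimal edge with one endpoint in $W_k$ and the other endpoint $v_k\notin W_k$, and let $V_{k+1}$ be the set of vertices outside $W_k$ reachable from $v_k$. Root-strong-components of a $v_0$-connected $\mathcal{O}$: $U_0$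 is the set of vertices from which $v_0$ is reachable; if $W_k=U_0\cup\dots\cup U_k\ne V$, let $e_k$ be the minimal edge with one endpoint in $W_k$ and the other $v_k\notin W_k$, and let $U_{k+1}$ be the set of vertices outside $W_k$ from which $v_k$ is reachable. -}

module Defs where

open import Data.Nat using (ℕ; zero; suc; _+_; _∸_; _⊓_; _≤_; _<_; _≡ᵇ_; _≤ᵇ_; _<ᵇ_)
open import Data.Bool using (Bool; true; false; not; _∧_; _∨_; _xor_; if_then_else_)
open import Data.Fin using (Fin; toℕ) renaming (_≟_ to _≟F_)
open import Data.Fin.Permutation using (Permutation′; _⟨$⟩ʳ_; _⟨$⟩ˡ_)
open import Data.Integer using (ℤ; +_; -_) renaming (_+_ to _+ℤ_; _*_ to _*ℤ_; _-_ to _-ℤ_; _^_ to _^ℤ_)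
open import Data.List using (List; []; _∷_; _∷ʳ_; length; map; foldr; filterᵇ; takeWhileᵇ; allFin; upTo; concatMap)
open import Data.Bool.ListAction using (any; all)
open import Data.List.Membership.Propositional using (_∈_)
open import Data.List.Relation.Unary.All using (All)
open import Data.List.Relation.Unary.Any using (Any)
open import Data.List.Relation.Unary.AllPairs using (AllPairs)
open import Data.List.Relation.Unary.Linked using (Linked)
open import Data.List.Relation.Unary.Unique.Propositional using (Unique)
open import Data.Vec using (Vec; []; _∷_; lookup; tabulate)
open import Data.Product using (Σ; _×_; ∃; ∃-syntax; _,_)
open import Function.Bundles using (_⇔_)
open import Relation.Binary.PropositionalEquality using (_≡_; _≢_)
open import Relation.Binary.Construct.Closure.ReflexiveTransitive using (Star)
open import Relation.Nullary using (¬_)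
open import Relation.Nullary.Decidable using (⌊_⌋)

-- Univariate integer polynomials, as coefficient lists (constant term first)

Poly : Set
Poly = List ℤ

_+P_ : Poly → Poly → Poly
[] +P q = q
(a ∷ p) +P [] = a ∷ p
(a ∷ p) +P (b ∷ q) = (a +ℤ b) ∷ (p +P q)

scaleP : ℤ → Poly → Poly
scaleP c = map (c *ℤ_)

_*P_ : Poly → Poly → Poly
[] *P q = []
(a ∷ p) *P q = scaleP a q +P (+ 0 ∷ (p *P q))

constP : ℤ → Poly
constP c = c ∷ []

_^P_ : Poly → ℕ → Poly
p ^P zero = constP (+ 1)
p ^P suc k = p *P (p ^P k)

sumP : List Poly → Poly
sumP = foldr _+P_ []

coeff : Poly → ℕ → ℤ
coeff [] i = + 0
coeff (a ∷ p) zero = a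
coeff (a ∷ p) (suc i) = coeff p i

onePlusX : Poly
onePlusX = + 1 ∷ + 1 ∷ []

varX : Poly
varX = + 0 ∷ + 1 ∷ []

allVecs : (m : ℕ) → List (Vec Bool m)
allVecs zero = [] ∷ []
allVecs (suc m) = concatMap (λ v → (false ∷ v) ∷ (true ∷ v) ∷ []) (allVecs m)

count : ∀ {A : Set} → (A → Bool) → List A → ℕ
count p xs = length (filterᵇ p xs)

iter : ∀ {A : Set} → (A → A) → ℕ → A → A
iter f zero a = a
iter f (suc k) a = f (iter f k a)

HasCount : ∀ {A : Set} → (A → Set) → ℕ → Set
HasCount {A} P k = Σ (List A) λ L → Unique L × (∀ a → (a ∈ L) ⇔ P a) × length L ≡ k

data MapStep {n : ℕ} (σ : Permutation′ n) (α : Fin n → Fin n) (h : Fin n) : Fin n → Set where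
  byσ  : MapStep σ α h (σ ⟨$⟩ʳ h)
  byσ⁻ : MapStep σ α h (σ ⟨$⟩ˡ h)
  byα  : MapStep σ α h (α h)

record RootedMap (n : ℕ) : Set where
  field
    σ        : Permutation′ n
    α        : Fin n → Fin n
    α-invol  : ∀ h → α (α h) ≡ h
    α-fpf    : ∀ h → α h ≢ h
    transitive : ∀ h h' → Star (MapStep σ α) h h'
    h₀       : Fin n

module MapDefs {n : ℕ} (M : RootedMap n) where
  open RootedMap M

  σf : Fin n → Fin n
  σf h = σ ⟨$⟩ʳ h

  H : List (Fin n)
  H = allFin n

  _==_ : Fin n → Fin n → Bool
  a == b = ⌊ a ≟F b ⌋

  -- h and h' lie in the same cycle of σ (i.e. at the same vertex)
  sameV : Fin n → Fin n → Bool
  sameV h h' = any (λ k → iter σf k h == h') (upTo n)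

  -- reachability along a step relation between half-edges (paths have < n steps)
  closure : (Fin n → Fin n → Bool) → ℕ → Fin n → Fin n → Bool
  closure st zero h h' = h == h'
  closure st (suc k) h h' = closure st k h h' ∨ any (λ m → closure st k h m ∧ st m h') H

  reach : (Fin n → Fin n → Bool) → Fin n → Fin n → Bool
  reach st = closure st n

  -- number of classes of a (symmetric, reflexive-transitive) relation = number of minimal representatives
  numClasses : (Fin n → Fin n → Bool) → ℕ
  numClasses r = count (λ h → all (λ h' → not (r h h') ∨ (toℕ h ≤ᵇ toℕ h')) H) H

  numV : ℕ
  numV = numClasses sameV

  -- Subgraphs (spanning, = edge sets) are the α-invariant subsets of H
  isSubgraph : Vec Bool n → Bool
  isSubgraph S = all (λ h → not (lookup S h xor lookup S (α h))) H

  allSubgraphs : List (Vec Bool n)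
  allSubgraphs = filterᵇ isSubgraph (allVecs n)

  numE : Vec Bool n → ℕ
  numE S = count (λ h → lookup S h ∧ (toℕ h <ᵇ toℕ (α h))) H

  ustep : Vec Bool n → Fin n → Fin n → Bool
  ustep S h h' = sameV h h' ∨ (lookup S h ∧ (α h == h'))

  numComp : Vec Bool n → ℕ
  numComp S = numClasses (reach (ustep S))

  tutteAt : Poly → ℤ → Poly
  tutteAt X y = sumP (map term allSubgraphs)
    where
    term : Vec Bool n → Poly
    term S = ((X +P constP (- + 1)) ^P (numComp S ∸ 1))
             *P constP ((y -ℤ + 1) ^ℤ (numE S + numComp S ∸ numV))

  -- Orientations: O h = true iff h is the tail of its edge

  isOrientation : Vec Bool n → Bool
  isOrientation O = all (λ h → lookup O h xor lookup O (α h)) H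

  dstep : Vec Bool n → Fin n → Fin n → Bool
  dstep O h h' = sameV h h' ∨ (lookup O h ∧ (α h == h'))

  reachD : Vec Bool n → Fin n → Fin n → Bool
  reachD O = reach (dstep O)

  v0Connected : Vec Bool n → Bool
  v0Connected O = all (λ h → reachD O h₀ h) H

  -- an O-directed cycle, given by the list of tails of its edges h ∷ rest in cyclic order,
  -- through pairwise distinct vertices
  DirectedCycle : Vec Bool n → Fin n → List (Fin n) → Set
  DirectedCycle O h rest =
    All (λ a → lookup O a ≡ true) (h ∷ rest)
    × Linked (λ a b → sameV (α a) b ≡ true) ((h ∷ rest) ∷ʳ h)
    × AllPairs (λ a b → sameV a b ≡ false) (h ∷ rest)

  Acyclic : Vec Bool n → Set
  Acyclic O = ∀ h rest → ¬ DirectedCycle O h rest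

  isSpanningTree : Vec Bool n → Bool
  isSpanningTree T = isSubgraph T ∧ (numComp T ≡ᵇ 1) ∧ (numE T + 1 ≡ᵇ numV)

  motion : Vec Bool n → Fin n → Fin n
  motion T h = if lookup T h then σf (α h) else σf h

  -- position of h in the (G,T)-order: least k with t^k(h₀) = h
  pos : Vec Bool n → Fin n → ℕ
  pos T h = length (takeWhileᵇ (λ k → not (iter (motion T) k h₀ == h)) (upTo n))

  edgeRank : Vec Bool n → Fin n → ℕ
  edgeRank T h = pos T h ⊓ pos T (α h)

  sameEdge : Fin n → Fin n → Bool
  sameEdge x h = (x == h) ∨ (x == α h)

  addRemove : Vec Bool n → Fin n → Fin n → Vec Bool n
  addRemove T e e' = tabulate λ x → (lookup T x ∨ sameEdge x e) ∧ not (sameEdge x e')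

  removeAdd : Vec Bool n → Fin n → Fin n → Vec Bool n
  removeAdd T e e' = tabulate λ x → (lookup T x ∧ not (sameEdge x e)) ∨ sameEdge x e'

  inFundCycle : Vec Bool n → Fin n → Fin n → Bool
  inFundCycle T e e' = isSpanningTree (addRemove T e e')

  inFundCocycle : Vec Bool n → Fin n → Fin n → Bool
  inFundCocycle T e e' = isSpanningTree (removeAdd T e e')

  fund : Vec Bool n → Fin n → Fin n → Bool
  fund T e e' = if lookup T e then inFundCocycle T e e' else inFundCycle T e e'

  active : Vec Bool n → Fin n → Bool
  active T e = all (λ e' → not (fund T e e') ∨ (edgeRank T e ≤ᵇ edgeRank T e')) H

  inInterval : Vec Bool n → Vec Bool n → Bool
  inInterval T S = isSpanningTree T ∧ isSubgraph S
                   ∧ all (λ h → not (lookup S h xor lookup T h) ∨ active T h) H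

  Φ : Vec Bool n → Vec Bool n → Vec Bool n
  Φ T S = tabulate λ h → not ((pos T h <ᵇ pos T (α h)) xor cond h)
    where
    meetsΔ : Fin n → Bool
    meetsΔ h = any (λ h' → fund T h h' ∧ (lookup S h' xor lookup T h')) H
    cond : Fin n → Bool
    cond h = if lookup T h then not (meetsΔ h) else meetsΔ h

  TreeOf : Vec Bool n → Vec Bool n → Set
  TreeOf O T = ∃[ S ] (inInterval T S ≡ true × Φ T S ≡ O)

  SmallestIsTail : Vec Bool n → List (Fin n) → Set
  SmallestIsTail T C = Any (λ a → All (λ b → (pos T a ≤ pos T b) × (pos T a < pos T (α b))) C) C

  MinimalWrt : Vec Bool n → Vec Bool n → Set
  MinimalWrt T O = ∀ h rest → DirectedCycle O h rest → ¬ SmallestIsTail T (h ∷ rest)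

  minCrossing : Vec Bool n → (Fin n → Bool) → List (Fin n) → Fin n → Fin n
  minCrossing T W [] best = best
  minCrossing T W (h ∷ hs) best =
    if (W h ∧ not (W (α h))) ∧ (edgeRank T h <ᵇ edgeRank T best)
    then minCrossing T W hs h else minCrossing T W hs best

  firstCrossing : (Fin n → Bool) → List (Fin n) → List (Fin n)
  firstCrossing W [] = []
  firstCrossing W (h ∷ hs) = if W h ∧ not (W (α h)) then h ∷ [] else firstCrossing W hs

  -- grow: given current W_k and the vertex v_k (as a half-edge), the new W_{k+1}
  countParts : Vec Bool n → ((Fin n → Bool) → Fin n → Fin n → Bool) → ℕ → (Fin n → Bool) → ℕ
  countParts T grow zero W = 1
  countParts T grow (suc f) W with firstCrossing W H
  ... | [] = 1
  ... | h ∷ _ = suc (countParts T grow f (λ x → grow W (α (minCrossing T W H h)) x))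

  numRootComps : Vec Bool n → Vec Bool n → ℕ
  numRootComps T O =
    countParts T (λ W v x → W x ∨ (reachD O v x ∧ not (W x))) n (λ x → reachD O h₀ x)

  numRootStrongComps : Vec Bool n → Vec Bool n → ℕ
  numRootStrongComps T O =
    countParts T (λ W v x → W x ∨ (reachD O x v ∧ not (W x))) n (λ x → reachD O x h₀)

  RC : ℕ → Vec Bool n → Set
  RC i O = ∃[ T ] (TreeOf O T × numRootComps T O ≡ suc i)

  RSC : ℕ → Vec Bool n → Set
  RSC i O = ∃[ T ] (TreeOf O T × numRootStrongComps T O ≡ suc i)

  Minimal : Vec Bool n → Set
  Minimal O = ∃[ T ] (TreeOf O T × MinimalWrt T O)

  CoeffsCount : Poly → (ℕ → Vec Bool n → Set) → Set
  CoeffsCount P Q = ∀ i → ∃[ k ] (HasCount (Q i) k × coeff P i ≡ + k)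

{-# OPTIONS --safe #-}
module Submission where

-- Fix a spanning tree T. Cutting the tour of T at a tree edge with half-edges b < αb leaves the
-- subtree of b, the half-edges from just after b up to αb: they form the component of T - {b, αb}
-- avoiding the root, and an external edge lies in the fundamental cocycle of b iff exactly one of
-- its half-edges is in the subtree. Orient tree edges from their first to their second half-edge
-- and external edges backwards. Then the fundamental cycle or cocycle of an edge is directed iff the
-- edge is active, and Φ reverses the union of the fundamental cycles and cocycles of the toggled
-- edges, which are the active edges on which T and S disagree.
--
-- Every subgraph lies in some interval: read the tour backwards, and exchange an inactive edge on
-- which T and S disagree with a smaller edge of its fundamental cycle or cocycle. This changes
-- neither the later part of the tour nor the activities there. Φ is injective: at the first half-edge
-- where the tours of two preimages of an orientation disagree, a directed cycle of one meets a
-- directed cut of the other. As there are as many orientations as subgraphs, Φ is bijective and the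
-- intervals are disjoint.
--
-- In the orientation of S, the subtrees of the toggled tree edges have no incoming edge, while
-- untoggled tree edges can be followed downwards; hence the root-components are the vertex sets of
-- the components of S. If no tree edge is toggled, a similar argument with reversed reachability
-- gives one root-strong-component for the root and one for each active tree edge. An orientation is
-- minimal iff no external edge is toggled, and acyclic iff no external edge is active. The
-- coefficients follow by summing over the two states of the active edges, one edge at a time.

open import Defs
open import Data.Bool
  using (Bool; true; false; not; _∧_; _∨_; _xor_; if_then_else_; T?)
  renaming (T to IsTrue)
open import Data.Bool.ListAction using (any; all)
open import Data.Bool.Properties
  using (¬-not; not-¬; not-injective; not-involutive; ∧-conicalˡ; ∧-conicalʳ; ∧-zeroʳ;
         ∧-identityʳ; ∨-identityʳ; ∨-zeroʳ; T-≡; ⇔→≡)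
import Data.Bool.Properties as 𝔹ₚ
open import Data.Empty using (⊥; ⊥-elim)
open import Data.Fin using (Fin; toℕ; fromℕ<)
open import Data.Fin.Permutation using (_⟨$⟩ˡ_; inverseˡ; inverseʳ)
import Data.Fin.Properties as Finₚ
open import Data.Integer
  using (ℤ; +_; -_)
  renaming (_+_ to _+ℤ_; _*_ to _*ℤ_; _-_ to _-ℤ_; _^_ to _^ℤ_)
import Data.Integer.Properties as ℤₚ
open import Data.Integer.Solver using (module +-*-Solver)
open import Data.List
  using (List; []; _∷_; _++_; _∷ʳ_; _ʳ++_; length; map; foldr; filterᵇ; takeWhileᵇ; allFin; upTo;
         applyUpTo; concatMap)
open import Data.List.Extrema.Nat
  using (argmin; argmin-sel; argmin-all; f[argmin]≤f[⊤]; f[argmin]≤f[xs])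
open import Data.List.Membership.Propositional using (_∈_; find; lose)
open import Data.List.Membership.Propositional.Properties
  using (∈-allFin; ∈-∃++; ∈-filter⁺; ∈-filter⁻; ∈-upTo⁺; ∈-map⁺; ∈-map⁻)
open import Data.List.Membership.Propositional.Properties.WithK using (unique∧set⇒bag)
import Data.List.Properties as Listₚ
open import Data.List.Relation.Binary.BagAndSetEquality using (∼bag⇒↭)
open import Data.List.Relation.Binary.Permutation.Propositional using (_↭_; ↭⇒↭ₛ)
open import Data.List.Relation.Binary.Permutation.Propositional.Properties
  using (map⁺; filter-↭; ↭-length; ↭-reverse; shift; ∈-resp-↭)
import Data.List.Relation.Binary.Permutation.Setoid.Properties as ↭ₛ
open import Data.List.Relation.Binary.Subset.Propositional using (_⊆_)
open import Data.List.Relation.Unary.All using (All; []; _∷_)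
import Data.List.Relation.Unary.All as All
import Data.List.Relation.Unary.All.Properties as Allₚ
open import Data.List.Relation.Unary.AllPairs using (AllPairs; []; _∷_)
import Data.List.Relation.Unary.AllPairs as AllPairs
import Data.List.Relation.Unary.AllPairs.Properties as AllPairsₚ
open import Data.List.Relation.Unary.Any using (here; there; any?)
import Data.List.Relation.Unary.Any as Any
import Data.List.Relation.Unary.Any.Properties as Anyₚ
open import Data.List.Relation.Unary.Linked using (Linked; [-]; _∷_)
open import Data.List.Relation.Unary.Unique.Propositional using (Unique)
import Data.List.Relation.Unary.Unique.Propositional.Properties as Uniqueₚ
open import Data.Nat using (ℕ; zero; suc; _+_; _*_; _∸_; _⊓_; _≤_; _<_; z≤n; s≤s; _≤ᵇ_; _<ᵇ_; _≡ᵇ_)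
open import Data.Nat.Induction using (<-rec; <-wellFounded)
open import Data.Nat.Properties
  using (≤-refl; ≤-reflexive; ≤-trans; <-trans; <-≤-trans; ≤-<-trans; <⇒≤; <-irrefl; <-asym;
         <-cmp; n<1+n; ≤-antisym; ≤-pred; ≮⇒≥; ≰⇒>; +-comm; +-assoc; +-identityʳ; +-suc)
import Data.Nat.Properties as ℕₚ
open import Data.Product using (Σ; _×_; ∃; _,_; proj₁; proj₂)
open import Data.Product.Function.NonDependent.Propositional using (_×-⇔_)
open import Data.Sum using (_⊎_; inj₁; inj₂; [_,_]′)
open import Data.Vec using (Vec; []; _∷_; lookup; tabulate)
open import Data.Vec.Properties using (lookup∘tabulate; tabulate-cong; tabulate∘lookup; ≡-dec)
open import Function using (_∘_; id)
open import Function.Bundles using (_⇔_; mk⇔; Equivalence)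
open import Function.Construct.Composition using (_⇔-∘_)
open import Function.Construct.Symmetry using (⇔-sym)
import Induction.WellFounded as WF
open import Relation.Binary.Construct.Closure.ReflexiveTransitive using (Star; ε; _◅_)
import Relation.Binary.Construct.On as On
open import Relation.Binary.Definitions using (DecidableEquality; tri<; tri≈; tri>)
open import Relation.Binary.PropositionalEquality
  using (_≡_; _≢_; setoid; refl; sym; trans; cong; cong₂; subst; subst₂; module ≡-Reasoning)
open import Relation.Binary.Structures using (IsEquivalence)
open import Relation.Nullary using (¬_; Dec; does; yes; no; contradiction)
open import Relation.Nullary.Decidable using (_×-dec_; dec-true)

IsTrue⇒≡ : ∀ {b} → IsTrue b → b ≡ true
IsTrue⇒≡ = Equivalence.to T-≡

≡⇒IsTrue : ∀ {b} → b ≡ true → IsTrue b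
≡⇒IsTrue = Equivalence.from T-≡

true⊎false : ∀ b → b ≡ true ⊎ b ≡ false
true⊎false true = inj₁ refl
true⊎false false = inj₂ refl

∨-introˡ : ∀ {a b} → a ≡ true → a ∨ b ≡ true
∨-introˡ refl = refl

∨-introʳ : ∀ a {b} → b ≡ true → a ∨ b ≡ true
∨-introʳ a refl = ∨-zeroʳ a

∨-elim : ∀ a {b} → a ∨ b ≡ true → a ≡ true ⊎ b ≡ true
∨-elim true _ = inj₁ refl
∨-elim false b≡true = inj₂ b≡true

not-∨-elim : ∀ {a b} → not a ∨ b ≡ true → a ≡ true → b ≡ true
not-∨-elim p refl = p

not-∨-intro : ∀ {a b} → (a ≡ true → b ≡ true) → not a ∨ b ≡ true
not-∨-intro {true} f = f refl
not-∨-intro {false} f = refl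

not-∨-false : ∀ {a b} → not a ∨ b ≡ false → a ≡ true × b ≡ false
not-∨-false {true} p = refl , p

≡-via-true : ∀ {a b} → (a ≡ true → b ≡ true) → (b ≡ true → a ≡ true) → a ≡ b
≡-via-true f g = ⇔→≡ {z = true} (mk⇔ f g)

≡not⇒≢ : ∀ {a b} → a ≡ not b → a ≢ b
≡not⇒≢ a≡not-b a≡b = not-¬ a≡b a≡not-b

≡not-cases : ∀ {a b} → a ≡ not b → (a ≡ true × b ≡ false) ⊎ (a ≡ false × b ≡ true)
≡not-cases {b = true} a≡false = inj₂ (a≡false , refl)
≡not-cases {b = false} a≡true = inj₁ (a≡true , refl)

xor⇒≡not : ∀ a {b} → a xor b ≡ true → a ≡ not b
xor⇒≡not true p = sym p
xor⇒≡not false refl = refl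

≡not⇒xor : ∀ {a b} → a ≡ not b → a xor b ≡ true
≡not⇒xor {b = true} refl = refl
≡not⇒xor {b = false} refl = refl

¬xor⇒≡ : ∀ {a b} → a xor b ≡ false → a ≡ b
¬xor⇒≡ {true} {true} _ = refl
¬xor⇒≡ {false} {false} _ = refl

xor-xorʳ : ∀ a c → (a xor c) xor c ≡ a
xor-xorʳ a c =
  trans (𝔹ₚ.xor-assoc a c c) (trans (cong (a xor_) (𝔹ₚ.xor-same c)) (𝔹ₚ.xor-identityʳ a))

xor-cancelʳ : ∀ {a b} c → a xor c ≡ b xor c → a ≡ b
xor-cancelʳ {a} {b} c e = trans (sym (xor-xorʳ a c)) (trans (cong (_xor c) e) (xor-xorʳ b c))

<⇒<ᵇ≡true : ∀ {m k} → m < k → (m <ᵇ k) ≡ true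
<⇒<ᵇ≡true m<k = IsTrue⇒≡ (ℕₚ.<⇒<ᵇ m<k)

<ᵇ≡true⇒< : ∀ {m k} → (m <ᵇ k) ≡ true → m < k
<ᵇ≡true⇒< {m} {k} e = ℕₚ.<ᵇ⇒< m k (≡⇒IsTrue e)

≥⇒<ᵇ≡false : ∀ {m k} → k ≤ m → (m <ᵇ k) ≡ false
≥⇒<ᵇ≡false k≤m = ¬-not λ e → ℕₚ.<⇒≱ (<ᵇ≡true⇒< e) k≤m

<ᵇ≡false⇒≥ : ∀ {m k} → (m <ᵇ k) ≡ false → k ≤ m
<ᵇ≡false⇒≥ e = ≮⇒≥ λ m<k → not-¬ (<⇒<ᵇ≡true m<k) e

≤⇒≤ᵇ≡true : ∀ {m k} → m ≤ k → (m ≤ᵇ k) ≡ true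
≤⇒≤ᵇ≡true m≤k = IsTrue⇒≡ (ℕₚ.≤⇒≤ᵇ m≤k)

≤ᵇ≡true⇒≤ : ∀ {m k} → (m ≤ᵇ k) ≡ true → m ≤ k
≤ᵇ≡true⇒≤ {m} {k} e = ℕₚ.≤ᵇ⇒≤ m k (≡⇒IsTrue e)

≤ᵇ≡false⇒> : ∀ {m k} → (m ≤ᵇ k) ≡ false → k < m
≤ᵇ≡false⇒> e = ≰⇒> λ m≤k → not-¬ (≤⇒≤ᵇ≡true m≤k) e

≡⇒≡ᵇ≡true : ∀ {m k} → m ≡ k → (m ≡ᵇ k) ≡ true
≡⇒≡ᵇ≡true {m} {k} e = IsTrue⇒≡ (ℕₚ.≡⇒≡ᵇ m k e)

≡ᵇ≡true⇒≡ : ∀ {m k} → (m ≡ᵇ k) ≡ true → m ≡ k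
≡ᵇ≡true⇒≡ {m} {k} e = ℕₚ.≡ᵇ⇒≡ m k (≡⇒IsTrue e)

𝟙 : Bool → ℕ
𝟙 true = 1
𝟙 false = 0

lookup-extensional : ∀ {A : Set} {n} {v w : Vec A n} → (∀ i → lookup v i ≡ lookup w i) → v ≡ w
lookup-extensional {v = v} {w} v≗w = begin
  v                     ≡⟨ tabulate∘lookup v ⟨
  tabulate (lookup v)   ≡⟨ tabulate-cong v≗w ⟩
  tabulate (lookup w)   ≡⟨ tabulate∘lookup w ⟩
  w                     ∎
  where open ≡-Reasoning

module _ {A : Set} where

  any-true⁺ : ∀ (p : A → Bool) {x xs} → x ∈ xs → p x ≡ true → any p xs ≡ true
  any-true⁺ p x∈xs px = IsTrue⇒≡ (Anyₚ.any⁺ p (lose x∈xs (≡⇒IsTrue px)))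

  any-true⁻ : ∀ (p : A → Bool) xs → any p xs ≡ true → ∃ λ x → x ∈ xs × p x ≡ true
  any-true⁻ p xs e =
    let x , x∈xs , px = find (Anyₚ.any⁻ p xs (≡⇒IsTrue e)) in x , x∈xs , IsTrue⇒≡ px

  all-true⁺ : ∀ (p : A → Bool) {xs} → (∀ {x} → x ∈ xs → p x ≡ true) → all p xs ≡ true
  all-true⁺ p h = IsTrue⇒≡ (Allₚ.all⁻ p (All.tabulate (λ x∈xs → ≡⇒IsTrue (h x∈xs))))

  all-true⁻ : ∀ (p : A → Bool) {x xs} → all p xs ≡ true → x ∈ xs → p x ≡ true
  all-true⁻ p {xs = xs} e x∈xs = IsTrue⇒≡ (All.lookup (Allₚ.all⁺ p xs (≡⇒IsTrue e)) x∈xs)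

  all-false⁻ : ∀ (p : A → Bool) xs → all p xs ≡ false → ∃ λ x → x ∈ xs × p x ≡ false
  all-false⁻ p (x ∷ xs) e with p x in px
  ... | false = x , here refl , px
  ... | true = let y , y∈xs , py = all-false⁻ p xs e in y , there y∈xs , py

  any-cong : ∀ {p q : A → Bool} → (∀ x → p x ≡ q x) → ∀ xs → any p xs ≡ any q xs
  any-cong p≗q [] = refl
  any-cong p≗q (x ∷ xs) = cong₂ _∨_ (p≗q x) (any-cong p≗q xs)

  all-cong : ∀ {p q : A → Bool} → (∀ x → p x ≡ q x) → ∀ xs → all p xs ≡ all q xs
  all-cong p≗q [] = refl
  all-cong p≗q (x ∷ xs) = cong₂ _∧_ (p≗q x) (all-cong p≗q xs)

  ∈-filterᵇ⁺ : ∀ (p : A → Bool) {x xs} → x ∈ xs → p x ≡ true → x ∈ filterᵇ p xs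
  ∈-filterᵇ⁺ p x∈xs px = ∈-filter⁺ (T? ∘ p) x∈xs (≡⇒IsTrue px)

  ∈-filterᵇ⁻ : ∀ (p : A → Bool) {x} xs → x ∈ filterᵇ p xs → x ∈ xs × p x ≡ true
  ∈-filterᵇ⁻ p xs i = let x∈xs , px = ∈-filter⁻ (T? ∘ p) {xs = xs} i in x∈xs , IsTrue⇒≡ px

  unique-filterᵇ : ∀ (p : A → Bool) {xs} → Unique xs → Unique (filterᵇ p xs)
  unique-filterᵇ p = Uniqueₚ.filter⁺ (T? ∘ p)

  unique⇒AllPairs : ∀ {R : A → A → Set} {xs} → Unique xs →
                    (∀ {x y} → x ∈ xs → y ∈ xs → x ≢ y → R x y) → AllPairs R xs
  unique⇒AllPairs [] h = []
  unique⇒AllPairs (x∉xs ∷ u) h =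
    All.tabulate (λ y∈xs → h (here refl) (there y∈xs) (All.lookup x∉xs y∈xs))
    ∷ unique⇒AllPairs u (λ y∈xs z∈xs → h (there y∈xs) (there z∈xs))

  unique-⊆⇒length-≤ : ∀ {xs ys : List A} → Unique xs → xs ⊆ ys → length xs ≤ length ys
  unique-⊆⇒length-≤ [] _ = z≤n
  unique-⊆⇒length-≤ {x ∷ xs} (x∉xs ∷ u) xs⊆ys with us , vs , refl ← ∈-∃++ (xs⊆ys (here refl)) =
    subst (suc (length xs) ≤_) (sym (↭-length (shift x us vs)))
      (s≤s (unique-⊆⇒length-≤ u xs⊆us++vs))
    where
    xs⊆us++vs : xs ⊆ us ++ vs
    xs⊆us++vs y∈xs =
      Any.tail (All.lookup x∉xs y∈xs ∘ sym) (∈-resp-↭ (shift x us vs) (xs⊆ys (there y∈xs)))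

  unique-map : ∀ {B : Set} {f : A → B} {xs} → Unique xs →
               (∀ {x y} → x ∈ xs → y ∈ xs → f x ≡ f y → x ≡ y) → Unique (map f xs)
  unique-map u inj =
    AllPairsₚ.map⁺ (unique⇒AllPairs u (λ x∈xs y∈xs x≢y → x≢y ∘ inj x∈xs y∈xs))

  involution-↭ : ∀ {τ : A → A} {xs} → Unique xs → (∀ {x} → x ∈ xs → τ x ∈ xs) →
                 (∀ {x} → x ∈ xs → τ (τ x) ≡ x) → map τ xs ↭ xs
  involution-↭ {τ} {xs} u closed invol =
    ∼bag⇒↭ (unique∧set⇒bag (unique-map u τ-injective) u (mk⇔ to from))
    where
    τ-injective : ∀ {x y} → x ∈ xs → y ∈ xs → τ x ≡ τ y → x ≡ y
    τ-injective x∈xs y∈xs e = trans (sym (invol x∈xs)) (trans (cong τ e) (invol y∈xs))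
    to : ∀ {y} → y ∈ map τ xs → y ∈ xs
    to i with x , x∈xs , refl ← ∈-map⁻ τ i = closed x∈xs
    from : ∀ {y} → y ∈ xs → y ∈ map τ xs
    from y∈xs = subst (_∈ map τ xs) (invol y∈xs) (∈-map⁺ τ (closed y∈xs))

  count-∷ : ∀ (p : A → Bool) x xs → count p (x ∷ xs) ≡ 𝟙 (p x) + count p xs
  count-∷ p x xs with p x
  ... | true = refl
  ... | false = refl

  count-cong : ∀ {p q : A → Bool} xs → (∀ {x} → x ∈ xs → p x ≡ q x) → count p xs ≡ count q xs
  count-cong [] h = refl
  count-cong {p} {q} (x ∷ xs) h = begin
    count p (x ∷ xs)
      ≡⟨ count-∷ p x xs ⟩
    𝟙 (p x) + count p xs
      ≡⟨ cong₂ (λ b k → 𝟙 b + k) (h (here refl)) (count-cong xs (h ∘ there)) ⟩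
    𝟙 (q x) + count q xs
      ≡⟨ count-∷ q x xs ⟨
    count q (x ∷ xs) ∎
    where open ≡-Reasoning

  count-↭ : ∀ (p : A → Bool) {xs ys} → xs ↭ ys → count p xs ≡ count p ys
  count-↭ p xs↭ys = ↭-length (filter-↭ (T? ∘ p) xs↭ys)

  count-map : ∀ (p : A → Bool) (f : A → A) xs → count p (map f xs) ≡ count (p ∘ f) xs
  count-map p f [] = refl
  count-map p f (x ∷ xs) = begin
    count p (f x ∷ map f xs)          ≡⟨ count-∷ p (f x) (map f xs) ⟩
    𝟙 (p (f x)) + count p (map f xs)  ≡⟨ cong (λ k → 𝟙 (p (f x)) + k) (count-map p f xs) ⟩
    𝟙 (p (f x)) + count (p ∘ f) xs    ≡⟨ count-∷ (p ∘ f) x xs ⟨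
    count (p ∘ f) (x ∷ xs)            ∎
    where open ≡-Reasoning

  count-split : ∀ (p q : A → Bool) xs →
                count p xs ≡ count (λ x → p x ∧ q x) xs + count (λ x → p x ∧ not (q x)) xs
  count-split p q [] = refl
  count-split p q (x ∷ xs) rewrite count-∷ p x xs | count-∷ (λ x → p x ∧ q x) x xs
    | count-∷ (λ x → p x ∧ not (q x)) x xs | count-split p q xs with p x | q x
  ... | true | true = refl
  ... | true | false = sym (+-suc _ _)
  ... | false | _ = refl

  count-∧-filterᵇ : ∀ (p q : A → Bool) xs → count (λ x → p x ∧ q x) xs ≡ count p (filterᵇ q xs)
  count-∧-filterᵇ p q [] = refl
  count-∧-filterᵇ p q (x ∷ xs) rewrite count-∷ (λ x → p x ∧ q x) x xs with q x
  ... | true rewrite count-∷ p x (filterᵇ q xs) =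
        cong₂ (λ b k → 𝟙 b + k) (∧-identityʳ (p x)) (count-∧-filterᵇ p q xs)
  ... | false rewrite ∧-zeroʳ (p x) = count-∧-filterᵇ p q xs

  count>0 : ∀ (p : A → Bool) {x xs} → x ∈ xs → p x ≡ true → 0 < count p xs
  count>0 p x∈xs px = Listₚ.filter-some (T? ∘ p) (lose x∈xs (≡⇒IsTrue px))

  count≡0⁻ : ∀ (p : A → Bool) {x xs} → count p xs ≡ 0 → x ∈ xs → p x ≡ false
  count≡0⁻ p e x∈xs = ¬-not λ px → <-irrefl (sym e) (count>0 p x∈xs px)

  count≡0⁺ : ∀ (p : A → Bool) xs → (∀ {x} → x ∈ xs → p x ≡ false) → count p xs ≡ 0
  count≡0⁺ p xs h =
    cong length (Listₚ.filter-none (T? ∘ p)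
      (All.tabulate {xs = xs} (λ x∈xs px → not-¬ (IsTrue⇒≡ px) (h x∈xs))))

  count≡1 : ∀ (p : A → Bool) {y xs} → Unique xs → y ∈ xs → p y ≡ true →
            (∀ {x} → p x ≡ true → x ≡ y) → count p xs ≡ 1
  count≡1 p {y} {xs} u y∈xs py only-y = ≤-antisym
    (unique-⊆⇒length-≤ {ys = y ∷ []} (unique-filterᵇ p u)
      (λ i → here (only-y (proj₂ (∈-filterᵇ⁻ p xs i)))))
    (count>0 p y∈xs py)

  count-strict-mono : ∀ {p q : A → Bool} {y} xs → (∀ {x} → p x ≡ true → q x ≡ true) →
                      y ∈ xs → p y ≡ false → q y ≡ true → count p xs < count q xs
  count-strict-mono {p} {q} {y} xs p⇒q y∈xs ¬py qy = begin-strict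
    count p xs
      ≡⟨ count-cong xs (λ _ → p≡q∧p _) ⟩
    count (λ x → q x ∧ p x) xs
      ≡⟨ +-identityʳ _ ⟨
    count (λ x → q x ∧ p x) xs + 0
      <⟨ ℕₚ.+-monoʳ-< _ (count>0 _ y∈xs (cong₂ _∧_ qy (cong not ¬py))) ⟩
    count (λ x → q x ∧ p x) xs + count (λ x → q x ∧ not (p x)) xs
      ≡⟨ count-split q p xs ⟨
    count q xs ∎
    where
    open ℕₚ.≤-Reasoning
    p≡q∧p : ∀ x → p x ≡ q x ∧ p x
    p≡q∧p x = ≡-via-true (λ px → cong₂ _∧_ (p⇒q px) px) (∧-conicalʳ (q x) _)

injective⇒surjective-on : ∀ {A B : Set} → DecidableEquality B → ∀ {f : A → B} {xs ys} → Unique xs →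
  (∀ {x y} → x ∈ xs → y ∈ xs → f x ≡ f y → x ≡ y) → map f xs ⊆ ys → length ys ≤ length xs →
    ys ⊆ map f xs
injective⇒surjective-on _≟_ {f} {xs} {ys} u inj f⊆ys |ys|≤|xs| {y} y∈ys with any? (y ≟_) (map f xs)
... | yes y∈fxs = y∈fxs
... | no y∉fxs = contradiction |ys|≤|xs| (ℕₚ.<⇒≱ (subst (_< length ys) (Listₚ.length-map f xs)
  (unique-⊆⇒length-≤ (Allₚ.¬Any⇒All¬ _ y∉fxs ∷ unique-map u inj)
    λ { (here refl) → y∈ys ; (there z∈fxs) → f⊆ys z∈fxs })))

module _ {n : ℕ} where

  all-allFin⁻ : ∀ (p : Fin n → Bool) → all p (allFin n) ≡ true → ∀ x → p x ≡ true
  all-allFin⁻ p e x = all-true⁻ p e (∈-allFin x)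

  all-allFin⁺ : ∀ (p : Fin n → Bool) → (∀ x → p x ≡ true) → all p (allFin n) ≡ true
  all-allFin⁺ p h = all-true⁺ p {allFin n} (λ {x} _ → h x)

  any-allFin⁺ : ∀ (p : Fin n → Bool) x → p x ≡ true → any p (allFin n) ≡ true
  any-allFin⁺ p x px = any-true⁺ p (∈-allFin x) px

  any-allFin⁻ : ∀ (p : Fin n → Bool) → any p (allFin n) ≡ true → ∃ λ x → p x ≡ true
  any-allFin⁻ p e = let x , _ , px = any-true⁻ p (allFin n) e in x , px

  unique-allFin : Unique (allFin n)
  unique-allFin = Uniqueₚ.allFin⁺ n

  count-allFin-≤ : ∀ (p : Fin n → Bool) → count p (allFin n) ≤ n
  count-allFin-≤ p =
    ≤-trans (Listₚ.length-filter (T? ∘ p) (allFin n)) (≤-reflexive (Listₚ.length-tabulate id))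

takeWhileᵇ-least : ∀ {A : Set} (p : A → Bool) (f : ℕ → A) {i m} → i < m → p (f i) ≡ false →
  let k = length (takeWhileᵇ p (applyUpTo f m)) in k ≤ i × p (f k) ≡ false
takeWhileᵇ-least p f {m = suc m} i<m ¬pfi with p (f 0) in pf0
... | false = z≤n , pf0
takeWhileᵇ-least p f {zero} {suc m} _ ¬pfi | true = contradiction ¬pfi (not-¬ pf0)
takeWhileᵇ-least p f {suc i} {suc m} (s≤s i<m) ¬pfi | true =
  let k≤i , ¬pfk = takeWhileᵇ-least p (f ∘ suc) i<m ¬pfi in s≤s k≤i , ¬pfk

iter-+ : ∀ {A : Set} (f : A → A) j k x → iter f (j + k) x ≡ iter f j (iter f k x)
iter-+ f zero k x = refl
iter-+ f (suc j) k x = cong f (iter-+ f j k x)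

iter-cong : ∀ {A : Set} {f g : A → A} → (∀ x → f x ≡ g x) → ∀ k x → iter f k x ≡ iter g k x
iter-cong f≗g zero x = refl
iter-cong {g = g} f≗g (suc k) x = trans (f≗g _) (cong g (iter-cong f≗g k x))

Orbit : ∀ {A : Set} → (A → A) → A → A → Set
Orbit f x y = ∃ λ k → iter f k x ≡ y

orbit-refl : ∀ {A : Set} {f : A → A} {x} → Orbit f x x
orbit-refl = 0 , refl

orbit-step : ∀ {A : Set} {f : A → A} {x} → Orbit f x (f x)
orbit-step = 1 , refl

orbit-trans : ∀ {A : Set} {f : A → A} {x y z} → Orbit f x y → Orbit f y z → Orbit f x z
orbit-trans {f = f} {x} (j , refl) (k , refl) = k + j , iter-+ f k j x

module Orbits {n : ℕ} (f : Fin n → Fin n) (f-injective : ∀ {x y} → f x ≡ f y → x ≡ y) where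

  iter-return : ∀ i {d x} → iter f (i + d) x ≡ iter f i x → iter f d x ≡ x
  iter-return zero e = e
  iter-return (suc i) e = iter-return i (f-injective e)

  period : ∀ x → ∃ λ m → m < n × iter f (suc m) x ≡ x
  period x with i , j , i<j , e ← Finₚ.pigeonhole (n<1+n n) (λ i → iter f (toℕ i) x)
           with m , i+1+m≡j ← ℕₚ.m≤n⇒∃[o]m+o≡n i<j = m , m<n , iter-return (toℕ i) returns
    where
    i+[1+m]≡j : toℕ i + suc m ≡ toℕ j
    i+[1+m]≡j = trans (+-suc (toℕ i) m) i+1+m≡j
    m<n : m < n
    m<n = ≤-trans (ℕₚ.m≤n+m (suc m) (toℕ i)) (subst (_≤ n) (sym i+[1+m]≡j) (Finₚ.toℕ≤pred[n] j))
    returns : iter f (toℕ i + suc m) x ≡ iter f (toℕ i) x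
    returns = trans (cong (λ k → iter f k x) i+[1+m]≡j) (sym e)

  orbit-unstep : ∀ x → Orbit f (f x) x
  orbit-unstep x = let m , _ , e = period x in
    m , trans (sym (iter-+ f m 1 x)) (trans (cong (λ k → iter f k x) (+-comm m 1)) e)

  orbit-sym : ∀ {x y} → Orbit f x y → Orbit f y x
  orbit-sym (zero , refl) = orbit-refl
  orbit-sym {x} (suc k , refl) = orbit-trans (orbit-unstep (iter f k x)) (orbit-sym (k , refl))

  reduce-mod-period : ∀ {m x} → iter f (suc m) x ≡ x → ∀ k → ∃ λ j → j ≤ m × iter f j x ≡ iter f k x
  reduce-mod-period e zero = 0 , z≤n , refl
  reduce-mod-period e (suc k) with j , j≤m , eⱼ ← reduce-mod-period e k with ℕₚ.m≤n⇒m<n∨m≡n j≤m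
  ... | inj₁ j<m = suc j , j<m , cong f eⱼ
  ... | inj₂ refl = 0 , z≤n , trans (sym e) (cong f eⱼ)

  orbit-bounded : ∀ {x y} → Orbit f x y → ∃ λ k → k < n × iter f k x ≡ y
  orbit-bounded {x} (k , refl) =
    let m , m<n , e = period x ; j , j≤m , eⱼ = reduce-mod-period e k in j , ≤-<-trans j≤m m<n , eⱼ

  module Transitive (x : Fin n) (transitive : ∀ y → Orbit f x y) where

    period-≥ : ∀ {m} → iter f (suc m) x ≡ x → n ≤ suc m
    period-≥ {m} e = Finₚ.injective⇒≤ {f = index} index-injective
      where
      visit : ∀ y → ∃ λ j → j ≤ m × iter f j x ≡ y
      visit y =
        let k , eₖ = transitive y ; j , j≤m , eⱼ = reduce-mod-period e k in j , j≤m , trans eⱼ eₖ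
      index : Fin n → Fin (suc m)
      index y = fromℕ< (s≤s (proj₁ (proj₂ (visit y))))
      index-injective : ∀ {y z} → index y ≡ index z → y ≡ z
      index-injective {y} {z} same = begin
        y                          ≡⟨ proj₂ (proj₂ (visit y)) ⟨
        iter f (proj₁ (visit y)) x ≡⟨ cong (λ j → iter f j x) (Finₚ.fromℕ<-injective _ _ _ _ same) ⟩
        iter f (proj₁ (visit z)) x ≡⟨ proj₂ (proj₂ (visit z)) ⟩
        z                          ∎
        where open ≡-Reasoning

    iter-n : iter f n x ≡ x
    iter-n =
      let m , m<n , e = period x in subst (λ k → iter f k x ≡ x) (≤-antisym m<n (period-≥ e)) e

    iter-distinct : ∀ {j k} → j < k → k < n → iter f j x ≢ iter f k x
    iter-distinct {j} {k} j<k k<n e with d , refl ← ℕₚ.m≤n⇒∃[o]m+o≡n j<k =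
      ℕₚ.<⇒≱ (≤-<-trans (s≤s (ℕₚ.m≤n+m d j)) k<n)
        (period-≥ (iter-return j (trans (cong (λ k → iter f k x) (+-suc j d)) (sym e))))

-- If f is f′ composed with the transposition of b and c, the cycles of f′ through b and c merge.
module MergedOrbits {n : ℕ} {f f′ : Fin n → Fin n}
  (f-injective : ∀ {x y} → f x ≡ f y → x ≡ y) (f′-injective : ∀ {x y} → f′ x ≡ f′ y → x ≡ y)
  {b c : Fin n} (fb≡f′c : f b ≡ f′ c) (fc≡f′b : f c ≡ f′ b)
  (agree : ∀ {x} → x ≢ b → x ≢ c → f x ≡ f′ x) (apart : ¬ Orbit f′ b c) where

  private
    module F = Orbits f f-injective
    module F′ = Orbits f′ f′-injective

    c-reaches : ∀ k → Orbit f c (iter f′ (suc k) b)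
    c-reaches zero = 1 , fc≡f′b
    c-reaches (suc k) with iter f′ (suc k) b Finₚ.≟ b | iter f′ (suc k) b Finₚ.≟ c
    ... | yes back | _ = 1 , trans fc≡f′b (cong f′ (sym back))
    ... | no _ | yes hits-c = ⊥-elim (apart (suc k , hits-c))
    ... | no ≢b | no ≢c = orbit-trans (c-reaches k) (1 , agree ≢b ≢c)

  merged : Orbit f b c
  merged = F.orbit-sym (let m , _ , e = F′.period b in subst (Orbit f c) e (c-reaches m))

  coarser : ∀ {x y} → Orbit f′ x y → Orbit f x y
  coarser (zero , refl) = orbit-refl
  coarser {x} (suc k , refl) = orbit-trans (coarser (k , refl)) (step (iter f′ k x))
    where
    step : ∀ y → Orbit f y (f′ y)
    step y with y Finₚ.≟ b | y Finₚ.≟ c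
    ... | yes refl | _ = orbit-trans merged (1 , fc≡f′b)
    ... | no _ | yes refl = orbit-trans (F.orbit-sym merged) (1 , fb≡f′c)
    ... | no ≢b | no ≢c = 1 , agree ≢b ≢c

module _ {P : Set} where

  ⟦_⟧ : Dec P → ℤ
  ⟦ P? ⟧ = if does P? then + 1 else + 0

  ⟦⟧-yes : ∀ (P? : Dec P) → P → ⟦ P? ⟧ ≡ + 1
  ⟦⟧-yes (yes _) _ = refl
  ⟦⟧-yes (no ¬p) p = contradiction p ¬p

  ⟦⟧-no : ∀ (P? : Dec P) → ¬ P → ⟦ P? ⟧ ≡ + 0
  ⟦⟧-no (yes p) ¬p = contradiction p ¬p
  ⟦⟧-no (no _) _ = refl

module _ {P Q : Set} where

  ⟦⟧-cong : ∀ (P? : Dec P) (Q? : Dec Q) → P ⇔ Q → ⟦ P? ⟧ ≡ ⟦ Q? ⟧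
  ⟦⟧-cong (yes p) Q? P⇔Q = sym (⟦⟧-yes Q? (Equivalence.to P⇔Q p))
  ⟦⟧-cong (no ¬p) Q? P⇔Q = sym (⟦⟧-no Q? (¬p ∘ Equivalence.from P⇔Q))

  ⟦⟧-× : ∀ (P? : Dec P) (Q? : Dec Q) → ⟦ P? ×-dec Q? ⟧ ≡ ⟦ P? ⟧ *ℤ ⟦ Q? ⟧
  ⟦⟧-× (yes _) (yes _) = refl
  ⟦⟧-× (yes _) (no _) = refl
  ⟦⟧-× (no _) (yes _) = refl
  ⟦⟧-× (no _) (no _) = refl

coeff-+P : ∀ p q i → coeff (p +P q) i ≡ coeff p i +ℤ coeff q i
coeff-+P [] q i = sym (ℤₚ.+-identityˡ _)
coeff-+P (a ∷ p) [] i = sym (ℤₚ.+-identityʳ _)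
coeff-+P (a ∷ p) (b ∷ q) zero = refl
coeff-+P (a ∷ p) (b ∷ q) (suc i) = coeff-+P p q i

coeff-scaleP : ∀ c p i → coeff (scaleP c p) i ≡ c *ℤ coeff p i
coeff-scaleP c [] i = sym (ℤₚ.*-zeroʳ c)
coeff-scaleP c (a ∷ p) zero = refl
coeff-scaleP c (a ∷ p) (suc i) = coeff-scaleP c p i

coeff-*constP : ∀ p c i → coeff (p *P constP c) i ≡ coeff p i *ℤ c
coeff-*constP [] c i = refl
coeff-*constP (a ∷ p) c zero = ℤₚ.+-identityʳ _
coeff-*constP (a ∷ p) c (suc i) = coeff-*constP p c i

coeff-1*P : ∀ p i → coeff (constP (+ 1) *P p) i ≡ coeff p i
coeff-1*P p i = begin
  coeff (scaleP (+ 1) p +P (+ 0 ∷ [])) i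
    ≡⟨ coeff-+P (scaleP (+ 1) p) _ i ⟩
  coeff (scaleP (+ 1) p) i +ℤ coeff (+ 0 ∷ []) i
    ≡⟨ cong₂ _+ℤ_ (coeff-scaleP (+ 1) p i) (coeff-0 i) ⟩
  + 1 *ℤ coeff p i +ℤ + 0
    ≡⟨ ℤₚ.+-identityʳ _ ⟩
  + 1 *ℤ coeff p i
    ≡⟨ ℤₚ.*-identityˡ _ ⟩
  coeff p i ∎
  where
  open ≡-Reasoning
  coeff-0 : ∀ i → coeff (+ 0 ∷ []) i ≡ + 0
  coeff-0 zero = refl
  coeff-0 (suc i) = refl

coeff-[a+x]*P-zero : ∀ a p → coeff ((a ∷ + 1 ∷ []) *P p) 0 ≡ a *ℤ coeff p 0
coeff-[a+x]*P-zero a p =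
  trans (coeff-+P (scaleP a p) _ 0) (trans (ℤₚ.+-identityʳ _) (coeff-scaleP a p 0))

coeff-[a+x]*P-suc : ∀ a p i →
    coeff ((a ∷ + 1 ∷ []) *P p) (suc i) ≡ a *ℤ coeff p (suc i) +ℤ coeff p i
coeff-[a+x]*P-suc a p i =
  trans (coeff-+P (scaleP a p) _ (suc i)) (cong₂ _+ℤ_ (coeff-scaleP a p (suc i)) (coeff-1*P p i))

coeff-x^ : ∀ k i → coeff (varX ^P k) i ≡ ⟦ k ℕₚ.≟ i ⟧
coeff-x^ zero zero = refl
coeff-x^ zero (suc i) = refl
coeff-x^ (suc k) zero = coeff-[a+x]*P-zero (+ 0) (varX ^P k)
coeff-x^ (suc k) (suc i) =
  trans (coeff-[a+x]*P-suc (+ 0) (varX ^P k) i) (trans (ℤₚ.+-identityˡ _) (coeff-x^ k i))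

0^ : ∀ k → (+ 0) ^ℤ k ≡ ⟦ k ℕₚ.≟ 0 ⟧
0^ zero = refl
0^ (suc k) = refl

-- the coefficient of x^i in (x - 1)^u x^m
mixedCoeff : ℕ → ℕ → ℕ → ℤ
mixedCoeff zero m i = ⟦ m ℕₚ.≟ i ⟧
mixedCoeff (suc u) m i = mixedCoeff u (suc m) i -ℤ mixedCoeff u m i

mixedCoeff-zero : ∀ u m → mixedCoeff u (suc m) 0 ≡ + 0
mixedCoeff-zero zero m = refl
mixedCoeff-zero (suc u) m = cong₂ _-ℤ_ (mixedCoeff-zero u (suc m)) (mixedCoeff-zero u m)

mixedCoeff-suc : ∀ u m i → mixedCoeff u (suc m) (suc i) ≡ mixedCoeff u m i
mixedCoeff-suc zero m i = refl
mixedCoeff-suc (suc u) m i = cong₂ _-ℤ_ (mixedCoeff-suc u (suc m) i) (mixedCoeff-suc u m i)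

mixedCoeff-rec : ∀ u m i → mixedCoeff (suc u) m i +ℤ mixedCoeff u m i ≡ mixedCoeff u (suc m) i
mixedCoeff-rec u m i =
  solve 2 (λ a b → (a :- b) :+ b := a) refl (mixedCoeff u (suc m) i) (mixedCoeff u m i)
  where open +-*-Solver

mixedPower : ℤ → ℕ → ℕ → ℤ
mixedPower y u m = (y -ℤ + 1) ^ℤ u *ℤ y ^ℤ m

mixedPower-rec : ∀ y u m → mixedPower y (suc u) m +ℤ mixedPower y u m ≡ mixedPower y u (suc m)
mixedPower-rec y u m =
  solve 3 (λ y a b → ((y :- con (+ 1)) :* a) :* b :+ a :* b := a :* (y :* b)) refl
    y ((y -ℤ + 1) ^ℤ u) (y ^ℤ m)
  where open +-*-Solver

x-1 : Poly
x-1 = - + 1 ∷ + 1 ∷ []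

coeff-[x-1]^ : ∀ u i → coeff (x-1 ^P u) i ≡ mixedCoeff u 0 i
coeff-[x-1]^ zero zero = refl
coeff-[x-1]^ zero (suc i) = refl
coeff-[x-1]^ (suc u) zero = begin
  coeff (x-1 *P (x-1 ^P u)) 0               ≡⟨ coeff-[a+x]*P-zero (- + 1) (x-1 ^P u) ⟩
  - + 1 *ℤ coeff (x-1 ^P u) 0               ≡⟨ cong (- + 1 *ℤ_) (coeff-[x-1]^ u 0) ⟩
  - + 1 *ℤ mixedCoeff u 0 0                 ≡⟨ ℤₚ.-1*i≡-i _ ⟩
  - mixedCoeff u 0 0                        ≡⟨ ℤₚ.+-identityˡ _ ⟨
  + 0 -ℤ mixedCoeff u 0 0                   ≡⟨ cong (_-ℤ mixedCoeff u 0 0) (mixedCoeff-zero u 0) ⟨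
  mixedCoeff u 1 0 -ℤ mixedCoeff u 0 0      ∎
  where open ≡-Reasoning
coeff-[x-1]^ (suc u) (suc i) = begin
  coeff (x-1 *P (x-1 ^P u)) (suc i)
    ≡⟨ coeff-[a+x]*P-suc (- + 1) (x-1 ^P u) i ⟩
  - + 1 *ℤ coeff (x-1 ^P u) (suc i) +ℤ coeff (x-1 ^P u) i
    ≡⟨ cong₂ (λ a b → - + 1 *ℤ a +ℤ b) (coeff-[x-1]^ u (suc i)) (coeff-[x-1]^ u i) ⟩
  - + 1 *ℤ mixedCoeff u 0 (suc i) +ℤ mixedCoeff u 0 i
    ≡⟨ solve 2 (λ a b → con (- + 1) :* a :+ b := b :- a) refl
        (mixedCoeff u 0 (suc i)) (mixedCoeff u 0 i) ⟩
  mixedCoeff u 0 i -ℤ mixedCoeff u 0 (suc i)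
    ≡⟨ cong (_-ℤ mixedCoeff u 0 (suc i)) (mixedCoeff-suc u 0 i) ⟨
  mixedCoeff u 1 (suc i) -ℤ mixedCoeff u 0 (suc i) ∎
  where
  open ≡-Reasoning
  open +-*-Solver

sumOver : ∀ {A : Set} → (A → ℤ) → List A → ℤ
sumOver f xs = foldr _+ℤ_ (+ 0) (map f xs)

coeff-sumP : ∀ {A : Set} (f : A → Poly) xs i →
    coeff (sumP (map f xs)) i ≡ sumOver (λ x → coeff (f x) i) xs
coeff-sumP f [] i = refl
coeff-sumP f (x ∷ xs) i = trans (coeff-+P (f x) _ i) (cong (coeff (f x) i +ℤ_) (coeff-sumP f xs i))

module _ {A : Set} where

  sumOver-cong : ∀ {f g : A → ℤ} xs → (∀ {x} → x ∈ xs → f x ≡ g x) → sumOver f xs ≡ sumOver g xs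
  sumOver-cong [] h = refl
  sumOver-cong (x ∷ xs) h = cong₂ _+ℤ_ (h (here refl)) (sumOver-cong xs (h ∘ there))

  sumOver-+ : ∀ (f g : A → ℤ) xs → sumOver (λ x → f x +ℤ g x) xs ≡ sumOver f xs +ℤ sumOver g xs
  sumOver-+ f g [] = refl
  sumOver-+ f g (x ∷ xs) = trans (cong (f x +ℤ g x +ℤ_) (sumOver-+ f g xs))
    (solve 4 (λ a b c d → (a :+ b) :+ (c :+ d) := (a :+ c) :+ (b :+ d)) refl
      (f x) (g x) (sumOver f xs) (sumOver g xs))
    where open +-*-Solver

  sumOver-↭ : ∀ (f : A → ℤ) {xs ys} → xs ↭ ys → sumOver f xs ≡ sumOver f ys
  sumOver-↭ f xs↭ys =
    ↭ₛ.foldr-commMonoid (setoid ℤ) ℤₚ.+-0-isCommutativeMonoid (↭⇒↭ₛ (map⁺ f xs↭ys))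

  sumOver-∘ : ∀ (f : A → ℤ) (τ : A → A) xs → sumOver (f ∘ τ) xs ≡ sumOver f (map τ xs)
  sumOver-∘ f τ xs = cong (foldr _+ℤ_ (+ 0)) (Listₚ.map-∘ xs)

  sumOver-⟦⟧ : ∀ {P : A → Set} (P? : ∀ x → Dec (P x)) xs →
               sumOver (λ x → ⟦ P? x ⟧) xs ≡ + count (λ x → does (P? x)) xs
  sumOver-⟦⟧ P? [] = refl
  sumOver-⟦⟧ P? (x ∷ xs) with does (P? x) | sumOver-⟦⟧ P? xs
  ... | true | ih = cong (+ 1 +ℤ_) ih
  ... | false | ih = trans (ℤₚ.+-identityˡ _) ih

  -- Both sums are doubled, and x is paired with τ x.
  sumOver-involution : ∀ {f g : A → ℤ} {τ : A → A} {xs} → Unique xs → (∀ {x} → x ∈ xs → τ x ∈ xs) →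
    (∀ {x} → x ∈ xs → τ (τ x) ≡ x) → (∀ {x} → x ∈ xs → f x +ℤ f (τ x) ≡ g x +ℤ g (τ x)) →
    sumOver f xs ≡ sumOver g xs
  sumOver-involution {f} {g} {τ} {xs} u closed invol paired = ℤₚ.*-cancelˡ-≡ (+ 2) _ _ (begin
    + 2 *ℤ sumOver f xs                      ≡⟨ doubled f ⟩
    sumOver (λ x → f x +ℤ f (τ x)) xs        ≡⟨ sumOver-cong xs paired ⟩
    sumOver (λ x → g x +ℤ g (τ x)) xs        ≡⟨ doubled g ⟨
    + 2 *ℤ sumOver g xs                      ∎)
    where
    open ≡-Reasoning
    open +-*-Solver
    doubled : ∀ h → + 2 *ℤ sumOver h xs ≡ sumOver (λ x → h x +ℤ h (τ x)) xs
    doubled h = begin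
      + 2 *ℤ sumOver h xs
        ≡⟨ solve 1 (λ a → con (+ 2) :* a := a :+ a) refl (sumOver h xs) ⟩
      sumOver h xs +ℤ sumOver h xs
        ≡⟨ cong (sumOver h xs +ℤ_) (sumOver-↭ h (involution-↭ u closed invol)) ⟨
      sumOver h xs +ℤ sumOver h (map τ xs)
        ≡⟨ cong (sumOver h xs +ℤ_) (sumOver-∘ h τ xs) ⟨
      sumOver h xs +ℤ sumOver (h ∘ τ) xs
        ≡⟨ sumOver-+ h (h ∘ τ) xs ⟨
      sumOver (λ x → h x +ℤ h (τ x)) xs ∎

module _ {m : ℕ} where

  private
    extend : List (Vec Bool m) → List (Vec Bool (suc m))
    extend = concatMap (λ v → (false ∷ v) ∷ (true ∷ v) ∷ [])

  ∈-extend⁺ : ∀ b {v : Vec Bool m} {vs} → v ∈ vs → (b ∷ v) ∈ extend vs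
  ∈-extend⁺ false (here refl) = here refl
  ∈-extend⁺ true (here refl) = there (here refl)
  ∈-extend⁺ b (there v∈vs) = there (there (∈-extend⁺ b v∈vs))

  ∈-extend⁻ : ∀ b {v : Vec Bool m} vs → (b ∷ v) ∈ extend vs → v ∈ vs
  ∈-extend⁻ b (w ∷ vs) (here refl) = here refl
  ∈-extend⁻ b (w ∷ vs) (there (here refl)) = here refl
  ∈-extend⁻ b (w ∷ vs) (there (there i)) = there (∈-extend⁻ b vs i)

  extend-unique : ∀ {vs} → Unique vs → Unique (extend vs)
  extend-unique [] = []
  extend-unique {v ∷ vs} (v∉vs ∷ u) =
    ((λ ()) ∷ All.tabulate (fresh false)) ∷ All.tabulate (fresh true) ∷ extend-unique u
    where
    fresh : ∀ b {w} → w ∈ extend vs → (b ∷ v) ≢ w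
    fresh b i refl = All.lookup v∉vs (∈-extend⁻ b vs i) refl

∈-allVecs : ∀ {m} (v : Vec Bool m) → v ∈ allVecs m
∈-allVecs [] = here refl
∈-allVecs (b ∷ v) = ∈-extend⁺ b (∈-allVecs v)

allVecs-unique : ∀ m → Unique (allVecs m)
allVecs-unique zero = [] ∷ []
allVecs-unique (suc m) = extend-unique (allVecs-unique m)

module HalfEdges {n : ℕ} (M : RootedMap n) where
  open RootedMap M
  open MapDefs M

  ==-refl : ∀ x → (x == x) ≡ true
  ==-refl x with x Finₚ.≟ x
  ... | yes _ = refl
  ... | no x≢x = contradiction refl x≢x

  ==⇒≡ : ∀ {x y} → (x == y) ≡ true → x ≡ y
  ==⇒≡ {x} {y} e with x Finₚ.≟ y
  ... | yes x≡y = x≡y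

  αα⁺ : ∀ {h} (P : Fin n → Set) → P h → P (α (α h))
  αα⁺ {h} P = subst P (sym (α-invol h))

  αα⁻ : ∀ {h} (P : Fin n → Set) → P (α (α h)) → P h
  αα⁻ {h} P = subst P (α-invol h)

  α-injective : ∀ {x y} → α x ≡ α y → x ≡ y
  α-injective {x} {y} e = trans (sym (α-invol x)) (trans (cong α e) (α-invol y))

  σ-injective : ∀ {x y} → σf x ≡ σf y → x ≡ y
  σ-injective e = trans (sym (inverseˡ σ)) (trans (cong (σ ⟨$⟩ˡ_) e) (inverseˡ σ))

  sameEdge⁻ : ∀ x e → sameEdge x e ≡ true → x ≡ e ⊎ x ≡ α e
  sameEdge⁻ x e p with ∨-elim (x == e) p
  ... | inj₁ q = inj₁ (==⇒≡ q)
  ... | inj₂ q = inj₂ (==⇒≡ q)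

  sameEdge-refl : ∀ e → sameEdge e e ≡ true
  sameEdge-refl e = ∨-introˡ (==-refl e)

  α-sameEdge : ∀ e → sameEdge (α e) e ≡ true
  α-sameEdge e = ∨-introʳ (α e == e) (==-refl (α e))

  ≢⇒¬sameEdge : ∀ {x e} → x ≢ e → x ≢ α e → sameEdge x e ≡ false
  ≢⇒¬sameEdge {x} {e} x≢e x≢αe = ¬-not λ p → [ x≢e , x≢αe ]′ (sameEdge⁻ x e p)

  ¬sameEdge⇒≢ : ∀ x e → sameEdge x e ≡ false → x ≢ e × x ≢ α e
  ¬sameEdge⇒≢ x e p = (λ { refl → not-¬ (sameEdge-refl e) p }) , λ { refl → not-¬ (α-sameEdge e) p }

  sameEdge-αʳ : ∀ x e → sameEdge x (α e) ≡ sameEdge x e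
  sameEdge-αʳ x e rewrite α-invol e = 𝔹ₚ.∨-comm (x == α e) (x == e)

  sameEdge-sym : ∀ x e → sameEdge x e ≡ true → sameEdge e x ≡ true
  sameEdge-sym x e p with sameEdge⁻ x e p
  ... | inj₁ refl = sameEdge-refl x
  ... | inj₂ refl =
    trans (sym (sameEdge-αʳ e (α e))) (trans (cong (sameEdge e) (α-invol e)) (sameEdge-refl e))

  sameEdge-comm : ∀ x e → sameEdge x e ≡ sameEdge e x
  sameEdge-comm x e = ≡-via-true (sameEdge-sym x e) (sameEdge-sym e x)

  sameEdge-αˡ : ∀ x e → sameEdge (α x) e ≡ sameEdge x e
  sameEdge-αˡ x e = trans (sameEdge-comm (α x) e) (trans (sameEdge-αʳ e x) (sameEdge-comm e x))

  sameEdge-congʳ : ∀ e f → sameEdge e f ≡ true → ∀ x → sameEdge x e ≡ sameEdge x f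
  sameEdge-congʳ e f p x with sameEdge⁻ e f p
  ... | inj₁ refl = refl
  ... | inj₂ refl = sameEdge-αʳ x f

  module σ-Orbits = Orbits σf σ-injective

  infix 4 _≈_

  record _≈_ (x y : Fin n) : Set where
    constructor mk≈
    field sameV≡true : sameV x y ≡ true
  open _≈_ public

  ≈⇒Orbit : ∀ {x y} → x ≈ y → Orbit σf x y
  ≈⇒Orbit {x} {y} (mk≈ e) = let k , _ , p = any-true⁻ _ (upTo n) e in k , ==⇒≡ p

  Orbit⇒≈ : ∀ {x y} → Orbit σf x y → x ≈ y
  Orbit⇒≈ {x} o with k , k<n , refl ← σ-Orbits.orbit-bounded o =
    mk≈ (any-true⁺ (λ j → iter σf j x == iter σf k x) (∈-upTo⁺ k<n) (==-refl _))

  ≈-refl : ∀ {x} → x ≈ x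
  ≈-refl = Orbit⇒≈ orbit-refl

  ≈-sym : ∀ {x y} → x ≈ y → y ≈ x
  ≈-sym x≈y = Orbit⇒≈ (σ-Orbits.orbit-sym (≈⇒Orbit x≈y))

  ≈-trans : ∀ {x y z} → x ≈ y → y ≈ z → x ≈ z
  ≈-trans x≈y y≈z = Orbit⇒≈ (orbit-trans (≈⇒Orbit x≈y) (≈⇒Orbit y≈z))

  x≈σx : ∀ x → x ≈ σf x
  x≈σx x = Orbit⇒≈ orbit-step

  x≈σ⁻¹x : ∀ x → x ≈ σ ⟨$⟩ˡ x
  x≈σ⁻¹x x = ≈-sym (subst (σ ⟨$⟩ˡ x ≈_) (inverseʳ σ) (x≈σx (σ ⟨$⟩ˡ x)))

  α-Invariant : (Fin n → Bool) → Set
  α-Invariant p = ∀ h → p h ≡ p (α h)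

  Halving : (Fin n → Bool) → Set
  Halving c = ∀ h → c (α h) ≡ not (c h)

  edgeCount : (Fin n → Bool) → ℕ
  edgeCount p = count (λ h → p h ∧ (toℕ h <ᵇ toℕ (α h))) H

  halving-via : ∀ (ρ : Fin n → ℕ) → (∀ {x y} → ρ x ≡ ρ y → x ≡ y) → Halving (λ h → ρ h <ᵇ ρ (α h))
  halving-via ρ ρ-injective h rewrite α-invol h with <-cmp (ρ h) (ρ (α h))
  ... | tri< lt _ _ = trans (≥⇒<ᵇ≡false (<⇒≤ lt)) (cong not (sym (<⇒<ᵇ≡true lt)))
  ... | tri≈ _ e _ = contradiction (sym (ρ-injective e)) (α-fpf h)
  ... | tri> _ _ gt = trans (<⇒<ᵇ≡true gt) (cong not (sym (≥⇒<ᵇ≡false (<⇒≤ gt))))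

  canonical : Fin n → Bool
  canonical h = toℕ h <ᵇ toℕ (α h)

  canonical-halving : Halving canonical
  canonical-halving = halving-via toℕ Finₚ.toℕ-injective

  count-halving : ∀ {p c} → α-Invariant p → Halving c → count p H ≡ 2 * count (λ h → p h ∧ c h) H
  count-halving {p} {c} p-inv c-half = begin
    count p H
      ≡⟨ count-split p c H ⟩
    k + count (λ h → p h ∧ not (c h)) H
      ≡⟨ cong (λ j → k + j) (count-cong H λ {h} _ → cong₂ _∧_ (p-inv h) (sym (c-half h))) ⟩
    k + count (λ h → p (α h) ∧ c (α h)) H
      ≡⟨ cong (λ j → k + j) (count-map (λ h → p h ∧ c h) α H) ⟨
    k + count (λ h → p h ∧ c h) (map α H)
      ≡⟨ cong (λ j → k + j) (count-↭ _ α-↭) ⟩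
    k + k
      ≡⟨ cong (λ j → k + j) (+-identityʳ k) ⟨
    2 * k ∎
    where
    open ≡-Reasoning
    k : ℕ
    k = count (λ h → p h ∧ c h) H
    α-↭ : map α H ↭ H
    α-↭ = involution-↭ unique-allFin (λ {h} _ → ∈-allFin (α h)) (λ {h} _ → α-invol h)

  edgeCount-via : ∀ {p c} → α-Invariant p → Halving c → edgeCount p ≡ count (λ h → p h ∧ c h) H
  edgeCount-via p-inv c-half = ℕₚ.*-cancelˡ-≡ _ _ 2
    (trans (sym (count-halving p-inv canonical-halving)) (count-halving p-inv c-half))

  edgeCount-cong : ∀ {p q} → (∀ h → p h ≡ q h) → edgeCount p ≡ edgeCount q
  edgeCount-cong p≗q = count-cong H λ {h} _ → cong (_∧ canonical h) (p≗q h)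

  edgeCount-split : ∀ p q →
      edgeCount p ≡ edgeCount (λ h → p h ∧ q h) + edgeCount (λ h → p h ∧ not (q h))
  edgeCount-split p q = trans (count-split (λ h → p h ∧ canonical h) q H)
    (cong₂ _+_ (count-cong H λ {h} _ → ∧-swapʳ (p h) (canonical h) (q h))
               (count-cong H λ {h} _ → ∧-swapʳ (p h) (canonical h) (not (q h))))
    where
    ∧-swapʳ : ∀ a b c → (a ∧ b) ∧ c ≡ (a ∧ c) ∧ b
    ∧-swapʳ a b c =
      trans (𝔹ₚ.∧-assoc a b c) (trans (cong (a ∧_) (𝔹ₚ.∧-comm b c)) (sym (𝔹ₚ.∧-assoc a c b)))

  edgeCount≡0⁺ : ∀ {p} → (∀ h → p h ≡ false) → edgeCount p ≡ 0
  edgeCount≡0⁺ ¬p = count≡0⁺ _ H λ {h} _ → cong (_∧ canonical h) (¬p h)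

  edgeCount≡0⁻ : ∀ {p} → α-Invariant p → edgeCount p ≡ 0 → ∀ h → p h ≡ false
  edgeCount≡0⁻ {p} p-inv e h = count≡0⁻ p
    (trans (count-halving p-inv canonical-halving) (cong (λ k → 2 * k) e)) (∈-allFin h)

  edgeCount-sameEdge : ∀ e → edgeCount (λ h → sameEdge h e) ≡ 1
  edgeCount-sameEdge e = [ canonical-case e , other-case ]′ (true⊎false (canonical e))
    where
    canonical-case : ∀ e → canonical e ≡ true → edgeCount (λ h → sameEdge h e) ≡ 1
    canonical-case e c = count≡1 _ unique-allFin (∈-allFin e) (cong₂ _∧_ (sameEdge-refl e) c) only-e
      where
      only-e : ∀ {h} → sameEdge h e ∧ canonical h ≡ true → h ≡ e
      only-e {h} p with sameEdge⁻ h e (∧-conicalˡ _ _ p)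
      ... | inj₁ h≡e = h≡e
      ... | inj₂ refl = contradiction (trans (canonical-halving e) (cong not c))
                          (not-¬ (∧-conicalʳ (sameEdge h e) _ p))
    other-case : canonical e ≡ false → edgeCount (λ h → sameEdge h e) ≡ 1
    other-case ¬c = trans (edgeCount-cong λ h → sym (sameEdge-αʳ h e))
      (canonical-case (α e) (trans (canonical-halving e) (cong not ¬c)))

module Reachability {n : ℕ} (M : RootedMap n) where
  open RootedMap M
  open MapDefs M
  open HalfEdges M

  -- The bounded closure is already transitively closed, because the reached set gains an
  -- element at every step until it stabilises.
  module _ (st : Fin n → Fin n → Bool) where

    closure-induction : ∀ {h} (P : Fin n → Set) → P h → (∀ {x y} → P x → st x y ≡ true → P y) →
                        ∀ k {x} → closure st k h x ≡ true → P x
    closure-induction P Ph step zero e = subst P (==⇒≡ e) Ph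
    closure-induction {h} P Ph step (suc k) {x} e with ∨-elim (closure st k h x) e
    ... | inj₁ p = closure-induction P Ph step k p
    ... | inj₂ p = let y , q = any-allFin⁻ (λ m → closure st k h m ∧ st m x) p in
      step (closure-induction P Ph step k (∧-conicalˡ _ _ q)) (∧-conicalʳ (closure st k h y) _ q)

    closure-+ : ∀ {h x} d k → closure st k h x ≡ true → closure st (d + k) h x ≡ true
    closure-+ zero k p = p
    closure-+ (suc d) k p = ∨-introˡ (closure-+ d k p)

    closure-mono : ∀ {h x j} k → j ≤ k → closure st j h x ≡ true → closure st k h x ≡ true
    closure-mono {h} {x} {j} k j≤k p =
      subst (λ i → closure st i h x ≡ true) (ℕₚ.m∸n+n≡m j≤k) (closure-+ (k ∸ j) j p)

    closure-refl : ∀ k h → closure st k h h ≡ true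
    closure-refl zero h = ==-refl h
    closure-refl (suc k) h = ∨-introˡ (closure-refl k h)

    closure-snoc : ∀ {h x y} k → closure st k h x ≡ true → st x y ≡ true →
        closure st (suc k) h y ≡ true
    closure-snoc {h} {x} {y} k p q = ∨-introʳ (closure st k h y) (any-allFin⁺ _ x (cong₂ _∧_ p q))

    reach-refl : ∀ h → reach st h h ≡ true
    reach-refl = closure-refl n

    reach-induction : ∀ {h} (P : Fin n → Set) → P h → (∀ {x y} → P x → st x y ≡ true → P y) →
                      ∀ {x} → reach st h x ≡ true → P x
    reach-induction P Ph step = closure-induction P Ph step n

    module _ (h : Fin n) where

      Stable : ℕ → Set
      Stable k = ∀ {x y} → closure st k h x ≡ true → st x y ≡ true → closure st k h y ≡ true

      not-new : ℕ → Fin n → Bool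
      not-new k x = not (closure st (suc k) h x) ∨ closure st k h x

      stabilises-or-grows : ∀ k → (∃ λ j → j ≤ k × Stable j) ⊎ k < count (closure st k h) H
      stabilises-or-grows zero = inj₂ (count>0 (closure st 0 h) (∈-allFin h) (==-refl h))
      stabilises-or-grows (suc k) with stabilises-or-grows k
      ... | inj₁ (j , j≤k , stable) = inj₁ (j , ℕₚ.m≤n⇒m≤1+n j≤k , stable)
      ... | inj₂ k< with true⊎false (all (not-new k) H)
      ... | inj₁ none-new = inj₁ (k , ℕₚ.n≤1+n k ,
              λ p q → not-∨-elim (all-allFin⁻ (not-new k) none-new _) (closure-snoc k p q))
      ... | inj₂ some-new =
        let x , _ , e = all-false⁻ (not-new k) H some-new ; new , old = not-∨-false e in
              inj₂ (≤-<-trans k< (count-strict-mono H ∨-introˡ (∈-allFin x) old new))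

      closure⇒reach : ∀ {x} k → closure st k h x ≡ true → reach st h x ≡ true
      closure⇒reach k p with stabilises-or-grows n
      ... | inj₂ n< = contradiction (count-allFin-≤ (closure st n h)) (ℕₚ.<⇒≱ n<)
      ... | inj₁ (j , j≤n , stable) = closure-mono n j≤n
        (closure-induction (λ y → closure st j h y ≡ true) (closure-refl j h) stable k p)

    reach-trans : ∀ {x y z} → reach st x y ≡ true → reach st y z ≡ true → reach st x z ≡ true
    reach-trans {x} p = reach-induction (λ z → reach st x z ≡ true) p
      λ q s → closure⇒reach x (suc n) (closure-snoc n q s)

    reach-step : ∀ {x y} → st x y ≡ true → reach st x y ≡ true
    reach-step {x} s = closure⇒reach x 1 (closure-snoc 0 (==-refl x) s)

  infix 4 _∈ˢ_ _∉ˢ_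

  _∈ˢ_ _∉ˢ_ : Fin n → Vec Bool n → Set
  h ∈ˢ A = lookup A h ≡ true
  h ∉ˢ A = lookup A h ≡ false

  -- An undirected and a directed step are the same relation, applied to a subgraph and to the
  -- tails of an orientation respectively.
  opaque
    canReach : Vec Bool n → Fin n → Fin n → Bool
    canReach A = reach (ustep A)

    numComp≡numClasses : ∀ S → numComp S ≡ numClasses (canReach S)
    numComp≡numClasses S = refl

    reachD≡canReach : ∀ O x y → reachD O x y ≡ canReach O x y
    reachD≡canReach O x y = refl

  infix 4 _⊢_⟶_

  _⊢_⟶_ : Vec Bool n → Fin n → Fin n → Set
  A ⊢ x ⟶ y = canReach A x y ≡ true

  module _ {A : Vec Bool n} where

    opaque
      unfolding canReach

      ⟶-refl : ∀ {x} → A ⊢ x ⟶ x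
      ⟶-refl = reach-refl (ustep A) _

      ⟶-trans : ∀ {x y z} → A ⊢ x ⟶ y → A ⊢ y ⟶ z → A ⊢ x ⟶ z
      ⟶-trans = reach-trans (ustep A)

      ≈⇒⟶ : ∀ {x y} → x ≈ y → A ⊢ x ⟶ y
      ≈⇒⟶ x≈y = reach-step (ustep A) (∨-introˡ (sameV≡true x≈y))

      ∈⇒⟶α : ∀ {x} → x ∈ˢ A → A ⊢ x ⟶ α x
      ∈⇒⟶α {x} x∈A = reach-step (ustep A) (∨-introʳ (sameV x (α x)) (cong₂ _∧_ x∈A (==-refl (α x))))

      ⟶-induction : ∀ {x} (P : Fin n → Set) → P x → (∀ {y z} → P y → y ≈ z → P z) →
                    (∀ {y} → P y → y ∈ˢ A → P (α y)) → ∀ {y} → A ⊢ x ⟶ y → P y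
      ⟶-induction P Px vertex edge = reach-induction (ustep A) P Px step
        where
        step : ∀ {y z} → P y → ustep A y z ≡ true → P z
        step {y} {z} Py e with ∨-elim (sameV y z) e
        ... | inj₁ s = vertex Py (mk≈ s)
        ... | inj₂ c = subst P (==⇒≡ (∧-conicalʳ (lookup A y) _ c)) (edge Py (∧-conicalˡ _ _ c))

    ⟶-≈ : ∀ {x y z} → A ⊢ x ⟶ y → y ≈ z → A ⊢ x ⟶ z
    ⟶-≈ x⟶y y≈z = ⟶-trans x⟶y (≈⇒⟶ y≈z)

    ⟶-α : ∀ {x y} → A ⊢ x ⟶ y → y ∈ˢ A → A ⊢ x ⟶ α y
    ⟶-α x⟶y y∈A = ⟶-trans x⟶y (∈⇒⟶α y∈A)

    α∈⇒⟶ : ∀ {x} → α x ∈ˢ A → A ⊢ α x ⟶ x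
    α∈⇒⟶ {x} αx∈A = αα⁻ (A ⊢ α x ⟶_) (∈⇒⟶α αx∈A)

    canReach-≈ : ∀ {x y z} → y ≈ z → canReach A x y ≡ canReach A x z
    canReach-≈ y≈z = ≡-via-true (λ p → ⟶-≈ p y≈z) (λ p → ⟶-≈ p (≈-sym y≈z))

  ⟶-mono : ∀ {A B} → (∀ {x} → x ∈ˢ A → x ∈ˢ B) → ∀ {x y} → A ⊢ x ⟶ y → B ⊢ x ⟶ y
  ⟶-mono {B = B} A⊆B {x} = ⟶-induction (B ⊢ x ⟶_) ⟶-refl ⟶-≈ (λ p y∈A → ⟶-α p (A⊆B y∈A))

  record Subgraph (S : Vec Bool n) : Set where
    constructor mkSubgraph
    field lookup-α : α-Invariant (lookup S)

    α∈ : ∀ {h} → h ∈ˢ S → α h ∈ˢ S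
    α∈ {h} h∈S = trans (sym (lookup-α h)) h∈S

    α∉ : ∀ {h} → h ∉ˢ S → α h ∉ˢ S
    α∉ {h} h∉S = trans (sym (lookup-α h)) h∉S
  open Subgraph public

  isSubgraph⁻ : ∀ {S} → isSubgraph S ≡ true → Subgraph S
  isSubgraph⁻ {S} p = mkSubgraph λ h → ¬xor⇒≡ (not-injective (all-allFin⁻ _ p h))

  isSubgraph⁺ : ∀ {S} → Subgraph S → isSubgraph S ≡ true
  isSubgraph⁺ {S} S-sub = all-allFin⁺ _ λ h →
    cong not (trans (cong (_xor lookup S (α h)) (lookup-α S-sub h)) (𝔹ₚ.xor-same (lookup S (α h))))

  ⟶-sym : ∀ {S} → Subgraph S → ∀ {x y} → S ⊢ x ⟶ y → S ⊢ y ⟶ x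
  ⟶-sym {S} S-sub {x} = ⟶-induction (S ⊢_⟶ x) ⟶-refl
    (λ p y≈z → ⟶-trans (≈⇒⟶ (≈-sym y≈z)) p)
    (λ p y∈S → ⟶-trans (α∈⇒⟶ (α∈ S-sub y∈S)) p)

module Components {n : ℕ} (M : RootedMap n) where
  open RootedMap M
  open MapDefs M
  open HalfEdges M
  open Reachability M

  module Classes {r : Fin n → Fin n → Bool} (r-equivalence : IsEquivalence (λ x y → r x y ≡ true))
    where
    private module r = IsEquivalence r-equivalence

    isLeast : Fin n → Bool
    isLeast h = all (λ h' → not (r h h') ∨ (toℕ h ≤ᵇ toℕ h')) H

    representatives : List (Fin n)
    representatives = filterᵇ isLeast H

    representative : ∀ x → ∃ λ m → m ∈ representatives × r m x ≡ true
    representative x =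
      m , ∈-filterᵇ⁺ isLeast (∈-allFin m) (all-allFin⁺ _ λ y → not-∨-intro (m≤ y)) , r.sym rxm
      where
      class : List (Fin n)
      class = filterᵇ (r x) H
      m : Fin n
      m = argmin toℕ x class
      rxm : r x m ≡ true
      rxm =
        argmin-all toℕ {P = λ y → r x y ≡ true} r.refl
          (All.tabulate λ i → proj₂ (∈-filterᵇ⁻ (r x) H i))
      m≤ : ∀ y → r m y ≡ true → (toℕ m ≤ᵇ toℕ y) ≡ true
      m≤ y rmy =
        ≤⇒≤ᵇ≡true (All.lookup (f[argmin]≤f[xs] {f = toℕ} x class)
          (∈-filterᵇ⁺ (r x) (∈-allFin y) (r.trans rxm rmy)))

    representatives-unrelated : ∀ {x y} → x ∈ representatives → y ∈ representatives → r x y ≡ true →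
        x ≡ y
    representatives-unrelated i j rxy =
      Finₚ.toℕ-injective (≤-antisym (least i rxy) (least j (r.sym rxy)))
      where
      least : ∀ {x y} → x ∈ representatives → r x y ≡ true → toℕ x ≤ toℕ y
      least {y = y} i rxy =
        ≤ᵇ≡true⇒≤ (not-∨-elim (all-allFin⁻ _ (proj₂ (∈-filterᵇ⁻ isLeast H i)) y) rxy)

    representatives-separated : AllPairs (λ x y → r x y ≢ true) representatives
    representatives-separated = unique⇒AllPairs (unique-filterᵇ isLeast unique-allFin)
      λ i j x≢y rxy → x≢y (representatives-unrelated i j rxy)

    private
      -- Sending each element of L to a related element of K is injective.
      separated-≤-covering : ∀ {L K} → AllPairs (λ x y → r x y ≢ true) L →
                             (∀ x → ∃ λ m → m ∈ K × r m x ≡ true) → length L ≤ length K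
      separated-≤-covering {L} {K} separated cover = subst (_≤ length K) (Listₚ.length-map to L)
        (unique-⊆⇒length-≤ (AllPairsₚ.map⁺ (AllPairs.map distinct separated)) to⊆K)
        where
        to : Fin n → Fin n
        to x = proj₁ (cover x)
        distinct : ∀ {x y} → r x y ≢ true → to x ≢ to y
        distinct {x} {y} ¬rxy e = ¬rxy (r.trans (r.sym (proj₂ (proj₂ (cover x))))
          (subst (λ m → r m y ≡ true) (sym e) (proj₂ (proj₂ (cover y)))))
        to⊆K : map to L ⊆ K
        to⊆K i with x , _ , refl ← ∈-map⁻ to i = proj₁ (proj₂ (cover x))

    numClasses-≤ : ∀ {L} → (∀ x → ∃ λ m → m ∈ L × r m x ≡ true) → numClasses r ≤ length L
    numClasses-≤ = separated-≤-covering representatives-separated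

    ≤-numClasses : ∀ {L} → AllPairs (λ x y → r x y ≢ true) L → length L ≤ numClasses r
    ≤-numClasses separated = separated-≤-covering separated representative

  numClasses-cong : ∀ {r r′} → (∀ x y → r x y ≡ r′ x y) → numClasses r ≡ numClasses r′
  numClasses-cong r≗r′ = count-cong H λ {x} _ →
    all-cong (λ y → cong (λ b → not b ∨ (toℕ x ≤ᵇ toℕ y)) (r≗r′ x y)) H

  ⟶-equivalence : ∀ {S} → Subgraph S → IsEquivalence (S ⊢_⟶_)
  ⟶-equivalence S-sub = record { refl = ⟶-refl ; sym = ⟶-sym S-sub ; trans = ⟶-trans }

  module ComponentsOf {S : Vec Bool n} (S-sub : Subgraph S) where
    private module C = Classes (⟶-equivalence S-sub)
    open C public using
      (representatives; representative; representatives-unrelated; representatives-separated)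

    numComp-≤ : ∀ {L} → (∀ x → ∃ λ m → m ∈ L × S ⊢ m ⟶ x) → numComp S ≤ length L
    numComp-≤ {L} cover = subst (_≤ length L) (sym (numComp≡numClasses S)) (C.numClasses-≤ cover)

    ≤-numComp : ∀ {L} → AllPairs (λ x y → ¬ S ⊢ x ⟶ y) L → length L ≤ numComp S
    ≤-numComp {L} separated =
      subst (length L ≤_) (sym (numComp≡numClasses S)) (C.≤-numClasses separated)

    length-representatives : length representatives ≡ numComp S
    length-representatives = sym (numComp≡numClasses S)

  Connected : Vec Bool n → Set
  Connected S = ∀ {x y} → S ⊢ x ⟶ y

  numComp≤1⇒connected : ∀ {S} → Subgraph S → numComp S ≤ 1 → Connected S
  numComp≤1⇒connected S-sub ≤1 = ¬-not λ ¬x⟶y →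
    contradiction ≤1 (ℕₚ.<⇒≱ (ComponentsOf.≤-numComp S-sub ((not-¬ ¬x⟶y ∷ []) ∷ [] ∷ [])))

  connected⇒numComp≤1 : ∀ {S} → Subgraph S → Connected S → numComp S ≤ 1
  connected⇒numComp≤1 S-sub connected =
    ComponentsOf.numComp-≤ S-sub {h₀ ∷ []} (λ _ → h₀ , here refl , connected)

  numComp≥1 : ∀ {S} → Subgraph S → 1 ≤ numComp S
  numComp≥1 S-sub = ComponentsOf.≤-numComp S-sub {h₀ ∷ []} ([] ∷ [])

  infixl 6 _∖_

  _∖_ : Vec Bool n → Fin n → Vec Bool n
  S ∖ e = tabulate λ h → lookup S h ∧ not (sameEdge h e)

  lookup-∖ : ∀ S e h → lookup (S ∖ e) h ≡ lookup S h ∧ not (sameEdge h e)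
  lookup-∖ S e = lookup∘tabulate _

  lookup-∖-other : ∀ S e {h} → sameEdge h e ≡ false → lookup (S ∖ e) h ≡ lookup S h
  lookup-∖-other S e {h} h≁e =
    trans (lookup-∖ S e h) (trans (cong (λ b → lookup S h ∧ not b) h≁e) (∧-identityʳ _))

  ∉-∖ : ∀ S e h → sameEdge h e ≡ true → h ∉ˢ S ∖ e
  ∉-∖ S e h h∼e = trans (lookup-∖ S e h) (trans (cong (λ b → lookup S h ∧ not b) h∼e) (∧-zeroʳ _))

  ∈-∖⁻ : ∀ S e {h} → h ∈ˢ S ∖ e → h ∈ˢ S × sameEdge h e ≡ false
  ∈-∖⁻ S e {h} p = ∧-conicalˡ _ _ q , not-injective (∧-conicalʳ (lookup S h) _ q)
    where
    q : lookup S h ∧ not (sameEdge h e) ≡ true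
    q = trans (sym (lookup-∖ S e h)) p

  ∈-∖⁺ : ∀ S e {h} → h ∈ˢ S → sameEdge h e ≡ false → h ∈ˢ S ∖ e
  ∈-∖⁺ S e h∈S h≁e = trans (lookup-∖-other S e h≁e) h∈S

  ∖-subgraph : ∀ {S} e → Subgraph S → Subgraph (S ∖ e)
  ∖-subgraph {S} e S-sub = mkSubgraph λ h → begin
    lookup (S ∖ e) h
      ≡⟨ lookup-∖ S e h ⟩
    lookup S h ∧ not (sameEdge h e)
      ≡⟨ cong₂ (λ a b → a ∧ not b) (lookup-α S-sub h) (sym (sameEdge-αˡ h e)) ⟩
    lookup S (α h) ∧ not (sameEdge (α h) e)
      ≡⟨ lookup-∖ S e (α h) ⟨
    lookup (S ∖ e) (α h) ∎
    where open ≡-Reasoning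

  ∈-sameEdge : ∀ {S} → Subgraph S → ∀ {h e} → sameEdge h e ≡ true → e ∈ˢ S → h ∈ˢ S
  ∈-sameEdge S-sub {h} {e} h∼e e∈S with sameEdge⁻ h e h∼e
  ... | inj₁ refl = e∈S
  ... | inj₂ refl = α∈ S-sub e∈S

  numE-∖ : ∀ {S} → Subgraph S → ∀ {e} → e ∈ˢ S → numE S ≡ suc (numE (S ∖ e))
  numE-∖ {S} S-sub {e} e∈S = begin
    numE S
      ≡⟨ edgeCount-split (lookup S) (λ h → sameEdge h e) ⟩
    edgeCount (λ h → lookup S h ∧ sameEdge h e)
      + edgeCount (λ h → lookup S h ∧ not (sameEdge h e))
        ≡⟨ cong₂ _+_ (edgeCount-cong on-e) (edgeCount-cong λ h → sym (lookup-∖ S e h)) ⟩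
    edgeCount (λ h → sameEdge h e) + numE (S ∖ e)
      ≡⟨ cong (_+ numE (S ∖ e)) (edgeCount-sameEdge e) ⟩
    suc (numE (S ∖ e)) ∎
    where
    open ≡-Reasoning
    on-e : ∀ h → lookup S h ∧ sameEdge h e ≡ sameEdge h e
    on-e h with sameEdge h e in h∼e
    ... | true = trans (∧-identityʳ _) (∈-sameEdge S-sub h∼e e∈S)
    ... | false = ∧-zeroʳ _

  ∖-induction : (P : Vec Bool n → Set) → (∀ {S} → Subgraph S → (∀ {e} → e ∈ˢ S → P (S ∖ e)) → P S) →
                ∀ {S} → Subgraph S → P S
  ∖-induction P step {S} = WF.All.wfRec (On.wellFounded numE <-wellFounded) _
    (λ S → Subgraph S → P S)
    (λ S smaller S-sub → step S-sub λ {e} e∈S →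
      smaller (≤-reflexive (sym (numE-∖ S-sub e∈S))) (∖-subgraph e S-sub))
    S

  edge-or-edgeless : ∀ S → (∃ λ e → e ∈ˢ S) ⊎ (∀ h → h ∉ˢ S)
  edge-or-edgeless S with true⊎false (any (lookup S) H)
  ... | inj₁ some = inj₁ (any-allFin⁻ (lookup S) some)
  ... | inj₂ none = inj₂ λ h → ¬-not λ h∈S → not-¬ (any-allFin⁺ (lookup S) h h∈S) none

  ⟶-edgeless : ∀ S → (∀ h → h ∉ˢ S) → ∀ {x y} → S ⊢ x ⟶ y → x ≈ y
  ⟶-edgeless S none {x} =
    ⟶-induction (x ≈_) ≈-refl ≈-trans λ {y} _ y∈S → contradiction (none y) (not-¬ y∈S)

  numComp-edgeless : ∀ S → (∀ h → h ∉ˢ S) → numComp S ≡ numV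
  numComp-edgeless S none = trans (numComp≡numClasses S) (numClasses-cong λ x y →
    ≡-via-true (λ x⟶y → sameV≡true (⟶-edgeless S none x⟶y)) (λ x≈y → ≈⇒⟶ (mk≈ x≈y)))

  module EdgeRemoval {S : Vec Bool n} (S-sub : Subgraph S) (e : Fin n) where
    private
      S∖e-sub : Subgraph (S ∖ e)
      S∖e-sub = ∖-subgraph e S-sub

    ∖-⊆ : ∀ {x y} → S ∖ e ⊢ x ⟶ y → S ⊢ x ⟶ y
    ∖-⊆ = ⟶-mono (proj₁ ∘ ∈-∖⁻ S e)

    AtEnd : Fin n → Set
    AtEnd y = S ∖ e ⊢ e ⟶ y ⊎ S ∖ e ⊢ α e ⟶ y

    atEnd-⟶ : ∀ {y z} → AtEnd y → S ∖ e ⊢ y ⟶ z → AtEnd z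
    atEnd-⟶ (inj₁ p) q = inj₁ (⟶-trans p q)
    atEnd-⟶ (inj₂ p) q = inj₂ (⟶-trans p q)

    atEnd-sameEdge : ∀ {h} → sameEdge h e ≡ true → AtEnd h
    atEnd-sameEdge {h} h∼e with sameEdge⁻ h e h∼e
    ... | inj₁ refl = inj₁ ⟶-refl
    ... | inj₂ refl = inj₂ ⟶-refl

    ⟶-split : ∀ {x y} → S ⊢ x ⟶ y → S ∖ e ⊢ x ⟶ y ⊎ (AtEnd x × AtEnd y)
    ⟶-split {x} =
      ⟶-induction (λ y → S ∖ e ⊢ x ⟶ y ⊎ (AtEnd x × AtEnd y)) (inj₁ ⟶-refl)
        (λ p y≈z → extend p (≈⇒⟶ y≈z)) edge
      where
      extend : ∀ {y z} → S ∖ e ⊢ x ⟶ y ⊎ (AtEnd x × AtEnd y) → S ∖ e ⊢ y ⟶ z →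
          S ∖ e ⊢ x ⟶ z ⊎ (AtEnd x × AtEnd z)
      extend (inj₁ p) q = inj₁ (⟶-trans p q)
      extend (inj₂ (p , q)) r = inj₂ (p , atEnd-⟶ q r)
      edge : ∀ {y} → S ∖ e ⊢ x ⟶ y ⊎ (AtEnd x × AtEnd y) → y ∈ˢ S →
          S ∖ e ⊢ x ⟶ α y ⊎ (AtEnd x × AtEnd (α y))
      edge {y} p y∈S with true⊎false (sameEdge y e)
      ... | inj₂ y≁e = extend p (∈⇒⟶α (∈-∖⁺ S e y∈S y≁e))
      ... | inj₁ y∼e = inj₂ (x-end p , atEnd-sameEdge (trans (sameEdge-αˡ y e) y∼e))
        where
        x-end : S ∖ e ⊢ x ⟶ y ⊎ (AtEnd x × AtEnd y) → AtEnd x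
        x-end (inj₁ q) = atEnd-⟶ (atEnd-sameEdge y∼e) (⟶-sym S∖e-sub q)
        x-end (inj₂ (q , _)) = q

    connected⇒AtEnd : Connected S → ∀ y → AtEnd y
    connected⇒AtEnd connected y = [ inj₁ , proj₂ ]′ (⟶-split (connected {e} {y}))

    ⟶-without-loop : S ∖ e ⊢ e ⟶ α e → ∀ {x y} → S ⊢ x ⟶ y → S ∖ e ⊢ x ⟶ y
    ⟶-without-loop loop x⟶y with ⟶-split x⟶y
    ... | inj₁ p = p
    ... | inj₂ (x-end , y-end) = ⟶-trans (⟶-sym S∖e-sub (from-e x-end)) (from-e y-end)
      where
      from-e : ∀ {z} → AtEnd z → S ∖ e ⊢ e ⟶ z
      from-e = [ id , ⟶-trans loop ]′

  module Bridge {S : Vec Bool n} (S-sub : Subgraph S) {e : Fin n} (e∈S : e ∈ˢ S)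
                (bridge : ¬ S ∖ e ⊢ e ⟶ α e) where
    open EdgeRemoval S-sub e
    private
      S∖e-sub : Subgraph (S ∖ e)
      S∖e-sub = ∖-subgraph e S-sub

    -- The end of e that is not joined in S ∖ e to the representative of its component in S
    -- represents one more component of S ∖ e.
    numComp-far-end : ∀ {m near far} → m ∈ ComponentsOf.representatives S-sub → S ∖ e ⊢ near ⟶ m →
      S ⊢ near ⟶ far → ¬ S ∖ e ⊢ near ⟶ far →
      (∀ {y} → AtEnd y → S ∖ e ⊢ near ⟶ y ⊎ S ∖ e ⊢ far ⟶ y) →
      numComp (S ∖ e) ≡ suc (numComp S)
    numComp-far-end {m} {near} {far} m∈ near⟶m near⟶far apart ends =
      trans
        (≤-antisym (S∖e.numComp-≤ cover) (S∖e.≤-numComp separated))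
        (cong suc C.length-representatives)
      where
      module C = ComponentsOf S-sub
      module S∖e = ComponentsOf S∖e-sub
      cover : ∀ x → ∃ λ r → r ∈ far ∷ C.representatives × S ∖ e ⊢ r ⟶ x
      cover x with r , r∈ , r⟶x ← C.representative x with ⟶-split r⟶x
      ... | inj₁ p = r , there r∈ , p
      ... | inj₂ (_ , x-end) with ends x-end
      ... | inj₁ near⟶x = m , there m∈ , ⟶-trans (⟶-sym S∖e-sub near⟶m) near⟶x
      ... | inj₂ far⟶x = far , here refl , far⟶x
      far-alone : ∀ {r} → r ∈ C.representatives → ¬ S ∖ e ⊢ far ⟶ r
      far-alone r∈ far⟶r
        with refl ← C.representatives-unrelated m∈ r∈
          (⟶-trans (⟶-sym S-sub (∖-⊆ near⟶m)) (⟶-trans near⟶far (∖-⊆ far⟶r))) =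
        apart (⟶-trans near⟶m (⟶-sym S∖e-sub far⟶r))
      separated : AllPairs (λ x y → ¬ S ∖ e ⊢ x ⟶ y) (far ∷ C.representatives)
      separated = All.tabulate far-alone ∷ AllPairs.map (_∘ ∖-⊆) C.representatives-separated

    numComp-∖-bridge : numComp (S ∖ e) ≡ suc (numComp S)
    numComp-∖-bridge
        with m , m∈ , m⟶e ← ComponentsOf.representative S-sub e with m-end (⟶-split m⟶e)
      where
      m-end : S ∖ e ⊢ m ⟶ e ⊎ (AtEnd m × AtEnd e) → AtEnd m
      m-end (inj₁ p) = inj₁ (⟶-sym S∖e-sub p)
      m-end (inj₂ (p , _)) = p
    ... | inj₁ e⟶m = numComp-far-end m∈ e⟶m (∈⇒⟶α e∈S) bridge id
    ... | inj₂ αe⟶m =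
      numComp-far-end m∈ αe⟶m (⟶-sym S-sub (∈⇒⟶α e∈S)) (bridge ∘ ⟶-sym S∖e-sub) [ inj₂ , inj₁ ]′

  numComp-∖-≤ : ∀ {S} → Subgraph S → ∀ {e} → e ∈ˢ S → numComp (S ∖ e) ≤ suc (numComp S)
  numComp-∖-≤ {S} S-sub {e} e∈S with true⊎false (canReach (S ∖ e) e (α e))
  ... | inj₂ bridge = ≤-reflexive (Bridge.numComp-∖-bridge S-sub e∈S (not-¬ bridge))
  ... | inj₁ loop = ≤-trans
    (subst (numComp (S ∖ e) ≤_) C.length-representatives
      (ComponentsOf.numComp-≤ (∖-subgraph e S-sub) λ x →
        let m , m∈ , m⟶x = C.representative x
        in m , m∈ , EdgeRemoval.⟶-without-loop S-sub e loop m⟶x))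
    (ℕₚ.n≤1+n _)
    where module C = ComponentsOf S-sub

  numV-≤ : ∀ {S} → Subgraph S → numV ≤ numE S + numComp S
  numV-≤ = ∖-induction (λ S → numV ≤ numE S + numComp S) step
    where
    open ℕₚ.≤-Reasoning
    step : ∀ {S} → Subgraph S → (∀ {e} → e ∈ˢ S → numV ≤ numE (S ∖ e) + numComp (S ∖ e)) →
        numV ≤ numE S + numComp S
    step {S} S-sub smaller with edge-or-edgeless S
    ... | inj₂ none = ≤-trans (≤-reflexive (sym (numComp-edgeless S none))) (ℕₚ.m≤n+m _ (numE S))
    ... | inj₁ (e , e∈S) = begin
      numV                                  ≤⟨ smaller e∈S ⟩
      numE (S ∖ e) + numComp (S ∖ e)        ≤⟨ ℕₚ.+-monoʳ-≤ _ (numComp-∖-≤ S-sub e∈S) ⟩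
      numE (S ∖ e) + suc (numComp S)        ≡⟨ +-suc _ _ ⟩
      suc (numE (S ∖ e)) + numComp S        ≡⟨ cong (_+ numComp S) (numE-∖ S-sub e∈S) ⟨
      numE S + numComp S                    ∎

  Forest : Vec Bool n → Set
  Forest S = ∀ {e} → e ∈ˢ S → ¬ S ∖ e ⊢ e ⟶ α e

  ∖-forest : ∀ S e → Forest S → Forest (S ∖ e)
  ∖-forest S e S-forest {f} f∈S∖e loop = S-forest (proj₁ (∈-∖⁻ S e f∈S∖e)) (⟶-mono e-removed loop)
    where
    e-removed : ∀ {h} → h ∈ˢ S ∖ e ∖ f → h ∈ˢ S ∖ f
    e-removed h∈ = let p , h≁f = ∈-∖⁻ (S ∖ e) f h∈ in ∈-∖⁺ S f (proj₁ (∈-∖⁻ S e p)) h≁f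

  forest-size : ∀ {S} → Subgraph S → Forest S → numE S + numComp S ≡ numV
  forest-size = ∖-induction (λ S → Forest S → numE S + numComp S ≡ numV) step
    where
    open ≡-Reasoning
    step : ∀ {S} → Subgraph S →
        (∀ {e} → e ∈ˢ S → Forest (S ∖ e) → numE (S ∖ e) + numComp (S ∖ e) ≡ numV) →
        Forest S → numE S + numComp S ≡ numV
    step {S} S-sub smaller S-forest with edge-or-edgeless S
    ... | inj₂ none = cong₂ _+_ (edgeCount≡0⁺ none) (numComp-edgeless S none)
    ... | inj₁ (e , e∈S) = begin
      numE S + numComp S
        ≡⟨ cong (_+ numComp S) (numE-∖ S-sub e∈S) ⟩
      suc (numE (S ∖ e)) + numComp S
        ≡⟨ +-suc _ _ ⟨
      numE (S ∖ e) + suc (numComp S)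
        ≡⟨ cong (λ k → numE (S ∖ e) + k) (Bridge.numComp-∖-bridge S-sub e∈S (S-forest e∈S)) ⟨
      numE (S ∖ e) + numComp (S ∖ e)
        ≡⟨ smaller e∈S (∖-forest S e S-forest) ⟩
      numV ∎

  record SpanningTree (T : Vec Bool n) : Set where
    constructor mkSpanningTree
    field
      subgraph : Subgraph T
      connected : Connected T
      size : numE T + 1 ≡ numV
  open SpanningTree public

  isSpanningTree⁻ : ∀ {T} → isSpanningTree T ≡ true → SpanningTree T
  isSpanningTree⁻ {T} p = mkSpanningTree T-sub
    (numComp≤1⇒connected T-sub (≤-reflexive (≡ᵇ≡true⇒≡ (∧-conicalˡ _ _ q))))
    (≡ᵇ≡true⇒≡ (∧-conicalʳ (numComp T ≡ᵇ 1) _ q))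
    where
    T-sub : Subgraph T
    T-sub = isSubgraph⁻ (∧-conicalˡ _ _ p)
    q : (numComp T ≡ᵇ 1) ∧ (numE T + 1 ≡ᵇ numV) ≡ true
    q = ∧-conicalʳ (isSubgraph T) _ p

  isSpanningTree⁺ : ∀ {T} → SpanningTree T → isSpanningTree T ≡ true
  isSpanningTree⁺ (mkSpanningTree T-sub T-conn T-size) = cong₂ _∧_ (isSubgraph⁺ T-sub)
    (cong₂ _∧_ (≡⇒≡ᵇ≡true (≤-antisym (connected⇒numComp≤1 T-sub T-conn) (numComp≥1 T-sub)))
      (≡⇒≡ᵇ≡true T-size))

  tree-forest : ∀ {T} → SpanningTree T → Forest T
  tree-forest {T} tree {e} e∈T loop = <-irrefl refl (begin-strict
    numV
      ≤⟨ numV-≤ T∖e-sub ⟩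
    numE (T ∖ e) + numComp (T ∖ e)
      ≤⟨ ℕₚ.+-monoʳ-≤ _ (connected⇒numComp≤1 T∖e-sub T∖e-connected) ⟩
    numE (T ∖ e) + 1
      <⟨ ℕₚ.+-monoˡ-< 1 (ℕₚ.≤-reflexive (sym (numE-∖ (subgraph tree) e∈T))) ⟩
    numE T + 1
      ≡⟨ size tree ⟩
    numV ∎)
    where
    open ℕₚ.≤-Reasoning
    T∖e-sub : Subgraph (T ∖ e)
    T∖e-sub = ∖-subgraph e (subgraph tree)
    T∖e-connected : Connected (T ∖ e)
    T∖e-connected = EdgeRemoval.⟶-without-loop (subgraph tree) e loop (connected tree)

  connected⇒spanningTree : ∀ {S} → Subgraph S → Connected S → ∃ SpanningTree
  connected⇒spanningTree = ∖-induction (λ S → Connected S → ∃ SpanningTree) step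
    where
    step : ∀ {S} → Subgraph S → (∀ {e} → e ∈ˢ S → Connected (S ∖ e) → ∃ SpanningTree) →
        Connected S → ∃ SpanningTree
    step {S} S-sub smaller S-conn
        with true⊎false (any (λ e → lookup S e ∧ canReach (S ∖ e) e (α e)) H)
    ... | inj₁ some = let e , p = any-allFin⁻ _ some in smaller (∧-conicalˡ _ _ p)
                        (EdgeRemoval.⟶-without-loop S-sub e (∧-conicalʳ (lookup S e) _ p) S-conn)
    ... | inj₂ none =
      S , mkSpanningTree S-sub S-conn
        (trans (cong (λ k → numE S + k) numComp≡1) (forest-size S-sub S-forest))
      where
      S-forest : Forest S
      S-forest {e} e∈S loop =
        not-¬ (any-allFin⁺ (λ e → lookup S e ∧ canReach (S ∖ e) e (α e)) e (cong₂ _∧_ e∈S loop))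
          none
      numComp≡1 : 1 ≡ numComp S
      numComp≡1 = ≤-antisym (numComp≥1 S-sub) (connected⇒numComp≤1 S-sub S-conn)

  spanningTree : ∃ SpanningTree
  spanningTree =
    connected⇒spanningTree {allEdges} (mkSubgraph λ h → trans (∈-all h) (sym (∈-all (α h))))
      (path (transitive _ _))
    where
    allEdges : Vec Bool n
    allEdges = tabulate λ _ → true
    ∈-all : ∀ h → h ∈ˢ allEdges
    ∈-all = lookup∘tabulate λ _ → true
    path : ∀ {x y} → Star (MapStep σ α) x y → allEdges ⊢ x ⟶ y
    path ε = ⟶-refl
    path (byσ ◅ p) = ⟶-trans (≈⇒⟶ (x≈σx _)) (path p)
    path (byσ⁻ ◅ p) = ⟶-trans (≈⇒⟶ (x≈σ⁻¹x _)) (path p)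
    path (byα ◅ p) = ⟶-trans (∈⇒⟶α (∈-all _)) (path p)

data EdgeKind : Set where
  internal external : EdgeKind

opposite : EdgeKind → EdgeKind
opposite internal = external
opposite external = internal

ofKind : ∀ {n} → EdgeKind → Vec Bool n → Fin n → Bool
ofKind internal T h = lookup T h
ofKind external T h = not (lookup T h)

module Motion {n : ℕ} (M : RootedMap n) where
  open RootedMap M
  open MapDefs M
  open HalfEdges M
  open Reachability M
  open Components M

  motion-∈ : ∀ S {h} → h ∈ˢ S → motion S h ≡ σf (α h)
  motion-∈ S h∈S rewrite h∈S = refl

  motion-∉ : ∀ S {h} → h ∉ˢ S → motion S h ≡ σf h
  motion-∉ S h∉S rewrite h∉S = refl

  motion-cong : ∀ S S′ {h} → lookup S h ≡ lookup S′ h → motion S h ≡ motion S′ h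
  motion-cong S S′ e rewrite e = refl

  module _ {S : Vec Bool n} where

    motion-injective : Subgraph S → ∀ {x y} → motion S x ≡ motion S y → x ≡ y
    motion-injective S-sub {x} {y} e with lookup S x in x? | lookup S y in y?
    ... | true | true = α-injective (σ-injective e)
    ... | false | false = σ-injective e
    ... | true | false = contradiction y? (not-¬ (subst (_∈ˢ S) (σ-injective e) (α∈ S-sub x?)))
    ... | false | true =
      contradiction x? (not-¬ (subst (_∈ˢ S) (sym (σ-injective e)) (α∈ S-sub y?)))

    ⟶-motion : ∀ x → S ⊢ x ⟶ motion S x
    ⟶-motion x with lookup S x in x?
    ... | true = ⟶-≈ (∈⇒⟶α x?) (x≈σx (α x))
    ... | false = ≈⇒⟶ (x≈σx x)

    orbit⇒⟶ : ∀ {x y} → Orbit (motion S) x y → S ⊢ x ⟶ y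
    orbit⇒⟶ (zero , refl) = ⟶-refl
    orbit⇒⟶ {x} (suc k , refl) = ⟶-trans (orbit⇒⟶ (k , refl)) (⟶-motion (iter (motion S) k x))

  forest-orbit : ∀ {S} → Subgraph S → Forest S → ∀ {x y} → S ⊢ x ⟶ y → Orbit (motion S) x y
  forest-orbit = ∖-induction (λ S → Forest S → ∀ {x y} → S ⊢ x ⟶ y → Orbit (motion S) x y) step
    where
    step : ∀ {S} → Subgraph S →
        (∀ {b} → b ∈ˢ S → Forest (S ∖ b) → ∀ {x y} → S ∖ b ⊢ x ⟶ y → Orbit (motion (S ∖ b)) x y) →
        Forest S → ∀ {x y} → S ⊢ x ⟶ y → Orbit (motion S) x y
    step {S} S-sub smaller S-forest {x} x⟶y with edge-or-edgeless S
    ... | inj₂ none = let k , e = ≈⇒Orbit (⟶-edgeless S none x⟶y) in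
            k , trans (iter-cong (λ h → motion-∉ S (none h)) k x) e
    ... | inj₁ (b , b∈S) = ⟶-induction (Orbit (motion S) x) orbit-refl
            (λ o y≈z → orbit-trans o (M∖b.coarser (IH (≈⇒⟶ y≈z))))
            (λ o y∈S → orbit-trans o (cross y∈S)) x⟶y
      where
      S∖b-sub : Subgraph (S ∖ b)
      S∖b-sub = ∖-subgraph b S-sub
      IH : ∀ {x y} → S ∖ b ⊢ x ⟶ y → Orbit (motion (S ∖ b)) x y
      IH = smaller b∈S (∖-forest S b S-forest)
      module M∖b = MergedOrbits (motion-injective S-sub) (motion-injective S∖b-sub) {b} {α b}
        (trans (motion-∈ S b∈S) (sym (motion-∉ (S ∖ b) (∉-∖ S b (α b) (α-sameEdge b)))))
        (trans (motion-∈ S (α∈ S-sub b∈S))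
          (trans (cong σf (α-invol b)) (sym (motion-∉ (S ∖ b) (∉-∖ S b b (sameEdge-refl b))))))
        (λ ≢b ≢αb → motion-cong S (S ∖ b) (sym (lookup-∖-other S b (≢⇒¬sameEdge ≢b ≢αb))))
        (S-forest b∈S ∘ orbit⇒⟶)
      cross : ∀ {y} → y ∈ˢ S → Orbit (motion S) y (α y)
      cross {y} y∈S with true⊎false (sameEdge y b)
      ... | inj₂ y≁b = M∖b.coarser (IH (∈⇒⟶α (∈-∖⁺ S b y∈S y≁b)))
      ... | inj₁ y∼b with sameEdge⁻ y b y∼b
      ... | inj₁ refl = M∖b.merged
      ... | inj₂ refl = αα⁺ (Orbit (motion S) (α b))
              (Orbits.orbit-sym (motion S) (motion-injective S-sub) M∖b.merged)

module Tour {n : ℕ} (M : RootedMap n) {T : Vec Bool n} (tree : Components.SpanningTree M T) where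
  open RootedMap M
  open MapDefs M
  open HalfEdges M
  open Reachability M
  open Components M
  open Motion M

  T-sub : Subgraph T
  T-sub = subgraph tree

  t : Fin n → Fin n
  t = motion T

  t-injective : ∀ {x y} → t x ≡ t y → x ≡ y
  t-injective = motion-injective T-sub

  private
    module t-Orbits = Orbits t t-injective

    t-transitive : ∀ x → Orbit t h₀ x
    t-transitive x = forest-orbit T-sub (tree-forest tree) (connected tree)

  open t-Orbits.Transitive h₀ t-transitive public using (iter-n; iter-distinct)

  opaque
    time : Fin n → ℕ
    time = pos T

    time≡pos : ∀ x → time x ≡ pos T x
    time≡pos x = refl

    time-least : ∀ {k} x → k < n → iter t k h₀ ≡ x → time x ≤ k × iter t (time x) h₀ ≡ x
    time-least {k} x k<n refl =
      let ≤k , e = takeWhileᵇ-least (λ j → not (iter t j h₀ == x)) id k<n (cong not (==-refl x))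
      in ≤k , ==⇒≡ (not-injective e)

  private
    visit : ∀ x → ∃ λ k → k < n × iter t k h₀ ≡ x
    visit x = t-Orbits.orbit-bounded (t-transitive x)

  iter-time : ∀ x → iter t (time x) h₀ ≡ x
  iter-time x = let k , k<n , e = visit x in proj₂ (time-least x k<n e)

  time<n : ∀ x → time x < n
  time<n x = let k , k<n , e = visit x in ≤-<-trans (proj₁ (time-least x k<n e)) k<n

  time-injective : ∀ {x y} → time x ≡ time y → x ≡ y
  time-injective {x} {y} e =
    trans (sym (iter-time x)) (trans (cong (λ k → iter t k h₀) e) (iter-time y))

  time-iter : ∀ {k} → k < n → time (iter t k h₀) ≡ k
  time-iter {k} k<n with time-least (iter t k h₀) k<n refl
  ... | ≤k , e = [ (λ <k → contradiction e (iter-distinct <k k<n)) , id ]′ (ℕₚ.m≤n⇒m<n∨m≡n ≤k)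

  time-h₀ : time h₀ ≡ 0
  time-h₀ = time-iter (≤-<-trans z≤n (time<n h₀))

  time-t : ∀ {x} → suc (time x) < n → time (t x) ≡ suc (time x)
  time-t {x} lt = trans (cong (λ y → time (t y)) (sym (iter-time x))) (time-iter lt)

  infix 4 _≺_ _≼_

  _≺_ _≼_ : Fin n → Fin n → Set
  x ≺ y = time x < time y
  x ≼ y = time x ≤ time y

  time-t-≺ : ∀ {x y} → x ≺ y → time (t x) ≡ suc (time x)
  time-t-≺ {x} {y} x≺y = time-t (≤-<-trans x≺y (time<n y))

  ≺-compare : ∀ {x y} → x ≢ y → x ≺ y ⊎ y ≺ x
  ≺-compare {x} {y} x≢y with <-cmp (time x) (time y)
  ... | tri< x≺y _ _ = inj₁ x≺y
  ... | tri≈ _ e _ = contradiction (time-injective e) x≢y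
  ... | tri> _ _ y≺x = inj₂ y≺x

  ≼∧≢⇒≺ : ∀ {x y} → x ≼ y → x ≢ y → x ≺ y
  ≼∧≢⇒≺ x≼y x≢y = ℕₚ.≤∧≢⇒< x≼y (x≢y ∘ time-injective)

  first-≢α : ∀ {x y} → x ≺ α x → y ≺ α y → y ≢ α x
  first-≢α {x} x≺αx y≺αy refl = <-asym x≺αx (αα⁻ (α x ≺_) y≺αy)

  first-or-second : ∀ x → x ≺ α x ⊎ α x ≺ x
  first-or-second x = ≺-compare (α-fpf x ∘ sym)

  -- Half-edges visited from just after b up to α b. When b is the first half-edge of a tree edge,
  -- they are the half-edges of the component of T - {b, α b} that avoids the root.
  opaque
    subtree : Fin n → Fin n → Bool
    subtree b x = (time b <ᵇ time x) ∧ (time x ≤ᵇ time (α b))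

    subtree⁺ : ∀ {b x} → b ≺ x → x ≼ α b → subtree b x ≡ true
    subtree⁺ b≺x x≼αb = cong₂ _∧_ (<⇒<ᵇ≡true b≺x) (≤⇒≤ᵇ≡true x≼αb)

    subtree⇒≻ : ∀ {b x} → subtree b x ≡ true → b ≺ x
    subtree⇒≻ p = <ᵇ≡true⇒< (∧-conicalˡ _ _ p)

    subtree⇒≼α : ∀ {b x} → subtree b x ≡ true → x ≼ α b
    subtree⇒≼α {b} {x} p = ≤ᵇ≡true⇒≤ (∧-conicalʳ (time b <ᵇ time x) _ p)

  ≼⇒∉subtree : ∀ {b x} → x ≼ b → subtree b x ≡ false
  ≼⇒∉subtree x≼b = ¬-not λ p → ℕₚ.<⇒≱ (subtree⇒≻ p) x≼b

  b∉subtree : ∀ b → subtree b b ≡ false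
  b∉subtree b = ≼⇒∉subtree ≤-refl

  h₀∉subtree : ∀ b → subtree b h₀ ≡ false
  h₀∉subtree b = ≼⇒∉subtree (subst (_≤ time b) (sym time-h₀) z≤n)

  αb∈subtree : ∀ {b} → b ≺ α b → subtree b (α b) ≡ true
  αb∈subtree b≺αb = subtree⁺ b≺αb ≤-refl

  -- The tour descends the tree along b.
  record Internal (b : Fin n) : Set where
    constructor mkInternal
    field
      internal∈ : b ∈ˢ T
      internal≺ : b ≺ α b
  open Internal public

  record External (g : Fin n) : Set where
    constructor mkExternal
    field
      external∉ : g ∉ˢ T
      external≺ : g ≺ α g
  open External public

  classify-first : ∀ {x} → x ≺ α x → Internal x ⊎ External x
  classify-first {x} x≺αx with lookup T x in x?
  ... | true = inj₁ (mkInternal x? x≺αx)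
  ... | false = inj₂ (mkExternal x? x≺αx)

  data Kind (x : Fin n) : Set where
    internal-first  : Internal x → Kind x
    internal-second : Internal (α x) → Kind x
    external-first  : External x → Kind x
    external-second : External (α x) → Kind x

  kind : ∀ x → Kind x
  kind x with first-or-second x
  ... | inj₁ x≺αx = [ internal-first , external-first ]′ (classify-first x≺αx)
  ... | inj₂ αx≺x = [ internal-second , external-second ]′ (classify-first (αα⁺ (α x ≺_) αx≺x))

  module _ {b : Fin n} (b-int : Internal b) where
    private
      T∖b-sub : Subgraph (T ∖ b)
      T∖b-sub = ∖-subgraph b T-sub

      subtree-motion : ∀ {x} → subtree b x ≡ true → subtree b (motion (T ∖ b) x) ≡ true
      subtree-motion {x} x∈ with true⊎false (sameEdge x b)
      ... | inj₂ x≁b =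
        subst (λ y → subtree b y ≡ true) (motion-cong T (T ∖ b) (sym (lookup-∖-other T b x≁b)))
          (subtree⁺ (subst (time b <_) (sym tx) (ℕₚ.m<n⇒m<1+n (subtree⇒≻ x∈)))
            (subst (_≤ time (α b)) (sym tx) x≺αb))
        where
        x≺αb : x ≺ α b
        x≺αb = ≼∧≢⇒≺ (subtree⇒≼α x∈) (proj₂ (¬sameEdge⇒≢ x b x≁b))
        tx : time (t x) ≡ suc (time x)
        tx = time-t-≺ x≺αb
      ... | inj₁ x∼b with sameEdge⁻ x b x∼b
      ... | inj₁ refl = contradiction (b∉subtree x) (not-¬ x∈)
      ... | inj₂ refl =
        subst (λ y → subtree b y ≡ true) (sym motion-αb)
          (subtree⁺ (subst (time b <_) (sym tb) (n<1+n _))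
            (subst (_≤ time (α b)) (sym tb) (internal≺ b-int)))
        where
        motion-αb : motion (T ∖ b) (α b) ≡ t b
        motion-αb =
          trans (motion-∉ (T ∖ b) (∉-∖ T b (α b) x∼b)) (sym (motion-∈ T (internal∈ b-int)))
        tb : time (t b) ≡ suc (time b)
        tb = time-t-≺ (internal≺ b-int)

      subtree-orbit : ∀ k {x} → subtree b x ≡ true → subtree b (iter (motion (T ∖ b)) k x) ≡ true
      subtree-orbit zero x∈ = x∈
      subtree-orbit (suc k) x∈ = subtree-motion (subtree-orbit k x∈)

      subtree-⟶⁺ : ∀ {x y} → T ∖ b ⊢ x ⟶ y → subtree b x ≡ true → subtree b y ≡ true
      subtree-⟶⁺ x⟶y x∈ with k , refl ← forest-orbit T∖b-sub (∖-forest T b (tree-forest tree)) x⟶y =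
        subtree-orbit k x∈

    subtree-⟶ : ∀ {x y} → T ∖ b ⊢ x ⟶ y → subtree b x ≡ subtree b y
    subtree-⟶ x⟶y = ≡-via-true (subtree-⟶⁺ x⟶y) (subtree-⟶⁺ (⟶-sym T∖b-sub x⟶y))

    subtree-≈ : ∀ {x y} → x ≈ y → subtree b x ≡ subtree b y
    subtree-≈ x≈y = subtree-⟶ (≈⇒⟶ x≈y)

    subtree-internal : ∀ {f} → f ∈ˢ T → f ≢ b → f ≢ α b → subtree b f ≡ subtree b (α f)
    subtree-internal f∈T f≢b f≢αb = subtree-⟶ (∈⇒⟶α (∈-∖⁺ T b f∈T (≢⇒¬sameEdge f≢b f≢αb)))

  internal-≢α : ∀ {b f} → Internal b → Internal f → f ≢ α b
  internal-≢α b-int f-int = first-≢α (internal≺ b-int) (internal≺ f-int)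

  crossing-internal-unique : ∀ {f b} → Internal f → Internal b →
      subtree b f ≡ not (subtree b (α f)) → f ≡ b
  crossing-internal-unique {f} {b} f-int b-int crosses with f Finₚ.≟ b
  ... | yes f≡b = f≡b
  ... | no f≢b =
    contradiction (subtree-internal b-int (internal∈ f-int) f≢b (internal-≢α b-int f-int))
      (≡not⇒≢ crosses)

  α∉later-subtree : ∀ {b c} → Internal b → Internal c → b ≺ c → subtree c (α b) ≡ false
  α∉later-subtree {b} {c} b-int c-int b≺c =
    trans (sym (subtree-internal c-int (internal∈ b-int) b≢c (internal-≢α c-int b-int)))
          (≼⇒∉subtree (<⇒≤ b≺c))
    where
    b≢c : b ≢ c
    b≢c refl = <-irrefl refl b≺c

  FirstOfKind : EdgeKind → Fin n → Set
  FirstOfKind internal = Internal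
  FirstOfKind external = External

  firstOfKind : ∀ κ {x} → ofKind κ T x ≡ true → x ≺ α x → FirstOfKind κ x
  firstOfKind internal x∈T = mkInternal x∈T
  firstOfKind external x∉T = mkExternal (not-injective x∉T)

  firstOfKind⇒ofKind : ∀ κ {x} → FirstOfKind κ x → ofKind κ T x ≡ true
  firstOfKind⇒ofKind internal = internal∈
  firstOfKind⇒ofKind external = cong not ∘ external∉

  ofKind-α : ∀ κ → α-Invariant (ofKind κ T)
  ofKind-α internal = lookup-α T-sub
  ofKind-α external = cong not ∘ lookup-α T-sub

  edgeCount-ofKind≡0 : ∀ κ {p} → α-Invariant p →
    edgeCount (λ h → ofKind κ T h ∧ p h) ≡ 0 ⇔ (∀ {x} → FirstOfKind κ x → p x ≡ false)
  edgeCount-ofKind≡0 κ {p} p-inv = mk⇔ to from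
    where
    κ∧p-inv : α-Invariant (λ h → ofKind κ T h ∧ p h)
    κ∧p-inv h = cong₂ _∧_ (ofKind-α κ h) (p-inv h)
    to : edgeCount (λ h → ofKind κ T h ∧ p h) ≡ 0 → ∀ {x} → FirstOfKind κ x → p x ≡ false
    to none {x} first = ¬-not λ px →
      not-¬ (cong₂ _∧_ (firstOfKind⇒ofKind κ first) px) (edgeCount≡0⁻ κ∧p-inv none x)
    from : (∀ {x} → FirstOfKind κ x → p x ≡ false) → edgeCount (λ h → ofKind κ T h ∧ p h) ≡ 0
    from none =
      edgeCount≡0⁺ λ h → ¬-not λ q → absurd h (∧-conicalˡ _ _ q) (∧-conicalʳ (ofKind κ T h) _ q)
      where
      absurd : ∀ h → ofKind κ T h ≡ true → p h ≢ true
      absurd h κh ph with first-or-second h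
      ... | inj₁ h≺αh = not-¬ ph (none (firstOfKind κ κh h≺αh))
      ... | inj₂ αh≺h = not-¬ (trans (sym (p-inv h)) ph)
              (none (firstOfKind κ (trans (sym (ofKind-α κ h)) κh) (αα⁺ (α h ≺_) αh≺h)))

  firstInternal : (Fin n → Bool) → Fin n → Bool
  firstInternal p h = (lookup T h ∧ p h) ∧ (time h <ᵇ time (α h))

  firstInternal⁺ : ∀ p {h} → Internal h → p h ≡ true → firstInternal p h ≡ true
  firstInternal⁺ p (mkInternal h∈T h≺αh) ph = cong₂ _∧_ (cong₂ _∧_ h∈T ph) (<⇒<ᵇ≡true h≺αh)

  firstInternal⁻ : ∀ p {h} → firstInternal p h ≡ true → Internal h × p h ≡ true
  firstInternal⁻ p {h} q =
    mkInternal (∧-conicalˡ _ _ r) (<ᵇ≡true⇒< (∧-conicalʳ (lookup T h ∧ p h) _ q)) ,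
      ∧-conicalʳ (lookup T h) _ r
    where
    r : lookup T h ∧ p h ≡ true
    r = ∧-conicalˡ _ _ q

  edgeCount-internal : ∀ {p} → α-Invariant p →
      edgeCount (λ h → ofKind internal T h ∧ p h) ≡ count (firstInternal p) H
  edgeCount-internal p-inv =
    edgeCount-via (λ h → cong₂ _∧_ (lookup-α T-sub h) (p-inv h)) (halving-via time time-injective)

  data Backstep (x : Fin n) : Set where
    atRoot     : h₀ ≡ x → Backstep x
    sameVertex : ∀ {y} → y ≺ x → y ≈ x → Backstep x
    fromParent : ∀ {b} → Internal b → time x ≡ suc (time b) → α b ≈ x → Backstep x

  backstep : ∀ x → Backstep x
  backstep x with time x in time-x
  ... | zero = atRoot (trans (cong (λ k → iter t k h₀) (sym time-x)) (iter-time x))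
  ... | suc k = go (true⊎false (lookup T w)) (first-or-second w)
    where
    w : Fin n
    w = iter t k h₀
    tw≡x : t w ≡ x
    tw≡x = trans (cong (λ k → iter t k h₀) (sym time-x)) (iter-time x)
    w-before : time x ≡ suc (time w)
    w-before =
      trans time-x (cong suc (sym (time-iter (<-trans (n<1+n k) (subst (_< n) time-x (time<n x))))))
    w≺x : w ≺ x
    w≺x = ≤-reflexive (sym w-before)
    go : w ∈ˢ T ⊎ w ∉ˢ T → w ≺ α w ⊎ α w ≺ w → Backstep x
    go (inj₂ w∉T) _ = sameVertex w≺x (subst (w ≈_) (trans (sym (motion-∉ T w∉T)) tw≡x) (x≈σx w))
    go (inj₁ w∈T) order with subst (α w ≈_) (trans (sym (motion-∈ T w∈T)) tw≡x) (x≈σx (α w)) | order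
    ... | αw≈x | inj₁ w≺αw = fromParent (mkInternal w∈T w≺αw) w-before αw≈x
    ... | αw≈x | inj₂ αw≺w = sameVertex (<-trans αw≺w w≺x) αw≈x

  ≺-induction : (P : Fin n → Set) → (∀ x → (∀ {y} → y ≺ x → P y) → P x) → ∀ x → P x
  ≺-induction = WF.All.wfRec (On.wellFounded time <-wellFounded) _

  -- The tree edge through which the path of T from p to q leaves the part of X containing p.
  data SeparatingEdge (X : Fin n → Bool) (p q : Fin n) : Set where
    upwards   : ∀ {f} → Internal f → subtree f p ≡ true → subtree f q ≡ false →
                X (α f) ≡ X p → X f ≡ X q → SeparatingEdge X p q
    downwards : ∀ {f} → Internal f → subtree f p ≡ false → subtree f q ≡ true →
                X f ≡ X p → X (α f) ≡ X q → SeparatingEdge X p q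

  module _ {X : Fin n → Bool} where

    separatingEdge-swap : ∀ {p q} → SeparatingEdge X p q → SeparatingEdge X q p
    separatingEdge-swap (upwards f-int p∈ q∉ e e′) = downwards f-int q∉ p∈ e′ e
    separatingEdge-swap (downwards f-int p∉ q∈ e e′) = upwards f-int q∈ p∉ e′ e

    private
      move : ∀ {p p′ q} → X p ≡ X p′ →
          (∀ {f} → Internal f → subtree f p ≢ subtree f q → subtree f p ≡ subtree f p′) →
          SeparatingEdge X p q → SeparatingEdge X p′ q
      move Xp≡ same (upwards f-int p∈ q∉ e e′) =
        upwards f-int (trans (sym (same f-int (≡not⇒≢ (trans p∈ (cong not (sym q∉)))))) p∈) q∉
          (trans e Xp≡) e′
      move Xp≡ same (downwards f-int p∉ q∈ e e′) =
        downwards f-int (trans (sym (same f-int (≡not⇒≢ (trans p∉ (cong not (sym q∈)))))) p∉) q∈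
          (trans e Xp≡) e′

    -- The later of p and q is moved back along the tour until the boundary of X is crossed.
    separatingEdge : (∀ {x y} → x ≈ y → X x ≡ X y) → ∀ p q → X p ≡ not (X q) → SeparatingEdge X p q
    separatingEdge X-≈ p q = go (suc (time p + time q)) p q ≤-refl
      where
      not-swap : ∀ {a b} → a ≡ not b → b ≡ not a
      not-swap {b = b} e = trans (sym (not-involutive b)) (cong not (sym e))
      go : ∀ m p q → time p + time q < m → X p ≡ not (X q) → SeparatingEdge X p q
      retreat : ∀ m p q → time p + time q ≤ m → X p ≡ not (X q) → q ≺ p → SeparatingEdge X p q
      go (suc m) p q (s≤s ≤m) crosses with ≺-compare {p} {q} (λ p≡q → ≡not⇒≢ crosses (cong X p≡q))
      ... | inj₂ q≺p = retreat m p q ≤m crosses q≺p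
      ... | inj₁ p≺q =
        separatingEdge-swap
          (retreat m q p (subst (_≤ m) (+-comm (time p) _) ≤m) (not-swap crosses) p≺q)
      retreat m p q ≤m crosses q≺p with backstep p
      ... | atRoot refl = contradiction (subst (time q <_) time-h₀ q≺p) ℕₚ.n≮0
      ... | sameVertex {y} y≺p y≈p = move (X-≈ y≈p) (λ f-int _ → subtree-≈ f-int y≈p)
              (go m y q (<-≤-trans (ℕₚ.+-monoˡ-< (time q) y≺p) ≤m) (trans (X-≈ y≈p) crosses))
      ... | fromParent {b} b-int time-p αb≈p with X b 𝔹ₚ.≟ X p
      ... | no Xb≢Xp =
        upwards b-int (trans (sym (subtree-≈ b-int αb≈p)) (αb∈subtree (internal≺ b-int)))
          (≼⇒∉subtree q≼b) (X-≈ αb≈p) (trans (¬-not Xb≢Xp) (sym (not-swap crosses)))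
        where
        q≼b : q ≼ b
        q≼b = ≤-pred (subst (time q <_) time-p q≺p)
      ... | yes Xb≡Xp =
        move Xb≡Xp same-side
          (go m b q (<-≤-trans (ℕₚ.+-monoˡ-< (time q) (≤-reflexive (sym time-p))) ≤m)
            (trans Xb≡Xp crosses))
        where
        same-side : ∀ {f} → Internal f → subtree f b ≢ subtree f q → subtree f b ≡ subtree f p
        same-side {f} f-int separated =
          trans (subtree-internal f-int (internal∈ b-int) b≢f (internal-≢α f-int b-int))
            (subtree-≈ f-int αb≈p)
          where
          b≢f : b ≢ f
          b≢f refl = separated (trans (b∉subtree b)
            (sym (≼⇒∉subtree (≤-pred (subst (time q <_) time-p q≺p)))))

module FundamentalCycles {n : ℕ} (M : RootedMap n) {T : Vec Bool n}
  (tree : Components.SpanningTree M T) where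
  open RootedMap M
  open MapDefs M
  open HalfEdges M
  open Reachability M
  open Components M
  open Tour M tree public

  ∉-sameEdge : ∀ {h e} → sameEdge h e ≡ true → e ∉ˢ T → h ∉ˢ T
  ∉-sameEdge {h} {e} h∼e e∉T with sameEdge⁻ h e h∼e
  ... | inj₁ refl = e∉T
  ... | inj₂ refl = α∉ T-sub e∉T

  lookup-removeAdd : ∀ b g h →
      lookup (removeAdd T b g) h ≡ (lookup T h ∧ not (sameEdge h b)) ∨ sameEdge h g
  lookup-removeAdd b g = lookup∘tabulate _

  lookup-addRemove : ∀ g b h →
      lookup (addRemove T g b) h ≡ (lookup T h ∨ sameEdge h g) ∧ not (sameEdge h b)
  lookup-addRemove g b = lookup∘tabulate _

  removeAdd-same : ∀ {b g} → b ∈ˢ T → sameEdge g b ≡ true → removeAdd T b g ≡ T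
  removeAdd-same {b} {g} b∈T g∼b = lookup-extensional λ h →
    trans (lookup-removeAdd b g h)
      (trans (cong ((lookup T h ∧ not (sameEdge h b)) ∨_) (sameEdge-congʳ g b g∼b h)) (pointwise h))
    where
    pointwise : ∀ h → (lookup T h ∧ not (sameEdge h b)) ∨ sameEdge h b ≡ lookup T h
    pointwise h with sameEdge h b in h∼b
    ... | true = trans (∨-zeroʳ _) (sym (∈-sameEdge T-sub h∼b b∈T))
    ... | false = trans (∨-identityʳ _) (∧-identityʳ _)

  removeAdd-∖ : ∀ {b g} → g ∉ˢ T → removeAdd T b g ∖ g ≡ T ∖ b
  removeAdd-∖ {b} {g} g∉T =
    tabulate-cong λ h → trans (cong (_∧ not (sameEdge h g)) (lookup-removeAdd b g h)) (pointwise h)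
    where
    pointwise : ∀ h →
        ((lookup T h ∧ not (sameEdge h b)) ∨ sameEdge h g) ∧ not (sameEdge h g)
          ≡ lookup T h ∧ not (sameEdge h b)
    pointwise h with sameEdge h g in h∼g
    ... | true = trans (∧-zeroʳ _) (sym (cong (_∧ not (sameEdge h b)) (∉-sameEdge h∼g g∉T)))
    ... | false = trans (∧-identityʳ _) (∨-identityʳ _)

  addRemove-same : ∀ {g} → g ∉ˢ T → addRemove T g g ≡ T
  addRemove-same {g} g∉T = lookup-extensional λ h → trans (lookup-addRemove g g h) (pointwise h)
    where
    pointwise : ∀ h → (lookup T h ∨ sameEdge h g) ∧ not (sameEdge h g) ≡ lookup T h
    pointwise h with sameEdge h g in h∼g
    ... | true = trans (∧-zeroʳ _) (sym (∉-sameEdge h∼g g∉T))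
    ... | false = trans (∧-identityʳ _) (∨-identityʳ _)

  addRemove-∖ : ∀ {g f} → g ∉ˢ T → f ∉ˢ T → addRemove T g f ∖ g ≡ T
  addRemove-∖ {g} {f} g∉T f∉T = lookup-extensional λ h →
    trans (lookup-∖ (addRemove T g f) g h)
      (trans (cong (_∧ not (sameEdge h g)) (lookup-addRemove g f h)) (pointwise h))
    where
    pointwise : ∀ h →
        ((lookup T h ∨ sameEdge h g) ∧ not (sameEdge h f)) ∧ not (sameEdge h g) ≡ lookup T h
    pointwise h with sameEdge h g in h∼g | sameEdge h f in h∼f
    ... | true | _ = trans (∧-zeroʳ _) (sym (∉-sameEdge h∼g g∉T))
    ... | false | true = trans (cong (_∧ true) (∧-zeroʳ _)) (sym (∉-sameEdge h∼f f∉T))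
    ... | false | false = trans (∧-identityʳ _) (trans (∧-identityʳ _) (∨-identityʳ _))

  addRemove≡removeAdd : ∀ {g b} → sameEdge b g ≡ false → addRemove T g b ≡ removeAdd T b g
  addRemove≡removeAdd {g} {b} b≁g = lookup-extensional λ h →
    trans (lookup-addRemove g b h) (trans (pointwise h) (sym (lookup-removeAdd b g h)))
    where
    pointwise : ∀ h →
        (lookup T h ∨ sameEdge h g) ∧ not (sameEdge h b)
          ≡ (lookup T h ∧ not (sameEdge h b)) ∨ sameEdge h g
    pointwise h with sameEdge h g in h∼g | sameEdge h b in h∼b
    ... | false | on-b = trans (cong (_∧ not on-b) (∨-identityʳ _)) (sym (∨-identityʳ _))
    ... | true | false = trans (∧-identityʳ _) (trans (∨-zeroʳ _) (sym (∨-zeroʳ _)))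
    ... | true | true =
      contradiction b≁g (not-¬ (trans (sym (sameEdge-congʳ h g h∼g b)) (sameEdge-sym h b h∼b)))

  lookup-removeAdd-other : ∀ {b g h} → sameEdge h b ≡ false → sameEdge h g ≡ false →
                           lookup (removeAdd T b g) h ≡ lookup T h
  lookup-removeAdd-other {b} {g} {h} h≁b h≁g = begin
    lookup (removeAdd T b g) h
      ≡⟨ lookup-removeAdd b g h ⟩
    (lookup T h ∧ not (sameEdge h b)) ∨ sameEdge h g
      ≡⟨ cong₂ (λ x y → (lookup T h ∧ not x) ∨ y) h≁b h≁g ⟩
    (lookup T h ∧ true) ∨ false
      ≡⟨ ∨-identityʳ _ ⟩
    lookup T h ∧ true
      ≡⟨ ∧-identityʳ _ ⟩
    lookup T h ∎
    where open ≡-Reasoning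

  ∈-removeAdd : ∀ {b g h} → sameEdge h g ≡ true → h ∈ˢ removeAdd T b g
  ∈-removeAdd {b} {g} {h} h∼g =
    trans (lookup-removeAdd b g h) (∨-introʳ (lookup T h ∧ not (sameEdge h b)) h∼g)

  ∉-removeAdd : ∀ {b g h} → sameEdge h b ≡ true → sameEdge h g ≡ false → h ∉ˢ removeAdd T b g
  ∉-removeAdd {b} {g} {h} h∼b h≁g = trans (lookup-removeAdd b g h)
    (trans (cong₂ (λ x y → (lookup T h ∧ not x) ∨ y) h∼b h≁g) (trans (∨-identityʳ _) (∧-zeroʳ _)))

  removeAdd-subgraph : ∀ b g → Subgraph (removeAdd T b g)
  removeAdd-subgraph b g = mkSubgraph λ h → begin
    lookup (removeAdd T b g) h
      ≡⟨ lookup-removeAdd b g h ⟩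
    (lookup T h ∧ not (sameEdge h b)) ∨ sameEdge h g
      ≡⟨ cong₂ _∨_ (cong₂ (λ x y → x ∧ not y) (lookup-α T-sub h) (sym (sameEdge-αˡ h b)))
          (sym (sameEdge-αˡ h g)) ⟩
    (lookup T (α h) ∧ not (sameEdge (α h) b)) ∨ sameEdge (α h) g
      ≡⟨ lookup-removeAdd b g (α h) ⟨
    lookup (removeAdd T b g) (α h) ∎
    where open ≡-Reasoning

  Crosses : Fin n → Fin n → Set
  Crosses b g = subtree b g ≡ not (subtree b (α g))

  crosses-α : ∀ {b g} → Crosses b g → Crosses b (α g)
  crosses-α {b} {g} crosses rewrite α-invol g | crosses = sym (not-involutive _)

  crosses-self : ∀ {b} → Internal b → Crosses b b
  crosses-self b-int = trans (b∉subtree _) (cong not (sym (αb∈subtree (internal≺ b-int))))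

  module _ {b : Fin n} (b-int : Internal b) where
    open EdgeRemoval T-sub b

    ∈subtree⇒αb⟶ : ∀ {y} → subtree b y ≡ true → T ∖ b ⊢ α b ⟶ y
    ∈subtree⇒αb⟶ {y} y∈ with connected⇒AtEnd (connected tree) y
    ... | inj₂ αb⟶y = αb⟶y
    ... | inj₁ b⟶y = contradiction (b∉subtree b) (not-¬ (trans (subtree-⟶ b-int b⟶y) y∈))

    ∉subtree⇒b⟶ : ∀ {y} → subtree b y ≡ false → T ∖ b ⊢ b ⟶ y
    ∉subtree⇒b⟶ {y} y∉ with connected⇒AtEnd (connected tree) y
    ... | inj₁ b⟶y = b⟶y
    ... | inj₂ αb⟶y =
      contradiction (trans (sym (subtree-⟶ b-int αb⟶y)) (αb∈subtree (internal≺ b-int))) (not-¬ y∉)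

    removeAdd-spanningTree : ∀ {g} → Crosses b g → SpanningTree (removeAdd T b g)
    removeAdd-spanningTree {g} crosses with true⊎false (sameEdge g b)
    ... | inj₁ g∼b = subst SpanningTree (sym (removeAdd-same (internal∈ b-int) g∼b)) tree
    ... | inj₂ g≁b = mkSpanningTree T′-sub (⟶-trans (⟶-sym T′-sub from-b) from-b) T′-size
      where
      T′ : Vec Bool n
      T′ = removeAdd T b g
      T′-sub : Subgraph T′
      T′-sub = removeAdd-subgraph b g
      g∉T : g ∉ˢ T
      g∉T = ¬-not λ g∈T →
        let g≢b , g≢αb = ¬sameEdge⇒≢ g b g≁b
        in ≡not⇒≢ crosses (subtree-internal b-int g∈T g≢b g≢αb)
      g∈T′ : g ∈ˢ T′
      g∈T′ = ∈-removeAdd {b} (sameEdge-refl g)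
      in-T′ : ∀ {x y} → T ∖ b ⊢ x ⟶ y → T′ ⊢ x ⟶ y
      in-T′ x⟶y = EdgeRemoval.∖-⊆ T′-sub g (subst (_⊢ _ ⟶ _) (sym (removeAdd-∖ g∉T)) x⟶y)
      bridge : T′ ⊢ b ⟶ α b
      bridge with ≡not-cases crosses
      ... | inj₁ (g∈ , αg∉) = ⟶-trans (in-T′ (∉subtree⇒b⟶ αg∉))
              (⟶-trans (α∈⇒⟶ (α∈ T′-sub g∈T′)) (⟶-sym T′-sub (in-T′ (∈subtree⇒αb⟶ g∈))))
      ... | inj₂ (g∉ , αg∈) = ⟶-trans (in-T′ (∉subtree⇒b⟶ g∉))
              (⟶-trans (∈⇒⟶α g∈T′) (⟶-sym T′-sub (in-T′ (∈subtree⇒αb⟶ αg∈))))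
      from-b : ∀ {y} → T′ ⊢ b ⟶ y
      from-b {y} with connected⇒AtEnd (connected tree) y
      ... | inj₁ b⟶y = in-T′ b⟶y
      ... | inj₂ αb⟶y = ⟶-trans bridge (in-T′ αb⟶y)
      T′-size : numE T′ + 1 ≡ numV
      T′-size = begin
        numE T′ + 1                    ≡⟨ cong (_+ 1) (numE-∖ T′-sub g∈T′) ⟩
        suc (numE (T′ ∖ g)) + 1        ≡⟨ cong (λ S → suc (numE S) + 1) (removeAdd-∖ g∉T) ⟩
        suc (numE (T ∖ b)) + 1         ≡⟨ cong (_+ 1) (numE-∖ T-sub (internal∈ b-int)) ⟨
        numE T + 1                     ≡⟨ size tree ⟩
        numV                           ∎
        where open ≡-Reasoning

    removeAdd-crosses : ∀ {g} → SpanningTree (removeAdd T b g) → Crosses b g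
    removeAdd-crosses {g} tree′ = ¬-not λ same → not-¬ (αb∈subtree (internal≺ b-int))
      (⟶-induction (λ y → subtree b y ≡ false) (b∉subtree b)
        (λ y∉ y≈z → trans (sym (subtree-≈ b-int y≈z)) y∉) (edge same) (connected tree′))
      where
      edge : subtree b g ≡ subtree b (α g) → ∀ {y} → subtree b y ≡ false → y ∈ˢ removeAdd T b g →
          subtree b (α y) ≡ false
      edge same {y} y∉ y∈T′
          with ∨-elim (lookup T y ∧ not (sameEdge y b)) (trans (sym (lookup-removeAdd b g y)) y∈T′)
      ... | inj₁ p =
        let y≢b , y≢αb = ¬sameEdge⇒≢ y b (not-injective (∧-conicalʳ (lookup T y) _ p))
        in trans (sym (subtree-internal b-int (∧-conicalˡ _ _ p) y≢b y≢αb)) y∉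
      ... | inj₂ y∼g with sameEdge⁻ y g y∼g
      ... | inj₁ refl = trans (sym same) y∉
      ... | inj₂ refl = trans (cong (subtree b) (α-invol g)) (trans same y∉)

  opaque
    fundamental : Fin n → Fin n → Bool
    fundamental = fund T

    fundamental-αˡ : ∀ e f → fundamental (α e) f ≡ fundamental e f
    fundamental-αˡ e f rewrite sym (lookup-α T-sub e) with lookup T e
    ... | true =
      cong isSpanningTree (tabulate-cong λ h →
        cong (λ b → (lookup T h ∧ not b) ∨ sameEdge h f) (sameEdge-αʳ h e))
    ... | false =
      cong isSpanningTree (tabulate-cong λ h →
        cong (λ b → (lookup T h ∨ b) ∧ not (sameEdge h f)) (sameEdge-αʳ h e))

    fundamental-αʳ : ∀ e f → fundamental e (α f) ≡ fundamental e f
    fundamental-αʳ e f with lookup T e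
    ... | true =
      cong isSpanningTree (tabulate-cong λ h →
        cong ((lookup T h ∧ not (sameEdge h e)) ∨_) (sameEdge-αʳ h f))
    ... | false =
      cong isSpanningTree (tabulate-cong λ h →
        cong (λ b → (lookup T h ∨ sameEdge h e) ∧ not b) (sameEdge-αʳ h f))

    fundamental-internal : ∀ {b g} → Internal b → fundamental b g ≡ true ⇔ Crosses b g
    fundamental-internal {b} {g} b-int rewrite internal∈ b-int = mk⇔
      (λ p → removeAdd-crosses b-int (isSpanningTree⁻ p))
      (λ crosses → isSpanningTree⁺ (removeAdd-spanningTree b-int crosses))

    fundamental-external : ∀ {g b} → External g → Internal b → fundamental g b ≡ true ⇔ Crosses b g
    fundamental-external {g} {b} g-ext b-int rewrite external∉ g-ext = mk⇔
      (λ p → removeAdd-crosses b-int (subst SpanningTree exchange≡ (isSpanningTree⁻ p)))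
      (λ crosses →
        isSpanningTree⁺ (subst SpanningTree (sym exchange≡) (removeAdd-spanningTree b-int crosses)))
      where
      exchange≡ : addRemove T g b ≡ removeAdd T b g
      exchange≡ = addRemove≡removeAdd
        (¬-not λ b∼g → not-¬ (internal∈ b-int) (∉-sameEdge b∼g (external∉ g-ext)))

    fundamental-external-refl : ∀ {g} → External g → fundamental g g ≡ true
    fundamental-external-refl g-ext rewrite external∉ g-ext =
      isSpanningTree⁺ (subst SpanningTree (sym (addRemove-same (external∉ g-ext))) tree)

    fundamental-external-external : ∀ {g f} → External g → External f → fundamental g f ≡ true →
        g ≡ f
    fundamental-external-external {g} {f} g-ext f-ext p rewrite external∉ g-ext with g Finₚ.≟ f
    ... | yes g≡f = g≡f
    ... | no g≢f =
      contradiction (trans (size tree′) (sym (size tree))) (ℕₚ.<⇒≢ (ℕₚ.+-monoˡ-< 1 numE<) ∘ sym)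
      where
      T′ : Vec Bool n
      T′ = addRemove T g f
      tree′ : SpanningTree T′
      tree′ = isSpanningTree⁻ p
      g≢αf : g ≢ α f
      g≢αf = first-≢α (external≺ f-ext) (external≺ g-ext)
      g∈T′ : g ∈ˢ T′
      g∈T′ =
        trans (lookup-addRemove g f g)
          (cong₂ _∧_ (∨-introʳ (lookup T g) (sameEdge-refl g)) (cong not (≢⇒¬sameEdge g≢f g≢αf)))
      numE< : numE T < numE T′
      numE< = ≤-reflexive (sym (trans (numE-∖ (subgraph tree′) g∈T′)
                (cong (suc ∘ numE) (addRemove-∖ (external∉ g-ext) (external∉ f-ext)))))

module Activity {n : ℕ} (M : RootedMap n) {T : Vec Bool n} (tree : Components.SpanningTree M T)
  where
  open RootedMap M
  open MapDefs M
  open HalfEdges M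
  open FundamentalCycles M tree public

  opaque
    unfolding time fundamental

    rank : Fin n → ℕ
    rank = edgeRank T

    rank≡edgeRank : ∀ e → rank e ≡ edgeRank T e
    rank≡edgeRank e = refl

    rank-α : ∀ e → rank (α e) ≡ rank e
    rank-α e =
      trans (cong (time (α e) ⊓_) (cong time (α-invol e))) (ℕₚ.⊓-comm (time (α e)) (time e))

    rank-first : ∀ {e} → e ≺ α e → rank e ≡ time e
    rank-first e≺αe = ℕₚ.m≤n⇒m⊓n≡m (<⇒≤ e≺αe)

    isActive : Fin n → Bool
    isActive = active T

    isActive≡active : ∀ e → isActive e ≡ active T e
    isActive≡active e = refl

    isActive-α : ∀ e → isActive (α e) ≡ isActive e
    isActive-α e =
      all-cong (λ f → cong₂ (λ p r → not p ∨ (r ≤ᵇ rank f)) (fundamental-αˡ e f) (rank-α e)) H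

    active⇒rank-≤ : ∀ {e f} → isActive e ≡ true → fundamental e f ≡ true → rank e ≤ rank f
    active⇒rank-≤ {e} {f} act p = ≤ᵇ≡true⇒≤
      (not-∨-elim (all-allFin⁻ (λ f → not (fundamental e f) ∨ (rank e ≤ᵇ rank f)) act f) p)

    inactive⇒rank-> : ∀ {e} → isActive e ≡ false → ∃ λ f → fundamental e f ≡ true × rank f < rank e
    inactive⇒rank-> {e} inact =
      let f , _ , p = all-false⁻ (λ f → not (fundamental e f) ∨ (rank e ≤ᵇ rank f)) H inact
          fundamental-ef , rank> = not-∨-false p
      in f , fundamental-ef , ≤ᵇ≡false⇒> rank>

  active⇒≼ : ∀ {e f} → e ≺ α e → f ≺ α f → isActive e ≡ true → fundamental e f ≡ true → e ≼ f
  active⇒≼ e≺αe f≺αf act p = subst₂ _≤_ (rank-first e≺αe) (rank-first f≺αf) (active⇒rank-≤ act p)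

  inactive⇒≻ : ∀ {e} → e ≺ α e → isActive e ≡ false →
      ∃ λ f → f ≺ α f × fundamental e f ≡ true × f ≺ e
  inactive⇒≻ {e} e≺αe inact with f , p , rank< ← inactive⇒rank-> inact with first-or-second f
  ... | inj₁ f≺αf = f , f≺αf , p , subst₂ _<_ (rank-first f≺αf) (rank-first e≺αe) rank<
  ... | inj₂ αf≺f = α f , αf≺ααf , trans (fundamental-αʳ e f) p ,
          subst₂ _<_ (trans (sym (rank-α f)) (rank-first αf≺ααf)) (rank-first e≺αe) rank<
    where
    αf≺ααf : α f ≺ α (α f)
    αf≺ααf = αα⁺ (α f ≺_) αf≺f

  -- A crossing external edge, traversed in the order of the tour, leaves or enters the subtree.
  Leaves Enters : Fin n → Fin n → Set
  Leaves f g = subtree f g ≡ true × subtree f (α g) ≡ false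
  Enters f g = subtree f g ≡ false × subtree f (α g) ≡ true

  leaves⇒crosses : ∀ {f g} → Leaves f g → Crosses f g
  leaves⇒crosses (g∈ , αg∉) = trans g∈ (cong not (sym αg∉))

  enters⇒crosses : ∀ {f g} → Enters f g → Crosses f g
  enters⇒crosses (g∉ , αg∈) = trans g∉ (cong not (sym αg∈))

  enters-α : ∀ {f g} → Enters f g → Leaves f (α g)
  enters-α {f} (g∉ , αg∈) = αg∈ , αα⁺ (λ h → subtree f h ≡ false) g∉

  leaves-α : ∀ {f g} → Leaves f g → Enters f (α g)
  leaves-α {f} (g∈ , αg∉) = αg∉ , αα⁺ (λ h → subtree f h ≡ true) g∈

  leaves⇒≺ : ∀ {f g} → Leaves f g → f ≺ g
  leaves⇒≺ (g∈ , _) = subtree⇒≻ g∈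

  enters⇒≺ : ∀ {f g} → Internal f → External g → Enters f g → g ≺ f
  enters⇒≺ {f} f-int g-ext (g∉ , αg∈) = ≼∧≢⇒≺
    (≮⇒≥ λ f≺g → not-¬ (subtree⁺ f≺g (≤-trans (<⇒≤ (external≺ g-ext)) (subtree⇒≼α αg∈))) g∉)
    (λ { refl → not-¬ (internal∈ f-int) (external∉ g-ext) })

  leaves-α≺α : ∀ {f g} → External g → Leaves f g → α f ≺ α g
  leaves-α≺α g-ext (g∈ , αg∉) =
    ≰⇒> λ αg≼αf → not-¬ (subtree⁺ (<-trans (subtree⇒≻ g∈) (external≺ g-ext)) αg≼αf) αg∉

  active-internal : ∀ {f g} → Internal f → isActive f ≡ true → External g → ¬ Enters f g
  active-internal f-int act g-ext enters = ℕₚ.<⇒≱ (enters⇒≺ f-int g-ext enters)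
    (active⇒≼ (internal≺ f-int) (external≺ g-ext) act
      (Equivalence.from (fundamental-internal f-int) (enters⇒crosses enters)))

  active-external : ∀ {f g} → External g → isActive g ≡ true → Internal f → ¬ Leaves f g
  active-external g-ext act f-int leaves = ℕₚ.<⇒≱ (leaves⇒≺ leaves)
    (active⇒≼ (external≺ g-ext) (internal≺ f-int) act
      (Equivalence.from (fundamental-external g-ext f-int) (leaves⇒crosses leaves)))

  inactive-internal : ∀ {f} → Internal f → isActive f ≡ false → ∃ λ g → External g × Enters f g
  inactive-internal {f} f-int inact
    with g , g≺αg , p , g≺f ← inactive⇒≻ (internal≺ f-int) inact
    with crosses ← Equivalence.to (fundamental-internal f-int) p with classify-first g≺αg
  ... | inj₁ g-int with refl ← crossing-internal-unique g-int f-int crosses =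
    contradiction g≺f (<-irrefl refl)
  ... | inj₂ g-ext with ≡not-cases crosses
  ... | inj₁ leaves = contradiction g≺f (<-asym (leaves⇒≺ leaves))
  ... | inj₂ enters = g , g-ext , enters

  inactive-external : ∀ {g} → External g → isActive g ≡ false → ∃ λ f → Internal f × Leaves f g
  inactive-external {g} g-ext inact
      with f , f≺αf , p , f≺g ← inactive⇒≻ (external≺ g-ext) inact with classify-first f≺αf
  ... | inj₂ f-ext with refl ← fundamental-external-external g-ext f-ext p =
    contradiction f≺g (<-irrefl refl)
  ... | inj₁ f-int with ≡not-cases (Equivalence.to (fundamental-external g-ext f-int) p)
  ... | inj₁ leaves = f , f-int , leaves
  ... | inj₂ enters = contradiction f≺g (<-asym (enters⇒≺ f-int g-ext enters))

module Intervals {n : ℕ} (M : RootedMap n) where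
  open RootedMap M
  open MapDefs M
  open HalfEdges M
  open Reachability M
  open Components M

  record Interval (T S : Vec Bool n) : Set where
    constructor mkInterval
    field
      tree : SpanningTree T
      S-sub : Subgraph S
      toggled⇒active : ∀ h → lookup S h xor lookup T h ≡ true → active T h ≡ true

  inInterval⁻ : ∀ {T S} → inInterval T S ≡ true → Interval T S
  inInterval⁻ {T} {S} p = mkInterval
    (isSpanningTree⁻ (∧-conicalˡ _ _ p))
    (isSubgraph⁻ (∧-conicalˡ _ _ q))
    λ h → not-∨-elim (all-allFin⁻ (λ h → not (lookup S h xor lookup T h) ∨ active T h)
                       (∧-conicalʳ (isSubgraph S) _ q) h)
    where
    q : isSubgraph S ∧ all (λ h → not (lookup S h xor lookup T h) ∨ active T h) H ≡ true
    q = ∧-conicalʳ (isSpanningTree T) _ p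

  inInterval⁺ : ∀ {T S} → Interval T S → inInterval T S ≡ true
  inInterval⁺ (mkInterval tree S-sub act) = cong₂ _∧_ (isSpanningTree⁺ tree)
    (cong₂ _∧_ (isSubgraph⁺ S-sub) (all-allFin⁺ _ λ h → not-∨-intro (act h)))

  record Preimage (O : Vec Bool n) : Set where
    constructor mkPreimage
    field
      {T S} : Vec Bool n
      interval : Interval T S
      image : Φ T S ≡ O

  record PredecessorClosed (O : Vec Bool n) (X : Fin n → Bool) : Set where
    field
      closed-≈ : ∀ {x y} → x ≈ y → X x ≡ X y
      closed-tail : ∀ {h} → h ∈ˢ O → X (α h) ≡ true → X h ≡ true

    closed-⟶ : ∀ {x y} → O ⊢ x ⟶ y → X y ≡ true → X x ≡ true
    closed-⟶ {x} x⟶y y∈ = ¬-not λ x∉ → not-¬ y∈ (⟶-induction (λ z → X z ≡ false) x∉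
      (λ y∉ y≈z → trans (sym (closed-≈ y≈z)) y∉)
      (λ y∉ y∈O → ¬-not λ αy∈ → not-¬ (closed-tail y∈O αy∈) y∉) x⟶y)
  open PredecessorClosed public

module Orientation {n : ℕ} (M : RootedMap n) {O : Vec Bool n} (π : Intervals.Preimage M O) where
  open RootedMap M
  open MapDefs M
  open HalfEdges M
  open Reachability M
  open Intervals M
  open Preimage π public using (T; S)
  open Interval (Preimage.interval π) public
  open Activity M tree public

  isToggled : Fin n → Bool
  isToggled h = lookup S h xor lookup T h

  isToggled-α : α-Invariant isToggled
  isToggled-α h = cong₂ _xor_ (lookup-α S-sub h) (lookup-α T-sub h)

  toggled⇒isActive : ∀ {h} → isToggled h ≡ true → isActive h ≡ true
  toggled⇒isActive {h} p = trans (isActive≡active h) (toggled⇒active h p)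

  opaque
    unfolding time fundamental

    meetsΔ : Fin n → Bool
    meetsΔ h = any (λ f → fundamental h f ∧ isToggled f) H

    meetsΔ-α : ∀ h → meetsΔ (α h) ≡ meetsΔ h
    meetsΔ-α h = any-cong (λ f → cong (_∧ isToggled f) (fundamental-αˡ h f)) H

    meetsΔ⁺ : ∀ {h f} → fundamental h f ≡ true → isToggled f ≡ true → meetsΔ h ≡ true
    meetsΔ⁺ {h} {f} p q = any-allFin⁺ (λ f → fundamental h f ∧ isToggled f) f (cong₂ _∧_ p q)

    meetsΔ⁻ : ∀ {h} → meetsΔ h ≡ true → ∃ λ f → fundamental h f ≡ true × isToggled f ≡ true
    meetsΔ⁻ {h} p = let f , q = any-allFin⁻ (λ f → fundamental h f ∧ isToggled f) p
                    in f , ∧-conicalˡ _ _ q , ∧-conicalʳ (fundamental h f) _ q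

    lookup-O : ∀ h →
        lookup O h
          ≡ not ((time h <ᵇ time (α h)) xor (if lookup T h then not (meetsΔ h) else meetsΔ h))
    lookup-O h = trans (cong (λ v → lookup v h) (sym (Preimage.image π))) (lookup∘tabulate _ h)

  O-flip : ∀ h → lookup O h ≡ not (lookup O (α h))
  O-flip h = begin
    lookup O h
      ≡⟨ lookup-O h ⟩
    not (first h xor reference h)
      ≡⟨ cong not (not-involutive _) ⟨
    not (not (not (first h xor reference h)))
      ≡⟨ cong (not ∘ not) (𝔹ₚ.not-distribˡ-xor (first h) _) ⟩
    not (not (not (first h) xor reference h))
      ≡⟨ cong₂ (λ a b → not (not (a xor b))) (halving-via time time-injective h) reference-α ⟨
    not (not (first (α h) xor reference (α h)))
      ≡⟨ cong not (lookup-O (α h)) ⟨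
    not (lookup O (α h)) ∎
    where
    open ≡-Reasoning
    first reference : Fin n → Bool
    first h = time h <ᵇ time (α h)
    reference h = if lookup T h then not (meetsΔ h) else meetsΔ h
    reference-α : reference (α h) ≡ reference h
    reference-α = cong₂ (λ a b → if a then not b else b) (sym (lookup-α T-sub h)) (meetsΔ-α h)

  tail⇒¬head : ∀ {h} → h ∈ˢ O → ¬ α h ∈ˢ O
  tail⇒¬head {h} h∈O αh∈O = not-¬ h∈O (trans (O-flip h) (cong not αh∈O))

  ¬tail⇒head : ∀ {h} → h ∉ˢ O → α h ∈ˢ O
  ¬tail⇒head {h} h∉O = not-injective (trans (sym (O-flip h)) h∉O)

  O-internal : ∀ {b} → Internal b → lookup O b ≡ not (meetsΔ b)
  O-internal {b} b-int rewrite lookup-O b | internal∈ b-int | <⇒<ᵇ≡true (internal≺ b-int) =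
    not-involutive _

  O-external : ∀ {g} → External g → lookup O g ≡ meetsΔ g
  O-external {g} g-ext rewrite lookup-O g | external∉ g-ext | <⇒<ᵇ≡true (external≺ g-ext) =
    not-involutive _

  meetsΔ-first : ∀ {h} → meetsΔ h ≡ true →
      ∃ λ f → f ≺ α f × fundamental h f ≡ true × isToggled f ≡ true
  meetsΔ-first {h} p with f , q , r ← meetsΔ⁻ p with first-or-second f
  ... | inj₁ f≺αf = f , f≺αf , q , r
  ... | inj₂ αf≺f =
    α f , αα⁺ (α f ≺_) αf≺f , trans (fundamental-αʳ h f) q , trans (sym (isToggled-α f)) r

  meetsΔ-internal⁺ : ∀ {b f} → Internal b → Crosses b f → isToggled f ≡ true → meetsΔ b ≡ true
  meetsΔ-internal⁺ b-int crosses = meetsΔ⁺ (Equivalence.from (fundamental-internal b-int) crosses)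

  meetsΔ-internal-self : ∀ {b} → Internal b → isToggled b ≡ true → meetsΔ b ≡ true
  meetsΔ-internal-self b-int = meetsΔ-internal⁺ b-int (crosses-self b-int)

  meetsΔ-external⁺ : ∀ {g b} → External g → Internal b → Crosses b g → isToggled b ≡ true →
      meetsΔ g ≡ true
  meetsΔ-external⁺ g-ext b-int crosses =
    meetsΔ⁺ (Equivalence.from (fundamental-external g-ext b-int) crosses)

  meetsΔ-external-self : ∀ {g} → External g → isToggled g ≡ true → meetsΔ g ≡ true
  meetsΔ-external-self g-ext = meetsΔ⁺ (fundamental-external-refl g-ext)

  toggled-internal⇒α-tail : ∀ {b} → Internal b → isToggled b ≡ true → α b ∈ˢ O
  toggled-internal⇒α-tail b-int b-tog =
    ¬tail⇒head (trans (O-internal b-int) (cong not (meetsΔ-internal-self b-int b-tog)))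

  toggled-external⇒tail : ∀ {g} → External g → isToggled g ≡ true → g ∈ˢ O
  toggled-external⇒tail g-ext g-tog = trans (O-external g-ext) (meetsΔ-external-self g-ext g-tog)

  data InternalState (b : Fin n) : Set where
    toggled        : isToggled b ≡ true → α b ∈ˢ O → InternalState b
    untouched      : isToggled b ≡ false → b ∈ˢ O → InternalState b
    onToggledCycle : ∀ {a} → isToggled b ≡ false → α b ∈ˢ O →
                     External a → isToggled a ≡ true → Enters b a → InternalState b

  internalState : ∀ {b} → Internal b → InternalState b
  internalState {b} b-int with true⊎false (isToggled b) | true⊎false (meetsΔ b)
  ... | inj₁ b-tog | _ = toggled b-tog (toggled-internal⇒α-tail b-int b-tog)
  ... | inj₂ ¬b-tog | inj₂ ¬meets = untouched ¬b-tog (trans (O-internal b-int) (cong not ¬meets))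
  ... | inj₂ ¬b-tog | inj₁ meets
      with f , f≺αf , p , f-tog ← meetsΔ-first meets
      with crosses ← Equivalence.to (fundamental-internal b-int) p | classify-first f≺αf
  ... | inj₁ f-int with refl ← crossing-internal-unique f-int b-int crosses =
    contradiction ¬b-tog (not-¬ f-tog)
  ... | inj₂ f-ext with ≡not-cases crosses
  ... | inj₁ leaves = contradiction leaves (active-external f-ext (toggled⇒isActive f-tog) b-int)
  ... | inj₂ enters =
    onToggledCycle ¬b-tog (¬tail⇒head (trans (O-internal b-int) (cong not meets)))
      f-ext f-tog enters

  data ExternalState (g : Fin n) : Set where
    toggled          : isToggled g ≡ true → g ∈ˢ O → ExternalState g
    untouched        : isToggled g ≡ false → α g ∈ˢ O → meetsΔ g ≡ false → ExternalState g
    onToggledCocycle : ∀ {b} → isToggled g ≡ false → g ∈ˢ O →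
                       Internal b → isToggled b ≡ true → Leaves b g → ExternalState g

  externalState : ∀ {g} → External g → ExternalState g
  externalState {g} g-ext with true⊎false (isToggled g) | true⊎false (meetsΔ g)
  ... | inj₁ g-tog | _ = toggled g-tog (toggled-external⇒tail g-ext g-tog)
  ... | inj₂ ¬g-tog | inj₂ ¬meets =
    untouched ¬g-tog (¬tail⇒head (trans (O-external g-ext) ¬meets)) ¬meets
  ... | inj₂ ¬g-tog | inj₁ meets
      with f , f≺αf , p , f-tog ← meetsΔ-first meets with classify-first f≺αf
  ... | inj₂ f-ext with refl ← fundamental-external-external g-ext f-ext p =
    contradiction ¬g-tog (not-¬ f-tog)
  ... | inj₁ f-int with ≡not-cases (Equivalence.to (fundamental-external g-ext f-int) p)
  ... | inj₁ leaves = onToggledCocycle ¬g-tog (trans (O-external g-ext) meets) f-int f-tog leaves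
  ... | inj₂ enters = contradiction enters (active-internal f-int (toggled⇒isActive f-tog) g-ext)

  subtree-predecessorClosed : ∀ {b} → Internal b → isToggled b ≡ true →
      PredecessorClosed O (subtree b)
  subtree-predecessorClosed {b} b-int b-tog = record
    { closed-≈ = subtree-≈ b-int
    ; closed-tail = λ {h} h∈O αh∈ → ¬-not λ h∉ → ¬entering h∈O h∉ αh∈ (kind h)
    }
    where
    ¬entering : ∀ {h} → h ∈ˢ O → subtree b h ≡ false → subtree b (α h) ≡ true → ¬ Kind h
    ¬entering h∈O h∉ αh∈ (internal-first h-int)
      with refl ← crossing-internal-unique h-int b-int (enters⇒crosses (h∉ , αh∈)) =
      tail⇒¬head h∈O (toggled-internal⇒α-tail b-int b-tog)
    ¬entering h∈O h∉ αh∈ (internal-second αh-int)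
      with refl ← crossing-internal-unique αh-int b-int (leaves⇒crosses (enters-α (h∉ , αh∈))) =
      not-¬ αh∈ (b∉subtree b)
    ¬entering h∈O h∉ αh∈ (external-first h-ext) =
      active-internal b-int (toggled⇒isActive b-tog) h-ext (h∉ , αh∈)
    ¬entering h∈O h∉ αh∈ (external-second αh-ext) = tail⇒¬head h∈O (trans (O-external αh-ext)
      (meetsΔ-external⁺ αh-ext b-int (leaves⇒crosses (enters-α (h∉ , αh∈))) b-tog))

  ¬enters-toggled-subtree : ∀ {b x y} → Internal b → isToggled b ≡ true → O ⊢ x ⟶ y →
                            subtree b x ≡ false → subtree b y ≢ true
  ¬enters-toggled-subtree b-int b-tog x⟶y x∉ y∈ =
    not-¬ (closed-⟶ (subtree-predecessorClosed b-int b-tog) x⟶y y∈) x∉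

  module ToggledCycle {a : Fin n} (a-ext : External a) (a-tog : isToggled a ≡ true) where

    ¬leaves : ∀ {f} → Internal f → ¬ Leaves f a
    ¬leaves = active-external a-ext (toggled⇒isActive a-tog)

    enters⇒α-tail : ∀ {f} → Internal f → Enters f a → α f ∈ˢ O
    enters⇒α-tail f-int enters = ¬tail⇒head
      (trans (O-internal f-int) (cong not (meetsΔ-internal⁺ f-int (enters⇒crosses enters) a-tog)))

    record Exit (X : Fin n → Bool) : Set where
      constructor mkExit
      field
        {f} : Fin n
        f-internal : Internal f
        f-enters : Enters f a
        αf-inside : X (α f) ≡ true
        f-outside : X f ≡ false

      αf-tail : α f ∈ˢ O
      αf-tail = enters⇒α-tail f-internal f-enters

    cycle-exit : ∀ {X} → (∀ {x y} → x ≈ y → X x ≡ X y) → X (α a) ≡ true → X a ≡ false → Exit X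
    cycle-exit X-≈ αa∈ a∉ with separatingEdge X-≈ (α a) a (trans αa∈ (cong not (sym a∉)))
    ... | upwards f-int αa∈f a∉f e e′ = mkExit f-int (a∉f , αa∈f) (trans e αa∈) (trans e′ a∉)
    ... | downwards f-int αa∉f a∈f _ _ = contradiction (a∈f , αa∉f) (¬leaves f-int)

    a-tail : a ∈ˢ O
    a-tail = toggled-external⇒tail a-ext a-tog

    αa⟶a : O ⊢ α a ⟶ a
    αa⟶a = ¬-not λ unreached → let open Exit (cycle-exit canReach-≈ ⟶-refl unreached) in
      not-¬ (⟶-trans αf-inside (α∈⇒⟶ αf-tail)) f-outside

    module _ {g : Fin n} (g-int : Internal g) (g-enters : Enters g a) where

      private
        g⟶a : O ⊢ g ⟶ a
        g⟶a = ¬-not λ unreached → absurd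
          (cycle-exit X-≈ (∨-introʳ (canReach O g (α a)) (proj₂ g-enters))
            (cong₂ _∨_ unreached (proj₁ g-enters)))
          where
          X : Fin n → Bool
          X z = canReach O g z ∨ subtree g z
          X-≈ : ∀ {x y} → x ≈ y → X x ≡ X y
          X-≈ x≈y = cong₂ _∨_ (canReach-≈ x≈y) (subtree-≈ g-int x≈y)
          absurd : ¬ Exit X
          absurd exit =
            [ (λ g⟶αf → not-¬ (⟶-trans g⟶αf (α∈⇒⟶ αf-tail)) unreached-f) , at-g ]′
              (∨-elim (canReach O g (α f)) αf-inside)
            where
            open Exit exit
            unreached-f : canReach O g f ≡ false
            unreached-f = 𝔹ₚ.∨-conicalˡ _ _ f-outside
            at-g : subtree g (α f) ≢ true
            at-g αf∈ with refl ← crossing-internal-unique f-internal g-int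
              (enters⇒crosses (𝔹ₚ.∨-conicalʳ (canReach O g f) _ f-outside , αf∈)) =
                not-¬ ⟶-refl unreached-f

        αa⟶αg : O ⊢ α a ⟶ α g
        αa⟶αg = subst (λ f → O ⊢ α a ⟶ α f) f≡g (∧-conicalˡ _ _ αf-inside)
          where
          open Exit (cycle-exit {λ z → canReach O (α a) z ∧ subtree g z}
            (λ x≈y → cong₂ _∧_ (canReach-≈ x≈y) (subtree-≈ g-int x≈y))
            (cong₂ _∧_ ⟶-refl (proj₂ g-enters))
            (trans (cong (canReach O (α a) a ∧_) (proj₁ g-enters)) (∧-zeroʳ _)))
          f∉ : subtree g f ≡ false
          f∉ = ¬-not λ f∈ →
            not-¬ (cong₂ _∧_ (⟶-trans (∧-conicalˡ _ _ αf-inside) (α∈⇒⟶ αf-tail)) f∈) f-outside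
          f≡g : f ≡ g
          f≡g = crossing-internal-unique f-internal g-int
            (enters⇒crosses (f∉ , ∧-conicalʳ (canReach O (α a) (α f)) _ αf-inside))

      enters⇒⟶α : O ⊢ g ⟶ α g
      enters⇒⟶α = ⟶-trans g⟶a (⟶-trans (∈⇒⟶α a-tail) αa⟶αg)

  untoggled-internal⇒⟶α : ∀ {b} → Internal b → isToggled b ≡ false → O ⊢ b ⟶ α b
  untoggled-internal⇒⟶α b-int ¬b-tog with internalState b-int
  ... | toggled b-tog _ = contradiction ¬b-tog (not-¬ b-tog)
  ... | untouched _ b∈O = ∈⇒⟶α b∈O
  ... | onToggledCycle _ _ a-ext a-tog enters = ToggledCycle.enters⇒⟶α a-ext a-tog b-int enters

  -- The tree path from the root to y first enters a predecessor-closed set along a toggled edge.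
  record ToggledEntry (X : Fin n → Bool) (y : Fin n) : Set where
    constructor mkToggledEntry
    field
      {f} : Fin n
      f-internal : Internal f
      f-toggled : isToggled f ≡ true
      y∈subtree : subtree f y ≡ true
      f-outside : X f ≡ false
      αf-inside : X (α f) ≡ true

  toggledEntry : ∀ {X y} → PredecessorClosed O X → X y ≡ true → X h₀ ≡ false → ToggledEntry X y
  toggledEntry {X} {y} closed y∈ h₀∉
      with separatingEdge (closed-≈ closed) y h₀ (trans y∈ (cong not (sym h₀∉)))
  ... | downwards f-int _ h₀∈f _ _ = contradiction (h₀∉subtree _) (not-¬ h₀∈f)
  ... | upwards {f} f-int y∈f _ αf∈ f∉ with true⊎false (isToggled f)
  ... | inj₁ f-tog = mkToggledEntry f-int f-tog y∈f (trans f∉ h₀∉) (trans αf∈ y∈)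
  ... | inj₂ ¬f-tog = contradiction (trans f∉ h₀∉)
          (not-¬ (closed-⟶ closed (untoggled-internal⇒⟶α f-int ¬f-tog) (trans αf∈ y∈)))

module TwoPreimages {n : ℕ} (M : RootedMap n) {O : Vec Bool n} (π π′ : Intervals.Preimage M O) where
  open Intervals M
  private
    module X = Orientation M π
    module Y = Orientation M π′

  internal-toggled-in-both : ∀ {b} → X.Internal b → Y.Internal b → X.isToggled b ≡ true →
      Y.isToggled b ≡ true
  internal-toggled-in-both b-X b-Y b-tog with Y.internalState b-Y
  ... | Y.toggled b-tog′ _ = b-tog′
  ... | Y.untouched _ b∈O = contradiction (X.toggled-internal⇒α-tail b-X b-tog) (X.tail⇒¬head b∈O)
  ... | Y.onToggledCycle _ _ a-ext a-tog enters = contradiction (X.αb∈subtree (X.internal≺ b-X))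
          (X.¬enters-toggled-subtree b-X b-tog (Y.ToggledCycle.enters⇒⟶α a-ext a-tog b-Y enters)
            (X.b∉subtree _))

  external-toggled-in-both : ∀ {g} → X.External g → Y.External g → X.isToggled g ≡ true →
      Y.isToggled g ≡ true
  external-toggled-in-both g-X g-Y g-tog with Y.externalState g-Y
  ... | Y.toggled g-tog′ _ = g-tog′
  ... | Y.untouched _ αg∈O _ = contradiction αg∈O (X.tail⇒¬head (X.toggled-external⇒tail g-X g-tog))
  ... | Y.onToggledCocycle _ _ b-int b-tog (g∈ , αg∉) = contradiction g∈
          (Y.¬enters-toggled-subtree b-int b-tog (X.ToggledCycle.αa⟶a g-X g-tog) αg∉)

module Disagreement {n : ℕ} (M : RootedMap n) {O : Vec Bool n} (π π′ : Intervals.Preimage M O) where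
  open RootedMap M
  open HalfEdges M
  open Reachability M
  open Intervals M
  open TwoPreimages M π π′
  private
    module X = Orientation M π
    module Y = Orientation M π′

  -- The tours of T and T′ first disagree at b, which is internal for T and external for T′.
  module _ {b : Fin n} (b∈T : b ∈ˢ X.T) (b∉T′ : b ∉ˢ Y.T) (same-time : X.time b ≡ Y.time b)
    (X-earlier : ∀ {x} → x X.≺ b → Y.time x ≡ X.time x × lookup X.T x ≡ lookup Y.T x)
    (Y-earlier : ∀ {x} → x Y.≺ b → X.time x ≡ Y.time x × lookup X.T x ≡ lookup Y.T x) where

    later-in-Y : ∀ {x} → b X.≺ x → b Y.≺ x
    later-in-Y b≺x = Y.≼∧≢⇒≺
      (≮⇒≥ λ x≺b → <-asym b≺x (subst₂ _<_ (sym (proj₁ (Y-earlier x≺b))) (sym same-time) x≺b))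
      λ { refl → <-irrefl refl b≺x }

    later-in-X : ∀ {x} → b Y.≺ x → b X.≺ x
    later-in-X b≺x = X.≼∧≢⇒≺
      (≮⇒≥ λ x≺b → <-asym b≺x (subst₂ _<_ (sym (proj₁ (X-earlier x≺b))) same-time x≺b))
      λ { refl → <-irrefl refl b≺x }

    disagree⇒later : ∀ {x} → x ∉ˢ X.T → x ∈ˢ Y.T → b X.≺ x
    disagree⇒later x∉T x∈T′ = X.≼∧≢⇒≺
      (≮⇒≥ λ x≺b → not-¬ x∈T′ (trans (sym (proj₂ (X-earlier x≺b))) x∉T))
      λ { refl → not-¬ b∈T x∉T }

    αb-later : b X.≺ α b
    αb-later = X.≼∧≢⇒≺
      (≮⇒≥ λ αb≺b → not-¬ (α∈ X.T-sub b∈T) (trans (proj₂ (X-earlier αb≺b)) (α∉ Y.T-sub b∉T′)))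
      (α-fpf b ∘ sym)

    b-internal : X.Internal b
    b-internal = X.mkInternal b∈T αb-later

    b-external : Y.External b
    b-external = Y.mkExternal b∉T′ (later-in-Y αb-later)

    b-subtree-closed : ∀ {f} → f ∈ˢ X.T → f ∈ˢ Y.T → X.subtree b f ≡ X.subtree b (α f)
    b-subtree-closed f∈T f∈T′ = X.subtree-internal b-internal f∈T
      (λ { refl → not-¬ f∈T′ b∉T′ }) (λ { refl → not-¬ f∈T′ (α∉ Y.T-sub b∉T′) })

    crosses⇒∉ : ∀ {f} → f ∈ˢ Y.T → X.Crosses b f → f ∉ˢ X.T
    crosses⇒∉ f∈T′ crosses = ¬-not λ f∈T → ≡not⇒≢ crosses (b-subtree-closed f∈T f∈T′)

    no-late-entry : ∀ {f} → f ∉ˢ X.T → b X.≺ f → X.Enters b f → α f ∈ˢ O → ¬ O ⊢ f ⟶ α f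
    no-late-entry {f} f∉T b≺f (f∉ , αf∈) αf∈O f⟶αf with X.first-or-second f
    ... | inj₁ f≺αf = not-¬ (X.subtree⁺ b≺f (≤-trans (<⇒≤ f≺αf) (X.subtree⇒≼α αf∈))) f∉
    ... | inj₂ αf≺f = impossible (X.externalState αf-ext)
      where
      αf-ext : X.External (α f)
      αf-ext = X.mkExternal (α∉ X.T-sub f∉T) (αα⁺ (α f X.≺_) αf≺f)
      impossible : ¬ X.ExternalState (α f)
      impossible (X.toggled αf-tog _) =
        X.active-external αf-ext (X.toggled⇒isActive αf-tog) b-internal (X.enters-α (f∉ , αf∈))
      impossible (X.untouched _ ααf∈O _) = X.tail⇒¬head αf∈O ααf∈O
      impossible (X.onToggledCocycle {c} _ _ c-int c-tog (αf∈c , ααf∉c)) =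
        X.¬enters-toggled-subtree c-int c-tog f⟶αf
          (αα⁻ (λ h → X.subtree c h ≡ false) ααf∉c) αf∈c

    no-entering-cycle : ∀ {a} → Y.External a → Y.isToggled a ≡ true → ¬ X.Enters b a
    no-entering-cycle a-ext a-tog (a∉ , αa∈) =
      no-late-entry f∉T (disagree⇒later f∉T f∈T′) (f-outside , αf-inside) αf-tail
        (enters⇒⟶α f-internal f-enters)
      where
      open Y.ToggledCycle a-ext a-tog
      open Exit (cycle-exit (X.subtree-≈ b-internal) αa∈ a∉)
      f∈T′ : f ∈ˢ Y.T
      f∈T′ = Y.internal∈ f-internal
      f∉T : f ∉ˢ X.T
      f∉T = crosses⇒∉ f∈T′ (X.enters⇒crosses {b} (f-outside , αf-inside))

    ¬X-onToggledCycle : ∀ {a} → X.External a → X.isToggled a ≡ true → ¬ X.Enters b a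
    ¬X-onToggledCycle {a} a-ext a-tog enters =
      no-entering-cycle a-ext′ (external-toggled-in-both a-ext a-ext′ a-tog) enters
      where
      a≺b : a X.≺ b
      a≺b = X.enters⇒≺ b-internal a-ext enters
      a≺′αa : a Y.≺ α a
      a≺′αa = <-trans (subst₂ _<_ (sym (proj₁ (X-earlier a≺b))) same-time a≺b)
        (later-in-Y (X.subtree⇒≻ (proj₂ enters)))
      a-ext′ : Y.External a
      a-ext′ = Y.mkExternal (trans (sym (proj₂ (X-earlier a≺b))) (X.external∉ a-ext)) a≺′αa

    ¬Y-toggled : Y.isToggled b ≢ true
    ¬Y-toggled b-tog = no-entering-cycle b-external b-tog (X.b∉subtree b , X.αb∈subtree αb-later)

    ¬X-toggled-Y-untouched : X.isToggled b ≡ true → Y.meetsΔ b ≢ false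
    ¬X-toggled-Y-untouched b-tog ¬meets =
      not-¬ f∈T (crosses⇒∉ f∈T′ (X.enters⇒crosses {b} (f-outside , αf-inside)))
      where
      open Y.ToggledEntry (Y.toggledEntry (X.subtree-predecessorClosed b-internal b-tog)
        (X.αb∈subtree αb-later) (X.h₀∉subtree b))
      f∈T′ : f ∈ˢ Y.T
      f∈T′ = Y.internal∈ f-internal
      b∈subtree : Y.subtree f b ≡ true
      b∈subtree = ¬-not λ b∉ →
        not-¬ (Y.meetsΔ-external⁺ b-external f-internal
                (Y.enters⇒crosses {f} (b∉ , y∈subtree)) f-toggled) ¬meets
      f∈T : f ∈ˢ X.T
      f∈T = trans (proj₂ (Y-earlier (Y.subtree⇒≻ b∈subtree))) f∈T′

    ¬Y-onToggledCocycle : ∀ {c} → b ∈ˢ O → Y.Internal c → Y.isToggled c ≡ true → ¬ Y.Leaves c b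
    ¬Y-onToggledCocycle {c} b∈O c-int c-tog (b∈c , αb∉c) = impossible
      (Y.toggledEntry (X.subtree-predecessorClosed c-int′ c-tog′) αb∈c (X.h₀∉subtree c))
      where
      c-earlier : X.time c ≡ Y.time c × lookup X.T c ≡ lookup Y.T c
      c-earlier = Y-earlier (Y.subtree⇒≻ b∈c)
      b≢c : b ≢ c
      b≢c refl = not-¬ (Y.internal∈ c-int) b∉T′
      b≢αc : b ≢ α c
      b≢αc refl = not-¬ (α∈ Y.T-sub (Y.internal∈ c-int)) b∉T′
      b≺αc : b X.≺ α c
      b≺αc = later-in-X (Y.≼∧≢⇒≺ (Y.subtree⇒≼α b∈c) b≢αc)
      c≺b : c X.≺ b
      c≺b = subst₂ _<_ (sym (proj₁ c-earlier)) (sym same-time) (Y.subtree⇒≻ b∈c)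
      c-int′ : X.Internal c
      c-int′ = X.mkInternal (trans (proj₂ c-earlier) (Y.internal∈ c-int)) (<-trans c≺b b≺αc)
      c-tog′ : X.isToggled c ≡ true
      c-tog′ = TwoPreimages.internal-toggled-in-both M π′ π c-int c-int′ c-tog
      αb∈c : X.subtree c (α b) ≡ true
      αb∈c = trans (sym (X.subtree-internal c-int′ b∈T b≢c b≢αc)) (X.subtree⁺ c≺b (<⇒≤ b≺αc))
      impossible : ¬ Y.ToggledEntry (X.subtree c) (α b)
      impossible entry = not-¬ αf-inside
        (trans (sym (X.subtree-internal c-int′ f∈T f≢c (Y.internal-≢α c-int f-internal))) f-outside)
        where
        open Y.ToggledEntry entry
        b∈f : Y.subtree f b ≡ true
        b∈f = closed-tail (Y.subtree-predecessorClosed f-internal f-toggled) b∈O y∈subtree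
        f∈T : f ∈ˢ X.T
        f∈T = trans (proj₂ (Y-earlier (Y.subtree⇒≻ b∈f))) (Y.internal∈ f-internal)
        f≢c : f ≢ c
        f≢c refl = not-¬ y∈subtree αb∉c

    disagreement-impossible : ⊥
    disagreement-impossible = absurd (X.internalState b-internal) (Y.externalState b-external)
      where
      absurd : X.InternalState b → Y.ExternalState b → ⊥
      absurd (X.toggled b-tog _) (Y.untouched _ _ ¬meets) = ¬X-toggled-Y-untouched b-tog ¬meets
      absurd (X.toggled _ αb∈O) (Y.toggled _ b∈O) = X.tail⇒¬head b∈O αb∈O
      absurd (X.toggled _ αb∈O) (Y.onToggledCocycle _ b∈O _ _ _) = X.tail⇒¬head b∈O αb∈O
      absurd (X.untouched _ _) (Y.toggled b-tog _) = ¬Y-toggled b-tog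
      absurd (X.untouched _ b∈O) (Y.untouched _ αb∈O _) = X.tail⇒¬head b∈O αb∈O
      absurd (X.untouched _ b∈O) (Y.onToggledCocycle _ _ c-int c-tog leaves) =
        ¬Y-onToggledCocycle b∈O c-int c-tog leaves
      absurd (X.onToggledCycle _ αb∈O _ _ _) (Y.toggled _ b∈O) = X.tail⇒¬head b∈O αb∈O
      absurd (X.onToggledCycle _ _ a-ext a-tog enters) (Y.untouched _ _ _) =
        ¬X-onToggledCycle a-ext a-tog enters
      absurd (X.onToggledCycle _ αb∈O _ _ _) (Y.onToggledCocycle _ b∈O _ _ _) =
        X.tail⇒¬head b∈O αb∈O

module Injectivity {n : ℕ} (M : RootedMap n) where
  open RootedMap M
  open MapDefs M
  open HalfEdges M
  open Motion M
  open Intervals M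

  module _ {O : Vec Bool n} (π π′ : Preimage O) where
    private
      module X = Orientation M π
      module Y = Orientation M π′

    AgreeAt : ℕ → Set
    AgreeAt k = lookup X.T (iter X.t k h₀) ≡ lookup Y.T (iter X.t k h₀)

    module _ {k : ℕ} (k<n : k < n) (before : ∀ {j} → j < k → AgreeAt j) where
      private
        b : Fin n
        b = iter X.t k h₀

        same-iter : ∀ j → j ≤ k → iter X.t j h₀ ≡ iter Y.t j h₀
        same-iter zero _ = refl
        same-iter (suc j) j<k =
          trans (motion-cong X.T Y.T (before j<k)) (cong Y.t (same-iter j (<⇒≤ j<k)))

        Y-time : ∀ {j} → j ≤ k → Y.time (iter X.t j h₀) ≡ j
        Y-time {j} j≤k = trans (cong Y.time (same-iter j j≤k)) (Y.time-iter (≤-<-trans j≤k k<n))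

        X-time-b : X.time b ≡ k
        X-time-b = X.time-iter k<n

        same-time : X.time b ≡ Y.time b
        same-time = trans X-time-b (sym (Y-time ≤-refl))

        X-earlier : ∀ {x} → x X.≺ b → Y.time x ≡ X.time x × lookup X.T x ≡ lookup Y.T x
        X-earlier {x} x≺b = trans (cong Y.time (sym (X.iter-time x))) (Y-time (<⇒≤ <k)) ,
          subst (λ y → lookup X.T y ≡ lookup Y.T y) (X.iter-time x) (before <k)
          where
          <k : X.time x < k
          <k = subst (X.time x <_) X-time-b x≺b

        Y-earlier : ∀ {x} → x Y.≺ b → X.time x ≡ Y.time x × lookup X.T x ≡ lookup Y.T x
        Y-earlier {x} x≺b = same , proj₂ (X-earlier (subst₂ _<_ (sym same) (sym same-time) x≺b))
          where
          <k : Y.time x < k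
          <k = subst (Y.time x <_) (Y-time ≤-refl) x≺b
          same : X.time x ≡ Y.time x
          same = begin
            X.time x                        ≡⟨ cong X.time (Y.iter-time x) ⟨
            X.time (iter Y.t (Y.time x) h₀) ≡⟨ cong X.time (same-iter (Y.time x) (<⇒≤ <k)) ⟨
            X.time (iter X.t (Y.time x) h₀) ≡⟨ X.time-iter (<-trans <k k<n) ⟩
            Y.time x                        ∎
            where open ≡-Reasoning

      agree-at-k : AgreeAt k
      agree-at-k with true⊎false (lookup X.T b) | true⊎false (lookup Y.T b)
      ... | inj₁ b∈T | inj₁ b∈T′ = trans b∈T (sym b∈T′)
      ... | inj₂ b∉T | inj₂ b∉T′ = trans b∉T (sym b∉T′)
      ... | inj₁ b∈T | inj₂ b∉T′ = ⊥-elim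
        (Disagreement.disagreement-impossible M π π′ b∈T b∉T′ same-time X-earlier Y-earlier)
      ... | inj₂ b∉T | inj₁ b∈T′ = ⊥-elim
        (Disagreement.disagreement-impossible M π′ π b∈T′ b∉T (sym same-time)
          (λ x≺b → let e , same = Y-earlier x≺b in e , sym same)
          (λ x≺b → let e , same = X-earlier x≺b in e , sym same))

    tours-agree : ∀ k → k < n → AgreeAt k
    tours-agree = <-rec (λ k → k < n → AgreeAt k)
      λ k earlier k<n → agree-at-k k<n λ j<k → earlier j<k (<-trans j<k k<n)

    T-unique : X.T ≡ Y.T
    T-unique = lookup-extensional λ x → subst (λ y → lookup X.T y ≡ lookup Y.T y) (X.iter-time x)
      (tours-agree (X.time x) (X.time<n x))

  S-unique : ∀ {O} (π π′ : Preimage O) → Preimage.T π ≡ Preimage.T π′ → Preimage.S π ≡ Preimage.S π′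
  S-unique {O} π@(mkPreimage {T} _ _) π′@(mkPreimage _ _) refl =
    lookup-extensional λ x → xor-cancelʳ (lookup T x) (same-toggled x)
    where
    module X = Orientation M π
    module Y = Orientation M π′
    same-time : ∀ x → X.time x ≡ Y.time x
    same-time x = trans (X.time≡pos x) (sym (Y.time≡pos x))
    transfer : ∀ {x y} → x X.≺ y → x Y.≺ y
    transfer = subst₂ _<_ (same-time _) (same-time _)
    same-toggled-first : ∀ {x} → X.Internal x ⊎ X.External x → X.isToggled x ≡ Y.isToggled x
    same-toggled-first (inj₁ x-int@(X.mkInternal x∈T x≺αx)) = ≡-via-true
      (TwoPreimages.internal-toggled-in-both M π π′ x-int (Y.mkInternal x∈T (transfer x≺αx)))
      (TwoPreimages.internal-toggled-in-both M π′ π (Y.mkInternal x∈T (transfer x≺αx)) x-int)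
    same-toggled-first (inj₂ x-ext@(X.mkExternal x∉T x≺αx)) = ≡-via-true
      (TwoPreimages.external-toggled-in-both M π π′ x-ext (Y.mkExternal x∉T (transfer x≺αx)))
      (TwoPreimages.external-toggled-in-both M π′ π (Y.mkExternal x∉T (transfer x≺αx)) x-ext)
    via-α : ∀ {x} → X.isToggled (α x) ≡ Y.isToggled (α x) → X.isToggled x ≡ Y.isToggled x
    via-α {x} e = trans (X.isToggled-α x) (trans e (sym (Y.isToggled-α x)))
    same-toggled : ∀ x → X.isToggled x ≡ Y.isToggled x
    same-toggled x with X.first-or-second x
    ... | inj₁ x≺αx = same-toggled-first (X.classify-first x≺αx)
    ... | inj₂ αx≺x = via-α (same-toggled-first (X.classify-first (αα⁺ (α x X.≺_) αx≺x)))

  Φ-injective : ∀ {T S T′ S′} → Interval T S → Interval T′ S′ → Φ T S ≡ Φ T′ S′ → T ≡ T′ × S ≡ S′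
  Φ-injective {T} {S} {T′} {S′} iv iv′ e = T≡T′ , S-unique π π′ T≡T′
    where
    π π′ : Preimage (Φ T′ S′)
    π = mkPreimage iv e
    π′ = mkPreimage iv′ refl
    T≡T′ : T ≡ T′
    T≡T′ = T-unique π π′

-- If T and T′ agree on the half-edges visited by the tour of T after time k, then their tours,
-- traced backwards from h₀, agree after time k.
module LaterAgreement {n : ℕ} (M : RootedMap n) {T T′ : Vec Bool n}
  (tree : Components.SpanningTree M T) (tree′ : Components.SpanningTree M T′) where
  open RootedMap M
  open MapDefs M
  open HalfEdges M
  open Reachability M
  open Motion M
  private
    module X = Activity M tree
    module Y = Activity M tree′

  module _ {k : ℕ} (agree : ∀ {x} → k < X.time x → lookup T x ≡ lookup T′ x) where

    same-iter : ∀ {j} → k < j → j ≤ n → iter X.t j h₀ ≡ iter Y.t j h₀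
    same-iter {j} k<j j≤n = backwards (n ∸ j) k<j (ℕₚ.m∸n+n≡m j≤n)
      where
      backwards : ∀ d {j} → k < j → d + j ≡ n → iter X.t j h₀ ≡ iter Y.t j h₀
      backwards zero k<j refl = trans X.iter-n (sym Y.iter-n)
      backwards (suc d) {j} k<j refl = motion-injective Y.T-sub (begin
        motion T′ (iter X.t j h₀)
          ≡⟨ motion-cong T T′ (agree (subst (k <_) (sym (X.time-iter j<n)) k<j)) ⟨
        iter X.t (suc j) h₀
          ≡⟨ backwards d (ℕₚ.m<n⇒m<1+n k<j) (+-suc d j) ⟩
        iter Y.t (suc j) h₀ ∎)
        where
        open ≡-Reasoning
        j<n : j < suc d + j
        j<n = s≤s (ℕₚ.m≤n+m j d)

    later-in-Y : ∀ {x} → k < X.time x → Y.time x ≡ X.time x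
    later-in-Y {x} k< =
      trans (cong Y.time (trans (sym (X.iter-time x)) (same-iter k< (<⇒≤ (X.time<n x)))))
            (Y.time-iter (X.time<n x))

    later-in-X : ∀ {x} → k < Y.time x → X.time x ≡ Y.time x
    later-in-X {x} k< =
      trans (cong X.time (trans (sym (Y.iter-time x)) (sym (same-iter k< (<⇒≤ (Y.time<n x))))))
            (X.time-iter (Y.time<n x))

    disagree⇒early : ∀ {x} → x ∉ˢ T → x ∈ˢ T′ → X.time x ≤ k
    disagree⇒early x∉T x∈T′ = ≮⇒≥ λ k< → not-¬ x∈T′ (trans (sym (agree k<)) x∉T)

    agree-α : ∀ {x} → k < X.time (α x) → lookup T x ≡ lookup T′ x
    agree-α {x} k< = trans (lookup-α X.T-sub x) (trans (agree k<) (sym (lookup-α Y.T-sub x)))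

    first-in-Y : ∀ {x} → k < X.time (α x) → x X.≺ α x → x Y.≺ α x
    first-in-Y {x} k< x≺αx with ℕₚ.<-≤-connex k (Y.time x)
    ... | inj₁ k<x = subst₂ _<_ (later-in-X k<x) (sym (later-in-Y k<)) x≺αx
    ... | inj₂ x≤k = ≤-<-trans x≤k (subst (k <_) (sym (later-in-Y k<)) k<)

    internal-in-Y : ∀ {s} → k < X.time (α s) → X.Internal s → Y.Internal s
    internal-in-Y k< (X.mkInternal s∈T s≺αs) =
      Y.mkInternal (trans (sym (agree-α k<)) s∈T) (first-in-Y k< s≺αs)

    external-in-Y : ∀ {s} → k < X.time (α s) → X.External s → Y.External s
    external-in-Y k< (X.mkExternal s∉T s≺αs) =
      Y.mkExternal (trans (sym (agree-α k<)) s∉T) (first-in-Y k< s≺αs)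

    module _ {s : Fin n} (s-int : X.Internal s) (k<αs : k < X.time (α s))
      (s-active : X.isActive s ≡ true) where

      private
        s-int′ : Y.Internal s
        s-int′ = internal-in-Y k<αs s-int

        no-early-crossing : ∀ {g} → X.External g → X.time (α g) ≤ k → ¬ X.Crosses s g
        no-early-crossing g-ext αg≤k crosses with ≡not-cases crosses
        ... | inj₂ enters = X.active-internal s-int s-active g-ext enters
        ... | inj₁ leaves = <-asym (X.leaves-α≺α g-ext leaves) (≤-<-trans αg≤k k<αs)

        crossing-unique : ∀ {f} → Y.Internal f → X.Crosses s f → f ≡ s
        crossing-unique {f} f-int crosses
            with f Finₚ.≟ s | true⊎false (lookup T f) | X.first-or-second f
        ... | yes f≡s | _ | _ = f≡s
        ... | no f≢s | inj₁ f∈T | _ =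
          contradiction (X.subtree-internal s-int f∈T f≢s (Y.internal-≢α s-int′ f-int))
            (≡not⇒≢ crosses)
        ... | no _ | inj₂ f∉T | inj₁ f≺αf =
          contradiction crosses
            (no-early-crossing (X.mkExternal f∉T f≺αf)
              (disagree⇒early (α∉ X.T-sub f∉T) (α∈ Y.T-sub (Y.internal∈ f-int))))
        ... | no _ | inj₂ f∉T | inj₂ αf≺f =
          contradiction (X.crosses-α crosses)
            (no-early-crossing (X.mkExternal (α∉ X.T-sub f∉T) (αα⁺ (α f X.≺_) αf≺f))
              (αα⁺ (λ h → X.time h ≤ k) (disagree⇒early f∉T (Y.internal∈ f-int))))

        separated-in-Y : ∀ p q → X.subtree s p ≡ not (X.subtree s q) →
            Y.subtree s p ≡ not (Y.subtree s q)
        separated-in-Y p q separated with Y.separatingEdge (X.subtree-≈ s-int) p q separated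
        ... | Y.upwards f-int p∈ q∉ αf∼p f∼q
          with refl ← crossing-unique f-int (trans f∼q (trans (sym (not-involutive _))
                        (cong not (trans (sym separated) (sym αf∼p))))) =
          trans p∈ (cong not (sym q∉))
        ... | Y.downwards f-int p∉ q∈ f∼p αf∼q
          with refl ← crossing-unique f-int (trans f∼p (trans separated (cong not (sym αf∼q)))) =
          trans p∉ (cong not (sym q∈))

        same-subtree : ∀ z → Y.subtree s z ≡ X.subtree s z
        same-subtree z with true⊎false (X.subtree s z)
        ... | inj₁ z∈ =
          trans (trans (separated-in-Y z s (trans z∈ (cong not (sym (X.b∉subtree s)))))
                       (cong not (Y.b∉subtree s)))
                (sym z∈)
        ... | inj₂ z∉ =
          trans (trans (separated-in-Y z (α s) (trans z∉ (cong not (sym αs∈))))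
                       (cong not (Y.αb∈subtree (Y.internal≺ s-int′))))
                (sym z∉)
          where
          αs∈ : X.subtree s (α s) ≡ true
          αs∈ = X.αb∈subtree (X.internal≺ s-int)

      internal-stays-active : Y.isActive s ≡ true
      internal-stays-active = ¬-not λ inactive →
        let g , g-ext , g∉ , αg∈ = Y.inactive-internal s-int′ inactive
        in not-entered g-ext
             (trans (sym (same-subtree g)) g∉ , trans (sym (same-subtree (α g))) αg∈)
        where
        not-entered : ∀ {g} → Y.External g → ¬ X.Enters s g
        not-entered {g} g-ext enters@(g∉ , αg∈) with X.first-or-second g
        ... | inj₁ g≺αg =
          [ not-internal , (λ g-ext′ → X.active-internal s-int s-active g-ext′ enters) ]′
            (X.classify-first g≺αg)
          where
          not-internal : ¬ X.Internal g
          not-internal g-int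
              with refl ← X.crossing-internal-unique g-int s-int (X.enters⇒crosses enters) =
            not-¬ (Y.internal∈ s-int′) (Y.external∉ g-ext)
        ... | inj₂ αg≺g =
          <-asym αg≺g (subst₂ _<_ (later-in-Y k<g) (sym (later-in-X k<αg)) (Y.external≺ g-ext))
          where
          k<g : k < X.time g
          k<g = <-trans k<αs
            (≰⇒> λ g≼αs → not-¬ (X.subtree⁺ (<-trans (X.subtree⇒≻ αg∈) αg≺g) g≼αs) g∉)
          k<αg : k < Y.time (α g)
          k<αg = <-trans (subst (k <_) (sym (later-in-Y k<g)) k<g) (Y.external≺ g-ext)

    module _ {s : Fin n} (s-ext : X.External s) (k<αs : k < X.time (α s))
      (s-active : X.isActive s ≡ true) where

      external-stays-active : Y.isActive s ≡ true
      external-stays-active = ¬-not λ inactive →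
        let f , f-int , leaves = Y.inactive-external s-ext′ inactive in not-left f-int leaves
        where
        s-ext′ : Y.External s
        s-ext′ = external-in-Y k<αs s-ext
        k<α : ∀ {h} → X.subtree h (α s) ≡ true → k < X.time (α h)
        k<α αs∈h = <-≤-trans k<αs (X.subtree⇒≼α αs∈h)
        not-left : ∀ {f} → Y.Internal f → ¬ Y.Leaves f s
        not-left {f} f-int leaves@(s∈ , αs∉)
            with X.separatingEdge (Y.subtree-≈ f-int) s (α s) (Y.leaves⇒crosses leaves)
        ... | X.upwards h-int s∈h αs∉h _ _ = X.active-external s-ext s-active h-int (s∈h , αs∉h)
        ... | X.downwards h-int s∉h αs∈h h∼s αh∼αs
          with refl ← Y.crossing-internal-unique (internal-in-Y (k<α αs∈h) h-int) f-int
                        (trans h∼s (trans s∈ (cong not (sym (trans αh∼αs αs∉))))) =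
          ℕₚ.<⇒≱ (Y.leaves-α≺α s-ext′ leaves)
            (subst₂ _≤_ (sym (later-in-Y k<αs)) (sym (later-in-Y (k<α αs∈h)))
              (X.subtree⇒≼α αs∈h))

    private
      first-stays-active : ∀ {x} → x X.≺ α x → k < X.time (α x) → X.isActive x ≡ true →
          Y.isActive x ≡ true
      first-stays-active x≺αx k<αx act with X.classify-first x≺αx
      ... | inj₁ x-int = internal-stays-active x-int k<αx act
      ... | inj₂ x-ext = external-stays-active x-ext k<αx act

    stays-active : ∀ {x} → k < X.time x → X.isActive x ≡ true → Y.isActive x ≡ true
    stays-active {x} k<x act with X.first-or-second x
    ... | inj₁ x≺αx = first-stays-active x≺αx (<-trans k<x x≺αx) act
    ... | inj₂ αx≺x = trans (sym (Y.isActive-α x)) (first-stays-active (αα⁺ (α x X.≺_) αx≺x)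
            (αα⁺ (λ h → k < X.time h) k<x) (trans (X.isActive-α x) act))

    -- Exchanging the edge visited at time k makes the new tour visit its other half-edge instead.
    visited-at-exchange : ∀ {u} → X.time u ≡ k → lookup T′ u ≡ not (lookup T u) →
        ∀ {x} → Y.time x ≡ k → x ≡ α u
    visited-at-exchange {u} time-u flipped {x} time-x = motion-injective Y.T-sub (begin
      Y.t x
        ≡⟨ cong Y.t (trans (sym (Y.iter-time x)) (cong (λ j → iter Y.t j h₀) time-x)) ⟩
      iter Y.t (suc k) h₀
        ≡⟨ same-iter (n<1+n k) (subst (_< n) time-u (X.time<n u)) ⟨
      iter X.t (suc k) h₀
        ≡⟨ cong X.t (trans (cong (λ j → iter X.t j h₀) (sym time-u)) (X.iter-time u)) ⟩
      X.t u
        ≡⟨ exchanged (true⊎false (lookup T u)) ⟩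
      Y.t (α u) ∎)
      where
      open ≡-Reasoning
      exchanged : u ∈ˢ T ⊎ u ∉ˢ T → X.t u ≡ Y.t (α u)
      exchanged (inj₁ u∈T) =
        trans (motion-∈ T u∈T) (sym (motion-∉ T′ (α∉ Y.T-sub (trans flipped (cong not u∈T)))))
      exchanged (inj₂ u∉T) = trans (motion-∉ T u∉T)
        (sym (trans (motion-∈ T′ (α∈ Y.T-sub (trans flipped (cong not u∉T))))
                    (cong σf (α-invol u))))

module Covering {n : ℕ} (M : RootedMap n) {S : Vec Bool n} (S-sub : Reachability.Subgraph M S) where
  open RootedMap M
  open MapDefs M
  open HalfEdges M
  open Reachability M
  open Components M
  open Intervals M

  ActiveFrom : ℕ → ∀ {T} → SpanningTree T → Set
  ActiveFrom k {T} tree =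
    ∀ {x} → lookup S x xor lookup T x ≡ true → k ≤ Activity.time M tree x →
      Activity.isActive M tree x ≡ true

  ActiveTreeFrom : ℕ → Set
  ActiveTreeFrom k = ∃ λ T → Σ (SpanningTree T) (ActiveFrom k)

  module _ {T : Vec Bool n} (tree : SpanningTree T) where
    open Activity M tree

    isToggled : Fin n → Bool
    isToggled h = lookup S h xor lookup T h

    isToggled-α : α-Invariant isToggled
    isToggled-α h = cong₂ _xor_ (lookup-α S-sub h) (lookup-α T-sub h)

    module Exchange {b g u : Fin n} (b-int : Internal b) (g-ext : External g) (crosses : Crosses b g)
      (αb≼u : α b ≼ u) (αg≼u : α g ≼ u) (u-end : u ≡ α b ⊎ u ≡ α g) where

      T′ : Vec Bool n
      T′ = removeAdd T b g

      tree′ : SpanningTree T′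
      tree′ = removeAdd-spanningTree b-int crosses

      private module A = LaterAgreement M tree tree′

      agree-later : ∀ {h} → u ≺ h → lookup T h ≡ lookup T′ h
      agree-later u≺h = sym (lookup-removeAdd-other
        (not-on (internal≺ b-int) αb≼u u≺h) (not-on (external≺ g-ext) αg≼u u≺h))
        where
        not-on : ∀ {e h} → e ≺ α e → α e ≼ u → u ≺ h → sameEdge h e ≡ false
        not-on {e} {h} e≺αe αe≼u u≺h = ≢⇒¬sameEdge {h} {e}
          (λ { refl → <-irrefl refl (<-trans e≺αe (≤-<-trans αe≼u u≺h)) })
          (λ { refl → <-irrefl refl (≤-<-trans αe≼u u≺h) })

      flipped : lookup T′ u ≡ not (lookup T u)
      flipped = [ at-b , at-g ]′ u-end
        where
        αb≁g : sameEdge (α b) g ≡ false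
        αb≁g = ¬-not λ αb∼g →
          not-¬ (α∈ T-sub (internal∈ b-int)) (∉-sameEdge {α b} αb∼g (external∉ g-ext))
        at-b : u ≡ α b → lookup T′ u ≡ not (lookup T u)
        at-b refl = trans (∉-removeAdd (α-sameEdge b) αb≁g)
          (cong not (sym (α∈ T-sub (internal∈ b-int))))
        at-g : u ≡ α g → lookup T′ u ≡ not (lookup T u)
        at-g refl = trans (∈-removeAdd (α-sameEdge g)) (cong not (sym (α∉ T-sub (external∉ g-ext))))

      αu-untoggled : isToggled u ≡ true → lookup S (α u) xor lookup T′ (α u) ≡ false
      αu-untoggled u-tog = begin
        lookup S (α u) xor lookup T′ (α u)
          ≡⟨ cong₂ _xor_ (lookup-α S-sub u) (lookup-α (subgraph tree′) u) ⟨
        lookup S u xor lookup T′ u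
          ≡⟨ cong (lookup S u xor_) flipped ⟩
        lookup S u xor not (lookup T u)
          ≡⟨ 𝔹ₚ.not-distribʳ-xor (lookup S u) (lookup T u) ⟨
        not (isToggled u)
          ≡⟨ cong not u-tog ⟩
        false ∎
        where open ≡-Reasoning

      active-from-u : isToggled u ≡ true → ActiveFrom (suc (time u)) tree → ActiveFrom (time u) tree′
      active-from-u u-tog active {x} x-tog u≤x = [ later , at-exchange ]′ (ℕₚ.m≤n⇒m<n∨m≡n u≤x)
        where
        module Y = Activity M tree′
        later : time u < Y.time x → Y.isActive x ≡ true
        later u<x = A.stays-active agree-later u≺x
          (active (trans (cong (lookup S x xor_) (agree-later u≺x)) x-tog) u≺x)
          where
          u≺x : u ≺ x
          u≺x = subst (time u <_) (sym (A.later-in-X agree-later u<x)) u<x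
        at-exchange : time u ≡ Y.time x → Y.isActive x ≡ true
        at-exchange u≡x = contradiction x-tog (not-¬
          (subst (λ y → lookup S y xor lookup T′ y ≡ false) (sym x≡αu) (αu-untoggled u-tog)))
          where
          x≡αu : x ≡ α u
          x≡αu = A.visited-at-exchange agree-later refl flipped (sym u≡x)

      exchange : isToggled u ≡ true → ActiveFrom (suc (time u)) tree → ActiveTreeFrom (time u)
      exchange u-tog active = T′ , tree′ , active-from-u u-tog active

    extend : ∀ {u} → ActiveFrom (suc (time u)) tree → (isToggled u ≡ true → isActive u ≡ true) →
        ActiveFrom (time u) tree
    extend {u} active at-u {x} x-tog u≼x = [ active x-tog , at-x ]′ (ℕₚ.m≤n⇒m<n∨m≡n u≼x)
      where
      at-x : time u ≡ time x → isActive x ≡ true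
      at-x u≡x =
        subst (λ y → isToggled y ≡ true → isActive y ≡ true) (time-injective u≡x) at-u x-tog

    exchange-at : ∀ {u} → isToggled u ≡ true → isActive u ≡ false → α u ≺ u →
        ActiveFrom (suc (time u)) tree → ActiveTreeFrom (time u)
    exchange-at {u} u-tog u-inactive αu≺u active =
      [ internal-case , external-case ]′ (classify-first (αα⁺ (α u ≺_) αu≺u))
      where
      αu-inactive : isActive (α u) ≡ false
      αu-inactive = trans (isActive-α u) u-inactive
      ααu≼u : α (α u) ≼ u
      ααu≼u = ≤-reflexive (cong time (α-invol u))
      internal-case : Internal (α u) → ActiveTreeFrom (time u)
      internal-case αu-int =
        let g , g-ext , enters = inactive-internal αu-int αu-inactive
        in Exchange.exchange αu-int g-ext (enters⇒crosses enters) ααu≼u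
             (≤-trans (subtree⇒≼α (proj₂ enters)) ααu≼u)
             (inj₁ (sym (α-invol u))) u-tog active
      external-case : External (α u) → ActiveTreeFrom (time u)
      external-case αu-ext =
        let f , f-int , leaves = inactive-external αu-ext αu-inactive
        in Exchange.exchange f-int αu-ext (leaves⇒crosses leaves)
             (<⇒≤ (<-≤-trans (leaves-α≺α αu-ext leaves) ααu≼u)) ααu≼u
             (inj₂ (sym (α-invol u))) u-tog active

    improve-at : ∀ u → ActiveFrom (suc (time u)) tree → ActiveTreeFrom (time u)
    improve-at u active with true⊎false (isToggled u) | true⊎false (isActive u)
    ... | inj₂ ¬tog | _ = T , tree , extend active λ tog → contradiction ¬tog (not-¬ tog)
    ... | inj₁ _ | inj₁ act = T , tree , extend active λ _ → act
    ... | inj₁ tog | inj₂ inact with first-or-second u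
    ... | inj₂ αu≺u = exchange-at tog inact αu≺u active
    ... | inj₁ u≺αu = contradiction inact
            (not-¬ (trans (sym (isActive-α u)) (active (trans (sym (isToggled-α u)) tog) u≺αu)))

    improve : ∀ {k} → k < n → ActiveFrom (suc k) tree → ActiveTreeFrom k
    improve {k} k<n active = subst ActiveTreeFrom time-u
      (improve-at (iter t k h₀) (subst (λ j → ActiveFrom (suc j) tree) (sym time-u) active))
      where
      time-u : time (iter t k h₀) ≡ k
      time-u = time-iter k<n

  activeTreeFrom : ∀ d {k} → d + k ≡ n → ActiveTreeFrom k
  activeTreeFrom zero refl =
    let T , tree = spanningTree
    in T , tree , λ {x} _ n≤x → contradiction n≤x (ℕₚ.<⇒≱ (Activity.time<n M tree x))
  activeTreeFrom (suc d) {k} refl =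
    let T , tree , active = activeTreeFrom d (+-suc d k)
    in improve tree (s≤s (ℕₚ.m≤n+m k d)) active

  interval-exists : ∃ λ T → Interval T S
  interval-exists = let T , tree , active = activeTreeFrom n (+-identityʳ n) in
    T , mkInterval tree S-sub λ h h-tog →
      trans (sym (Activity.isActive≡active M tree h)) (active h-tog z≤n)

module ToggledEdges {n : ℕ} (M : RootedMap n) {O : Vec Bool n} (π : Intervals.Preimage M O) where
  open RootedMap M
  open MapDefs M
  open HalfEdges M
  open Reachability M
  open Components M
  open Orientation M π public

  #toggled : EdgeKind → ℕ
  #toggled κ = edgeCount (λ h → ofKind κ T h ∧ isToggled h)

  #active : EdgeKind → ℕ
  #active κ = edgeCount (λ h → ofKind κ T h ∧ active T h)

  NoneToggled : EdgeKind → Set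
  NoneToggled κ = ∀ {x} → FirstOfKind κ x → isToggled x ≡ false

  #toggled≡0 : ∀ κ → #toggled κ ≡ 0 ⇔ NoneToggled κ
  #toggled≡0 κ = edgeCount-ofKind≡0 κ isToggled-α

  -- Untoggled tree edges can be followed downwards by R, so every half-edge x is reached from the
  -- root or from below the last toggled tree edge above x.
  module Descent (R : Fin n → Fin n → Set) (R-refl : ∀ {x} → R x x)
    (R-≈ : ∀ {u x y} → R u x → x ≈ y → R u y)
    (R-down : ∀ {u b} → R u b → Internal b → isToggled b ≡ false → R u (α b)) where

    data ReachedFrom (x : Fin n) : Set where
      root    : R h₀ x → ReachedFrom x
      toggled : ∀ {b} → Internal b → isToggled b ≡ true → subtree b x ≡ true → R (α b) x →
          ReachedFrom x

    reachedFrom-≈ : ∀ {x y} → x ≈ y → ReachedFrom x → ReachedFrom y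
    reachedFrom-≈ x≈y (root r) = root (R-≈ r x≈y)
    reachedFrom-≈ x≈y (toggled b-int b-tog x∈b r) =
      toggled b-int b-tog (trans (sym (subtree-≈ b-int x≈y)) x∈b) (R-≈ r x≈y)

    reachedFrom-down : ∀ {b} → Internal b → ReachedFrom b → ReachedFrom (α b)
    reachedFrom-down {b} b-int from with true⊎false (isToggled b) | from
    ... | inj₁ b-tog | _ = toggled b-int b-tog (αb∈subtree (internal≺ b-int)) R-refl
    ... | inj₂ ¬b-tog | root r = root (R-down r b-int ¬b-tog)
    ... | inj₂ ¬b-tog | toggled {c} c-int c-tog b∈c r =
      toggled c-int c-tog (trans (sym b∼αb) b∈c) (R-down r b-int ¬b-tog)
      where
      b≢c : b ≢ c
      b≢c refl = not-¬ c-tog ¬b-tog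
      b∼αb : subtree c b ≡ subtree c (α b)
      b∼αb = subtree-internal c-int (internal∈ b-int) b≢c (internal-≢α c-int b-int)

    reachedFrom : ∀ x → ReachedFrom x
    reachedFrom = ≺-induction ReachedFrom step
      where
      step : ∀ x → (∀ {y} → y ≺ x → ReachedFrom y) → ReachedFrom x
      step x earlier with backstep x
      ... | atRoot refl = root R-refl
      ... | sameVertex y≺x y≈x = reachedFrom-≈ y≈x (earlier y≺x)
      ... | fromParent b-int time-x αb≈x =
        reachedFrom-≈ αb≈x (reachedFrom-down b-int (earlier (≤-reflexive (sym time-x))))

  untoggled-internal⇒∈S : ∀ {b} → Internal b → isToggled b ≡ false → b ∈ˢ S
  untoggled-internal⇒∈S {b} b-int ¬b-tog rewrite internal∈ b-int =
    trans (sym (not-involutive _)) (cong not (trans (sym (𝔹ₚ.xor-comm (lookup S b) true)) ¬b-tog))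

  toggled-internal⇒∉S : ∀ {b} → Internal b → isToggled b ≡ true → b ∉ˢ S
  toggled-internal⇒∉S {b} b-int b-tog rewrite internal∈ b-int =
    not-injective (trans (𝔹ₚ.xor-comm true (lookup S b)) b-tog)

  toggled-subtree-⟶ : ∀ {b} → Internal b → isToggled b ≡ true → ∀ {x y} → S ⊢ x ⟶ y →
      subtree b x ≡ subtree b y
  toggled-subtree-⟶ {b} b-int b-tog {x} = ⟶-induction (λ y → subtree b x ≡ subtree b y) refl
    (λ e y≈z → trans e (subtree-≈ b-int y≈z)) (λ {y} e y∈S → trans e (not-crossed y y∈S))
    where
    no-first-crossing : ∀ {y} → y ≺ α y → y ∈ˢ S → ¬ Crosses b y
    no-first-crossing y≺αy y∈S crosses with classify-first y≺αy
    ... | inj₁ y-int with refl ← crossing-internal-unique y-int b-int crosses =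
          not-¬ y∈S (toggled-internal⇒∉S b-int b-tog)
    ... | inj₂ y-ext with ≡not-cases crosses
    ... | inj₁ leaves =
      active-external y-ext (toggled⇒isActive (cong₂ _xor_ y∈S (external∉ y-ext))) b-int leaves
    ... | inj₂ enters = active-internal b-int (toggled⇒isActive b-tog) y-ext enters
    not-crossed : ∀ y → y ∈ˢ S → subtree b y ≡ subtree b (α y)
    not-crossed y y∈S with subtree b y 𝔹ₚ.≟ subtree b (α y) | first-or-second y
    ... | yes same | _ = same
    ... | no differ | inj₁ y≺αy = contradiction (¬-not differ) (no-first-crossing y≺αy y∈S)
    ... | no differ | inj₂ αy≺y = contradiction (crosses-α {b} {y} (¬-not differ))
            (no-first-crossing (αα⁺ (α y ≺_) αy≺y) (α∈ S-sub y∈S))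

  numComp-S : numComp S ≡ suc (#toggled internal)
  numComp-S = begin
    numComp S                     ≡⟨ ≤-antisym (C.numComp-≤ cover) (C.≤-numComp separated) ⟩
    suc (length (map α tops))     ≡⟨ cong suc (Listₚ.length-map α tops) ⟩
    suc (count isTop H)           ≡⟨ cong suc (edgeCount-internal isToggled-α) ⟨
    suc (#toggled internal)       ∎
    where
    open ≡-Reasoning
    module C = ComponentsOf S-sub
    module D = Descent (S ⊢_⟶_) ⟶-refl ⟶-≈
      (λ u⟶b b-int ¬b-tog → ⟶-α u⟶b (untoggled-internal⇒∈S b-int ¬b-tog))
    isTop : Fin n → Bool
    isTop = firstInternal isToggled
    tops : List (Fin n)
    tops = filterᵇ isTop H
    cover : ∀ x → ∃ λ m → m ∈ h₀ ∷ map α tops × S ⊢ m ⟶ x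
    cover x with D.reachedFrom x
    ... | D.root h₀⟶x = h₀ , here refl , h₀⟶x
    ... | D.toggled {b} b-int b-tog _ αb⟶x = α b , there (∈-map⁺ α b∈tops) , αb⟶x
      where
      b∈tops : b ∈ tops
      b∈tops = ∈-filterᵇ⁺ isTop (∈-allFin b) (firstInternal⁺ isToggled b-int b-tog)
    top : ∀ {b} → b ∈ tops → Internal b × isToggled b ≡ true
    top i = firstInternal⁻ isToggled (proj₂ (∈-filterᵇ⁻ isTop H i))
    outside : ∀ {b x} → b ∈ tops → subtree b x ≡ false → ¬ S ⊢ x ⟶ α b
    outside i x∉b x⟶αb =
      let b-int , b-tog = top i
          x∼αb = toggled-subtree-⟶ b-int b-tog x⟶αb
      in not-¬ (αb∈subtree (internal≺ b-int)) (trans (sym x∼αb) x∉b)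
    tops-apart : ∀ {b c} → b ∈ tops → c ∈ tops → b ≢ c → ¬ S ⊢ α b ⟶ α c
    tops-apart i j b≢c αb⟶αc with ≺-compare b≢c
    ... | inj₁ b≺c = outside j (α∉later-subtree (proj₁ (top i)) (proj₁ (top j)) b≺c) αb⟶αc
    ... | inj₂ c≺b =
      outside i (α∉later-subtree (proj₁ (top j)) (proj₁ (top i)) c≺b) (⟶-sym S-sub αb⟶αc)
    separated : AllPairs (λ x y → ¬ S ⊢ x ⟶ y) (h₀ ∷ map α tops)
    separated = Allₚ.map⁺ (All.tabulate λ i → outside i (h₀∉subtree _))
      ∷ AllPairsₚ.map⁺ (unique⇒AllPairs (unique-filterᵇ isTop unique-allFin) tops-apart)

  numE-S : numE S + #toggled internal ≡ numE T + #toggled external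
  numE-S = begin
    numE S + #toggled internal
      ≡⟨ cong₂ _+_ (edgeCount-split (lookup S) (lookup T)) (edgeCount-cong internal-toggles) ⟩
    (both + S─T) + T─S
      ≡⟨ +-assoc both S─T T─S ⟩
    both + (S─T + T─S)
      ≡⟨ cong (λ k → both + k) (+-comm S─T T─S) ⟩
    both + (T─S + S─T)
      ≡⟨ +-assoc both T─S S─T ⟨
    (both + T─S) + S─T
      ≡⟨ cong₂ _+_ (cong (_+ T─S) (edgeCount-cong λ h → 𝔹ₚ.∧-comm (lookup S h) (lookup T h)))
          (edgeCount-cong external-toggles) ⟩
    (edgeCount (λ h → lookup T h ∧ lookup S h) + T─S) + #toggled external
      ≡⟨ cong (_+ #toggled external) (edgeCount-split (lookup T) (lookup S)) ⟨
    numE T + #toggled external ∎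
    where
    open ≡-Reasoning
    both S─T T─S : ℕ
    both = edgeCount (λ h → lookup S h ∧ lookup T h)
    S─T = edgeCount (λ h → lookup S h ∧ not (lookup T h))
    T─S = edgeCount (λ h → lookup T h ∧ not (lookup S h))
    internal-toggles : ∀ h → lookup T h ∧ isToggled h ≡ lookup T h ∧ not (lookup S h)
    internal-toggles h with lookup T h | lookup S h
    ... | true | true = refl
    ... | true | false = refl
    ... | false | _ = refl
    external-toggles : ∀ h → lookup S h ∧ not (lookup T h) ≡ not (lookup T h) ∧ isToggled h
    external-toggles h with lookup T h | lookup S h
    ... | true | true = refl
    ... | true | false = refl
    ... | false | true = refl
    ... | false | false = refl

  nullity-S : numE S + numComp S ∸ numV ≡ #toggled external
  nullity-S = begin
    numE S + numComp S ∸ numV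
      ≡⟨ cong₂ (λ c v → numE S + c ∸ v) numComp-S (sym (trans (+-comm 1 (numE T)) (size tree))) ⟩
    numE S + suc (#toggled internal) ∸ suc (numE T)
      ≡⟨ cong (_∸ suc (numE T)) (+-suc (numE S) (#toggled internal)) ⟩
    numE S + #toggled internal ∸ numE T
      ≡⟨ cong (_∸ numE T) numE-S ⟩
    numE T + #toggled external ∸ numE T
      ≡⟨ ℕₚ.m+n∸m≡n (numE T) (#toggled external) ⟩
    #toggled external ∎
    where open ≡-Reasoning

  module O-Descent = Descent (O ⊢_⟶_) ⟶-refl ⟶-≈
    (λ u⟶b b-int ¬b-tog → ⟶-trans u⟶b (untoggled-internal⇒⟶α b-int ¬b-tog))

  v0Connected⇔ : v0Connected O ≡ true ⇔ NoneToggled internal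
  v0Connected⇔ = mk⇔ to from
    where
    to : v0Connected O ≡ true → NoneToggled internal
    to connected {b} b-int = ¬-not λ b-tog →
      ¬enters-toggled-subtree b-int b-tog h₀⟶αb (h₀∉subtree b) (αb∈subtree (internal≺ b-int))
      where
      h₀⟶αb : O ⊢ h₀ ⟶ α b
      h₀⟶αb = trans (sym (reachD≡canReach O h₀ (α b))) (all-allFin⁻ _ connected (α b))
    from : NoneToggled internal → v0Connected O ≡ true
    from none =
      all-allFin⁺ _ λ x → trans (reachD≡canReach O h₀ x) (from-root (O-Descent.reachedFrom x))
      where
      from-root : ∀ {x} → O-Descent.ReachedFrom x → O ⊢ h₀ ⟶ x
      from-root (O-Descent.root h₀⟶x) = h₀⟶x
      from-root (O-Descent.toggled b-int b-tog _ _) = contradiction (none b-int) (not-¬ b-tog)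

module Exploration {n : ℕ} (M : RootedMap n) where
  open RootedMap M
  open MapDefs M

  Crossing : (Fin n → Bool) → Fin n → Set
  Crossing W h = W h ≡ true × W (α h) ≡ false

  data FirstCrossing (W : Fin n → Bool) (hs : List (Fin n)) : Set where
    none  : firstCrossing W hs ≡ [] → (∀ {h} → h ∈ hs → ¬ Crossing W h) → FirstCrossing W hs
    found : ∀ {h} → firstCrossing W hs ≡ h ∷ [] → Crossing W h → FirstCrossing W hs

  firstCrossing-spec : ∀ W hs → FirstCrossing W hs
  firstCrossing-spec W [] = none refl λ ()
  firstCrossing-spec W (h ∷ hs) with W h ∧ not (W (α h)) in h? | firstCrossing-spec W hs
  ... | true | _ = found (cong (λ b → if b then h ∷ [] else firstCrossing W hs) h?)
          (∧-conicalˡ _ _ h? , not-injective (∧-conicalʳ (W h) _ h?))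
  ... | false | found e crossing =
    found (trans (cong (λ b → if b then h ∷ [] else firstCrossing W hs) h?) e) crossing
  ... | false | none e ¬crossing =
    none (trans (cong (λ b → if b then h ∷ [] else firstCrossing W hs) h?) e)
      λ { (here refl) (h∈ , αh∉) → not-¬ (cong₂ _∧_ h∈ (cong not αh∉)) h?
        ; (there i) → ¬crossing i }

  minCrossing-spec : ∀ T W hs {best} → Crossing W best →
      let m = minCrossing T W hs best in
      Crossing W m × edgeRank T m ≤ edgeRank T best ×
      (∀ {h} → h ∈ hs → Crossing W h → edgeRank T m ≤ edgeRank T h)
  minCrossing-spec T W [] best-crosses = best-crosses , ≤-refl , λ ()
  minCrossing-spec T W (h ∷ hs) {best} best-crosses
    with (W h ∧ not (W (α h))) ∧ (edgeRank T h <ᵇ edgeRank T best) in better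
  ... | true =
    let crosses = ∧-conicalˡ _ _ better
        h<best = <ᵇ≡true⇒< (∧-conicalʳ (W h ∧ not (W (α h))) _ better)
        m-crosses , m≤h , m≤hs = minCrossing-spec T W hs
          (∧-conicalˡ _ _ crosses , not-injective (∧-conicalʳ (W h) _ crosses))
    in m-crosses , ≤-trans m≤h (<⇒≤ h<best) , λ { (here refl) _ → m≤h ; (there i) → m≤hs i }
  ... | false =
    let m-crosses , m≤best , m≤hs = minCrossing-spec T W hs best-crosses
    in m-crosses , m≤best ,
       λ { (here refl) (h∈ , αh∉) → ≤-trans m≤best (<ᵇ≡false⇒≥
             (¬-not λ h< → not-¬ (cong₂ _∧_ (cong₂ _∧_ h∈ (cong not αh∉)) h<) better))
         ; (there i) → m≤hs i }

  module _ (T : Vec Bool n) (grow : (Fin n → Bool) → Fin n → Fin n → Bool) where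

    countParts-done : ∀ f W → firstCrossing W H ≡ [] → countParts T grow f W ≡ 1
    countParts-done zero W _ = refl
    countParts-done (suc f) W e with firstCrossing W H | e
    ... | [] | _ = refl

    countParts-step : ∀ f W {h} → firstCrossing W H ≡ h ∷ [] →
      countParts T grow (suc f) W ≡ suc (countParts T grow f (grow W (α (minCrossing T W H h))))
    countParts-step f W e with firstCrossing W H | e
    ... | _ ∷ [] | refl = refl

-- The explored set grows from the R-successors of h₀ by the R-successors of the lower ends of the
-- marked tree edges, taken in the order of the tour.
module MarkedExploration {n : ℕ} (M : RootedMap n) {T : Vec Bool n}
  (tree : Components.SpanningTree M T)
  (R : Fin n → Fin n → Bool) (marked : Fin n → Bool) where
  open RootedMap M
  open MapDefs M
  open HalfEdges M
  open Motion M
  open Activity M tree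
  open Exploration M

  growR : (Fin n → Bool) → Fin n → Fin n → Bool
  growR W v x = W x ∨ (R v x ∧ not (W x))

  opaque
    explored : ℕ → Fin n → Bool
    explored p x = R h₀ x ∨ any (λ b → (marked b ∧ (time b <ᵇ p)) ∧ R (α b) x) H

    explored-root : ∀ {p x} → R h₀ x ≡ true → explored p x ≡ true
    explored-root = ∨-introˡ

    explored-marked : ∀ {p x b} → marked b ≡ true → time b < p → R (α b) x ≡ true →
        explored p x ≡ true
    explored-marked {p} {x} {b} b-marked b<p r =
      ∨-introʳ (R h₀ x) (any-allFin⁺ _ b (cong₂ _∧_ (cong₂ _∧_ b-marked (<⇒<ᵇ≡true b<p)) r))

    explored⁻ : ∀ {p x} → explored p x ≡ true →
                R h₀ x ≡ true ⊎ ∃ λ b → marked b ≡ true × time b < p × R (α b) x ≡ true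
    explored⁻ {p} {x} e with ∨-elim (R h₀ x) e
    ... | inj₁ r = inj₁ r
    ... | inj₂ some with b , q ← any-allFin⁻ (λ b → (marked b ∧ (time b <ᵇ p)) ∧ R (α b) x) some =
          inj₂ (b , ∧-conicalˡ _ _ (∧-conicalˡ _ _ q) ,
            <ᵇ≡true⇒< (∧-conicalʳ (marked b) _ (∧-conicalˡ _ _ q)) ,
            ∧-conicalʳ (marked b ∧ (time b <ᵇ p)) _ q)

  explored-mono : ∀ {p q x} → p ≤ q → explored p x ≡ true → explored q x ≡ true
  explored-mono p≤q e with explored⁻ e
  ... | inj₁ r = explored-root r
  ... | inj₂ (b , b-marked , b<p , r) = explored-marked b-marked (<-≤-trans b<p p≤q) r

  markedFrom : ℕ → ℕ
  markedFrom p = count (λ h → marked h ∧ (p ≤ᵇ time h)) H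

  markedFrom-n : markedFrom n ≡ 0
  markedFrom-n =
    count≡0⁺ _ H λ {h} _ → ¬-not λ p → ℕₚ.<⇒≱ (time<n h) (≤ᵇ≡true⇒≤ (∧-conicalʳ (marked h) _ p))

  markedFrom-zero : markedFrom 0 ≡ count marked H
  markedFrom-zero = count-cong H λ {h} _ → ∧-identityʳ (marked h)

  markedFrom-suc : ∀ b → markedFrom (time b) ≡ 𝟙 (marked b) + markedFrom (suc (time b))
  markedFrom-suc b =
    trans (count-split _ (_== b) H)
      (cong₂ _+_ (at-b (true⊎false (marked b))) (count-cong H λ {h} _ → off-b h))
    where
    at-b : marked b ≡ true ⊎ marked b ≡ false →
           count (λ h → (marked h ∧ (time b ≤ᵇ time h)) ∧ (h == b)) H ≡ 𝟙 (marked b)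
    at-b (inj₁ b-marked) = trans
      (count≡1 _ unique-allFin (∈-allFin b)
        (cong₂ _∧_ (cong₂ _∧_ b-marked (≤⇒≤ᵇ≡true {time b} ≤-refl)) (==-refl b))
        (λ {h} p → ==⇒≡ (∧-conicalʳ (marked h ∧ (time b ≤ᵇ time h)) _ p)))
      (sym (cong 𝟙 b-marked))
    at-b (inj₂ ¬marked) =
      trans (count≡0⁺ _ H λ {h} _ → ¬-not (λ p → not-¬ (b-is-marked h p) ¬marked))
        (sym (cong 𝟙 ¬marked))
      where
      b-is-marked : ∀ h → (marked h ∧ (time b ≤ᵇ time h)) ∧ (h == b) ≡ true → marked b ≡ true
      b-is-marked h p with refl ← ==⇒≡ {h} {b} (∧-conicalʳ (marked h ∧ (time b ≤ᵇ time h)) _ p) =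
        ∧-conicalˡ _ _ (∧-conicalˡ _ _ p)
    off-b : ∀ h →
        (marked h ∧ (time b ≤ᵇ time h)) ∧ not (h == b) ≡ marked h ∧ (suc (time b) ≤ᵇ time h)
    off-b h with h Finₚ.≟ b
    ... | yes refl =
      trans (∧-zeroʳ _) (sym (trans (cong (marked h ∧_) not-later) (∧-zeroʳ _)))
      where
      not-later : (suc (time h) ≤ᵇ time h) ≡ false
      not-later = ¬-not λ p → <-irrefl refl (≤ᵇ≡true⇒≤ {suc (time h)} p)
    ... | no h≢b = trans (∧-identityʳ _) (cong (marked h ∧_) (≡-via-true
      (λ p → ≤⇒≤ᵇ≡true (≼∧≢⇒≺ (≤ᵇ≡true⇒≤ p) (h≢b ∘ sym)))
      (λ p → ≤⇒≤ᵇ≡true (<⇒≤ (≤ᵇ≡true⇒≤ {suc (time b)} p)))))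

  module _
    (R-≈ : ∀ {u x y} → x ≈ y → R u x ≡ true → R u y ≡ true)
    (marked⇒internal : ∀ {b} → marked b ≡ true → Internal b)
    (new : ∀ {b} → marked b ≡ true → explored (time b) (α b) ≡ false)
    (visited : ∀ x → explored (time x) x ≡ true)
    (external-explored : ∀ {b g} → marked b ≡ true → External g → g ≺ b →
      explored (time b) (α g) ≡ true) where

    explored-≈ : ∀ {p x y} → x ≈ y → explored p x ≡ true → explored p y ≡ true
    explored-≈ x≈y e with explored⁻ e
    ... | inj₁ r = explored-root (R-≈ x≈y r)
    ... | inj₂ (b , b-marked , b<p , r) = explored-marked b-marked b<p (R-≈ x≈y r)

    explored-unmarked : ∀ {b} → marked b ≡ false → ∀ x →
        explored (time b) x ≡ explored (suc (time b)) x
    explored-unmarked {b} ¬marked x = ≡-via-true (explored-mono (ℕₚ.n≤1+n _)) from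
      where
      from : explored (suc (time b)) x ≡ true → explored (time b) x ≡ true
      from e with explored⁻ e
      ... | inj₁ r = explored-root r
      ... | inj₂ (c , c-marked , s≤s c≼b , r) =
        explored-marked c-marked (≼∧≢⇒≺ c≼b λ { refl → not-¬ c-marked ¬marked }) r

    module _ {b : Fin n} (b-marked : marked b ≡ true) where
      private
        W : Fin n → Bool
        W = explored (time b)

        W-early : ∀ {x} → x ≼ b → W x ≡ true
        W-early x≼b = explored-mono x≼b (visited _)

        first-crossing⇒b : ∀ {x} → x ≺ α x → W (α x) ≡ false → x ≼ b → x ≡ b
        first-crossing⇒b {x} x≺αx αx∉ x≼b with x Finₚ.≟ b | classify-first x≺αx
        ... | yes x≡b | _ = x≡b
        ... | no x≢b | inj₂ x-ext =
          contradiction αx∉ (not-¬ (external-explored b-marked x-ext (≼∧≢⇒≺ x≼b x≢b)))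
        ... | no x≢b | inj₁ x-int =
          contradiction αx∉ (not-¬ (explored-≈ (≈-sym αx≈tx)
            (W-early (subst (_≤ time b) (sym (time-t-≺ x≺b)) x≺b))))
          where
          x≺b : x ≺ b
          x≺b = ≼∧≢⇒≺ x≼b x≢b
          αx≈tx : α x ≈ t x
          αx≈tx = subst (α x ≈_) (sym (motion-∈ T (internal∈ x-int))) (x≈σx (α x))

        rank-b : rank b ≡ time b
        rank-b = rank-first (internal≺ (marked⇒internal b-marked))

      b-crossing : ∀ {V} → (∀ x → V x ≡ W x) → Crossing V b
      b-crossing V≗W = trans (V≗W b) (visited b) , trans (V≗W (α b)) (new b-marked)

      crossing-of-least-rank : ∀ {x} → Crossing W x → rank x ≤ rank b → x ≡ b
      crossing-of-least-rank {x} (_ , αx∉) rank≤ with first-or-second x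
      ... | inj₁ x≺αx = first-crossing⇒b x≺αx αx∉ (subst₂ _≤_ (rank-first x≺αx) rank-b rank≤)
      ... | inj₂ αx≺x = contradiction αx∉ (not-¬ (W-early (subst₂ _≤_ rank-αx rank-b rank≤)))
        where
        rank-αx : rank x ≡ time (α x)
        rank-αx = trans (sym (rank-α x)) (rank-first (αα⁺ (α x ≺_) αx≺x))

      minCrossing≡b : ∀ {V h} → (∀ x → V x ≡ W x) → Crossing V h → minCrossing T V H h ≡ b
      minCrossing≡b {V} {h} V≗W h-crossing
          with (m∈ , αm∉) , _ , m≤ ← minCrossing-spec T V H h-crossing =
        crossing-of-least-rank (trans (sym (V≗W m)) m∈ , trans (sym (V≗W (α m))) αm∉)
          (subst₂ _≤_ (sym (rank≡edgeRank m)) (sym (rank≡edgeRank b))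
            (m≤ (∈-allFin b) (b-crossing V≗W)))
        where
        m : Fin n
        m = minCrossing T V H h

      growR-marked : ∀ {V} → (∀ x → V x ≡ W x) → ∀ x → growR V (α b) x ≡ explored (suc (time b)) x
      growR-marked {V} V≗W x = ≡-via-true to from
        where
        to : growR V (α b) x ≡ true → explored (suc (time b)) x ≡ true
        to p with ∨-elim (V x) p
        ... | inj₁ x∈V = explored-mono (ℕₚ.n≤1+n _) (trans (sym (V≗W x)) x∈V)
        ... | inj₂ q = explored-marked b-marked (n<1+n _) (∧-conicalˡ _ _ q)
        from : explored (suc (time b)) x ≡ true → growR V (α b) x ≡ true
        from e with true⊎false (V x) | explored⁻ e
        ... | inj₁ x∈V | _ = ∨-introˡ x∈V
        ... | inj₂ x∉V | inj₁ r = contradiction (trans (sym (V≗W x)) x∉V) (not-¬ (explored-root r))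
        ... | inj₂ x∉V | inj₂ (c , c-marked , s≤s c≼b , r) with c Finₚ.≟ b
        ... | yes refl = ∨-introʳ (V x) (cong₂ _∧_ r (cong not x∉V))
        ... | no c≢b =
          contradiction (trans (sym (V≗W x)) x∉V)
            (not-¬ (explored-marked c-marked (≼∧≢⇒≺ c≼b c≢b) r))

      countParts-at-marked : ∀ f {V} → (∀ x → V x ≡ W x) →
          countParts T growR (suc f) V ≡ suc (countParts T growR f (growR V (α b)))
      countParts-at-marked f {V} V≗W with firstCrossing-spec V H
      ... | none _ ¬crossing = ⊥-elim (¬crossing (∈-allFin b) (b-crossing V≗W))
      ... | found e h-crossing = trans (countParts-step T growR f V e)
        (cong (λ c → suc (countParts T growR f (growR V (α c)))) (minCrossing≡b V≗W h-crossing))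

    explored-n⇒done : ∀ {V} → (∀ x → V x ≡ explored n x) → firstCrossing V H ≡ []
    explored-n⇒done {V} V≗ with firstCrossing-spec V H
    ... | none e _ = e
    ... | found {h} _ (_ , αh∉) = contradiction αh∉
      (not-¬ (trans (V≗ (α h)) (explored-mono (<⇒≤ (time<n (α h))) (visited (α h)))))

    countParts-explored : ∀ d {p} → d + p ≡ n → ∀ f {V} → (∀ x → V x ≡ explored p x) →
        markedFrom p ≤ f → countParts T growR f V ≡ suc (markedFrom p)
    countParts-explored zero refl f {V} V≗ _ =
      trans (countParts-done T growR f V (explored-n⇒done V≗)) (cong suc (sym markedFrom-n))
    countParts-explored (suc d) {p} refl f {V} V≗ ≤f =
      subst (λ k → countParts T growR f V ≡ suc (markedFrom k)) time-b
        (step f (true⊎false (marked b)) (subst (λ k → markedFrom k ≤ f) (sym time-b) ≤f))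
      where
      open ≡-Reasoning
      b : Fin n
      b = iter t p h₀
      time-b : time b ≡ p
      time-b = time-iter (s≤s (ℕₚ.m≤n+m p d))
      V≗W : ∀ x → V x ≡ explored (time b) x
      V≗W x = trans (V≗ x) (cong (λ k → explored k x) (sym time-b))
      later : d + suc (time b) ≡ suc (d + p)
      later = trans (+-suc d (time b)) (cong (λ k → suc (d + k)) time-b)
      markedFrom-b : ∀ {c} → marked b ≡ c → markedFrom (time b) ≡ 𝟙 c + markedFrom (suc (time b))
      markedFrom-b b? = trans (markedFrom-suc b) (cong (λ c → 𝟙 c + markedFrom (suc (time b))) b?)
      step : ∀ f → marked b ≡ true ⊎ marked b ≡ false → markedFrom (time b) ≤ f →
             countParts T growR f V ≡ suc (markedFrom (time b))
      step f (inj₂ ¬marked) ≤f = trans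
        (countParts-explored d later f (λ x → trans (V≗W x) (explored-unmarked ¬marked x))
          (subst (_≤ f) (markedFrom-b ¬marked) ≤f))
        (cong suc (sym (markedFrom-b ¬marked)))
      step zero (inj₁ b-marked) ≤0 = contradiction (subst (_≤ 0) (markedFrom-b b-marked) ≤0) λ ()
      step (suc f) (inj₁ b-marked) ≤f = begin
        countParts T growR (suc f) V
          ≡⟨ countParts-at-marked b-marked f V≗W ⟩
        suc (countParts T growR f (growR V (α b)))
          ≡⟨ cong suc (countParts-explored d later f (growR-marked b-marked V≗W)
              (≤-pred (subst (_≤ suc f) (markedFrom-b b-marked) ≤f))) ⟩
        suc (suc (markedFrom (suc (time b))))
          ≡⟨ cong suc (markedFrom-b b-marked) ⟨
        suc (markedFrom (time b)) ∎

    countParts-marked : countParts T growR n (R h₀) ≡ suc (count marked H)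
    countParts-marked = trans
      (countParts-explored n (+-identityʳ n) n (λ x → ≡-via-true explored-root (from x))
        (subst (_≤ n) (sym markedFrom-zero) (count-allFin-≤ marked)))
      (cong suc markedFrom-zero)
      where
      from : ∀ x → explored 0 x ≡ true → R h₀ x ≡ true
      from x e with explored⁻ e
      ... | inj₁ r = r
      ... | inj₂ (_ , _ , () , _)

module RootComponents {n : ℕ} (M : RootedMap n) {O : Vec Bool n} (π : Intervals.Preimage M O) where
  open RootedMap M
  open MapDefs M
  open Reachability M
  open ToggledEdges M π
  private
    marked : Fin n → Bool
    marked = firstInternal isToggled

    module E = MarkedExploration M tree (canReach O) marked

    new : ∀ {b} → marked b ≡ true → E.explored (time b) (α b) ≡ false
    new {b} b-marked = ¬-not λ e → unreached (E.explored⁻ e)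
      where
      b-int : Internal b
      b-int = proj₁ (firstInternal⁻ isToggled b-marked)
      αb-unreached : ∀ {x} → subtree b x ≡ false → ¬ O ⊢ x ⟶ α b
      αb-unreached x∉b x⟶αb =
        ¬enters-toggled-subtree b-int (proj₂ (firstInternal⁻ isToggled b-marked)) x⟶αb x∉b
          (αb∈subtree (internal≺ b-int))
      unreached : ¬ (O ⊢ h₀ ⟶ α b ⊎ ∃ λ c → marked c ≡ true × c ≺ b × O ⊢ α c ⟶ α b)
      unreached (inj₁ h₀⟶αb) = αb-unreached (h₀∉subtree b) h₀⟶αb
      unreached (inj₂ (c , c-marked , c≺b , αc⟶αb)) =
        αb-unreached (α∉later-subtree (proj₁ (firstInternal⁻ isToggled c-marked)) b-int c≺b) αc⟶αb

    visited : ∀ x → E.explored (time x) x ≡ true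
    visited x with O-Descent.reachedFrom x
    ... | O-Descent.root h₀⟶x = E.explored-root h₀⟶x
    ... | O-Descent.toggled b-int b-tog x∈b αb⟶x =
      E.explored-marked (firstInternal⁺ isToggled b-int b-tog) (subtree⇒≻ x∈b) αb⟶x

    external-explored : ∀ {b g} → marked b ≡ true → External g → g ≺ b →
        E.explored (time b) (α g) ≡ true
    external-explored {b} {g} _ g-ext g≺b with O-Descent.reachedFrom (α g)
    ... | O-Descent.root h₀⟶αg = E.explored-root h₀⟶αg
    ... | O-Descent.toggled {c} c-int c-tog αg∈c αc⟶αg with ℕₚ.<-≤-connex (time c) (time b)
    ... | inj₁ c≺b = E.explored-marked (firstInternal⁺ isToggled c-int c-tog) c≺b αc⟶αg
    ... | inj₂ b≼c = contradiction (≼⇒∉subtree (<⇒≤ (<-≤-trans g≺b b≼c)) , αg∈c)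
                       (active-internal c-int (toggled⇒isActive c-tog) g-ext)

  numRootComps≡ : numRootComps T O ≡ suc (#toggled internal)
  numRootComps≡ = begin
    numRootComps T O
      ≡⟨ as-exploration ⟩
    countParts T E.growR n (canReach O h₀)
      ≡⟨ E.countParts-marked (λ x≈y r → ⟶-≈ r x≈y) (proj₁ ∘ firstInternal⁻ isToggled)
          new visited external-explored ⟩
    suc (count marked H)
      ≡⟨ cong suc (edgeCount-internal isToggled-α) ⟨
    suc (#toggled internal) ∎
    where
    open ≡-Reasoning
    opaque
      unfolding canReach
      as-exploration : numRootComps T O ≡ countParts T E.growR n (canReach O h₀)
      as-exploration = refl

module RootStrongComponents {n : ℕ} (M : RootedMap n) {O : Vec Bool n} (π : Intervals.Preimage M O)
  (none-toggled : ToggledEdges.NoneToggled M π internal) where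
  open RootedMap M
  open MapDefs M
  open HalfEdges M
  open Reachability M
  open ToggledEdges M π

  private
    internal⇒⟶α : ∀ {b} → Internal b → O ⊢ b ⟶ α b
    internal⇒⟶α b-int = untoggled-internal⇒⟶α b-int (none-toggled b-int)

  active-subtree-⟶ : ∀ {b} → Internal b → isActive b ≡ true → ∀ {x y} → O ⊢ x ⟶ y →
      subtree b x ≡ true → subtree b y ≡ true
  active-subtree-⟶ {b} b-int b-act x⟶y x∈ = ⟶-induction (λ y → subtree b y ≡ true) x∈
    (λ y∈ y≈z → trans (sym (subtree-≈ b-int y≈z)) y∈)
    (λ {y} y∈ y∈O → ¬-not λ αy∉ → ¬leaving y∈O y∈ αy∉ (kind y)) x⟶y
    where
    αb∉O : ¬ α b ∈ˢ O
    αb∉O αb∈O with internalState b-int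
    ... | toggled b-tog _ = not-¬ b-tog (none-toggled b-int)
    ... | untouched _ b∈O = tail⇒¬head b∈O αb∈O
    ... | onToggledCycle _ _ a-ext _ enters = active-internal b-int b-act a-ext enters
    ¬leaving : ∀ {y} → y ∈ˢ O → subtree b y ≡ true → subtree b (α y) ≡ false → ¬ Kind y
    ¬leaving y∈O y∈ αy∉ (internal-first y-int)
      with refl ← crossing-internal-unique y-int b-int (leaves⇒crosses (y∈ , αy∉)) =
      not-¬ y∈ (b∉subtree b)
    ¬leaving {y} y∈O y∈ αy∉ (internal-second αy-int)
      with refl ← crossing-internal-unique αy-int b-int (enters⇒crosses (leaves-α (y∈ , αy∉))) =
      αb∉O (αα⁺ (_∈ˢ O) y∈O)
    ¬leaving y∈O y∈ αy∉ (external-second αy-ext) =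
      active-internal b-int b-act αy-ext (leaves-α (y∈ , αy∉))
    ¬leaving y∈O y∈ αy∉ (external-first y-ext) with externalState y-ext
    ... | toggled y-tog _ = active-external y-ext (toggled⇒isActive y-tog) b-int (y∈ , αy∉)
    ... | untouched _ αy∈O _ = tail⇒¬head y∈O αy∈O
    ... | onToggledCocycle _ _ c-int c-tog _ = not-¬ c-tog (none-toggled c-int)

  subtree-nested : ∀ {b c} → Internal b → Internal c → b ≢ c → subtree c (α b) ≡ true →
                   ∀ {y} → subtree b y ≡ true → subtree c y ≡ true
  subtree-nested {b} {c} b-int c-int b≢c αb∈c y∈b = subtree⁺
    (<-trans (subtree⇒≻ (trans b∼αb αb∈c)) (subtree⇒≻ y∈b))
    (≤-trans (subtree⇒≼α y∈b) (subtree⇒≼α αb∈c))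
    where
    b∼αb : subtree c b ≡ subtree c (α b)
    b∼αb = subtree-internal c-int (internal∈ b-int) b≢c (internal-≢α c-int b-int)

  αw⟶subtree : ∀ {w y} → Internal w → subtree w y ≡ true → O ⊢ α w ⟶ y
  αw⟶subtree {w} {y} w-int y∈w = ¬-not λ unreached →
    absurd unreached (separatingEdge canReach-≈ (α w) y (trans ⟶-refl (cong not (sym unreached))))
    where
    absurd : canReach O (α w) y ≡ false → ¬ SeparatingEdge (canReach O (α w)) (α w) y
    absurd unreached (downwards f-int _ _ f∼αw αf∼y) =
      not-¬ (⟶-trans (trans f∼αw ⟶-refl) (internal⇒⟶α f-int)) (trans αf∼y unreached)
    absurd unreached (upwards {f} f-int αw∈f y∉f _ _) with w Finₚ.≟ f
    ... | yes refl = not-¬ y∈w y∉f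
    ... | no w≢f = not-¬ (subtree-nested w-int f-int w≢f αw∈f y∈w) y∉f

  external⇒αg⟶g : ∀ {g} → External g → O ⊢ α g ⟶ g
  external⇒αg⟶g g-ext with externalState g-ext
  ... | toggled g-tog _ = ToggledCycle.αa⟶a g-ext g-tog
  ... | untouched _ αg∈O _ = α∈⇒⟶ αg∈O
  ... | onToggledCocycle _ _ b-int b-tog _ = contradiction (none-toggled b-int) (not-¬ b-tog)

  data Reaches (x : Fin n) : Set where
    toRoot   : O ⊢ x ⟶ h₀ → Reaches x
    toActive : ∀ {b} → Internal b → isActive b ≡ true → b ≺ x → O ⊢ x ⟶ α b → Reaches x

  reaches-via : ∀ {x y} → y ≺ x → O ⊢ x ⟶ y → Reaches y → Reaches x
  reaches-via y≺x x⟶y (toRoot y⟶h₀) = toRoot (⟶-trans x⟶y y⟶h₀)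
  reaches-via y≺x x⟶y (toActive b-int b-act b≺y y⟶αb) =
    toActive b-int b-act (<-trans b≺y y≺x) (⟶-trans x⟶y y⟶αb)

  -- From below an inactive tree edge, an external edge entering its subtree leads back to an
  -- earlier vertex.
  reaches : ∀ x → Reaches x
  reaches = ≺-induction Reaches step
    where
    step : ∀ x → (∀ {y} → y ≺ x → Reaches y) → Reaches x
    step x earlier with backstep x
    ... | atRoot refl = toRoot ⟶-refl
    ... | sameVertex y≺x y≈x = reaches-via y≺x (≈⇒⟶ (≈-sym y≈x)) (earlier y≺x)
    ... | fromParent {b} b-int time-x αb≈x with true⊎false (isActive b)
    ... | inj₁ b-act = toActive b-int b-act (≤-reflexive (sym time-x)) (≈⇒⟶ (≈-sym αb≈x))
    ... | inj₂ b-inact with g , g-ext , enters ← inactive-internal b-int b-inact =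
          let g≺x = <-trans (enters⇒≺ b-int g-ext enters) (≤-reflexive (sym time-x))
              x⟶αg = ⟶-trans (≈⇒⟶ (≈-sym αb≈x)) (αw⟶subtree b-int (proj₂ enters))
          in reaches-via g≺x (⟶-trans x⟶αg (external⇒αg⟶g g-ext)) (earlier g≺x)

  private
    marked : Fin n → Bool
    marked = firstInternal isActive

    module E = MarkedExploration M tree (λ u x → canReach O x u) marked

    new : ∀ {b} → marked b ≡ true → E.explored (time b) (α b) ≡ false
    new {b} b-marked = ¬-not λ e → unreached (E.explored⁻ e)
      where
      b-int : Internal b
      b-int = proj₁ (firstInternal⁻ isActive b-marked)
      stays : ∀ {x} → O ⊢ α b ⟶ x → subtree b x ≡ true
      stays αb⟶x = active-subtree-⟶ b-int (proj₂ (firstInternal⁻ isActive b-marked)) αb⟶x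
        (αb∈subtree (internal≺ b-int))
      unreached : ¬ (O ⊢ α b ⟶ h₀ ⊎ ∃ λ c → marked c ≡ true × c ≺ b × O ⊢ α b ⟶ α c)
      unreached (inj₁ αb⟶h₀) = not-¬ (stays αb⟶h₀) (h₀∉subtree b)
      unreached (inj₂ (c , c-marked , c≺b , αb⟶αc)) =
        not-¬ (stays αb⟶αc) (α∉later-subtree (proj₁ (firstInternal⁻ isActive c-marked)) b-int c≺b)

    visited : ∀ x → E.explored (time x) x ≡ true
    visited x with reaches x
    ... | toRoot x⟶h₀ = E.explored-root x⟶h₀
    ... | toActive b-int b-act b≺x x⟶αb =
      E.explored-marked (firstInternal⁺ isActive b-int b-act) b≺x x⟶αb

    external-explored : ∀ {b g} → marked b ≡ true → External g → g ≺ b →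
        E.explored (time b) (α g) ≡ true
    external-explored _ g-ext g≺b with reaches _
    ... | toRoot g⟶h₀ = E.explored-root (⟶-trans (external⇒αg⟶g g-ext) g⟶h₀)
    ... | toActive c-int c-act c≺g g⟶αc =
      E.explored-marked (firstInternal⁺ isActive c-int c-act) (<-trans c≺g g≺b)
        (⟶-trans (external⇒αg⟶g g-ext) g⟶αc)

    #active≡#marked : #active internal ≡ count marked H
    #active≡#marked = trans (edgeCount-cong λ h → cong (lookup T h ∧_) (sym (isActive≡active h)))
      (edgeCount-internal λ h → sym (isActive-α h))

  numRootStrongComps≡ : numRootStrongComps T O ≡ suc (#active internal)
  numRootStrongComps≡ = begin
    numRootStrongComps T O
      ≡⟨ as-exploration ⟩
    countParts T E.growR n (λ x → canReach O x h₀)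
      ≡⟨ E.countParts-marked (λ x≈y r → ⟶-trans (≈⇒⟶ (≈-sym x≈y)) r)
          (proj₁ ∘ firstInternal⁻ isActive) new visited external-explored ⟩
    suc (count marked H)
      ≡⟨ cong suc #active≡#marked ⟨
    suc (#active internal) ∎
    where
    open ≡-Reasoning
    opaque
      unfolding canReach
      as-exploration : numRootStrongComps T O ≡ countParts T E.growR n (λ x → canReach O x h₀)
      as-exploration = refl

module DirectedCycles {n : ℕ} (M : RootedMap n) where
  open RootedMap M
  open MapDefs M
  open HalfEdges M
  open Reachability M
  open Intervals M

  linked-⟶ : ∀ {A} x xs z → Linked (λ a b → sameV (α a) b ≡ true) ((x ∷ xs) ∷ʳ z) →
      All (_∈ˢ A) (x ∷ xs) → ∀ {a} → a ∈ x ∷ xs → A ⊢ x ⟶ a × A ⊢ α a ⟶ z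
  linked-⟶ x [] z (αx∼z ∷ _) _ (here refl) = ⟶-refl , ≈⇒⟶ (mk≈ αx∼z)
  linked-⟶ x (y ∷ ys) z (αx∼y ∷ links) (_ ∷ y∈A ∷ ys⊆A) (here refl) =
    ⟶-refl , ⟶-trans (≈⇒⟶ (mk≈ αx∼y))
      (⟶-trans (∈⇒⟶α y∈A) (proj₂ (linked-⟶ y ys z links (y∈A ∷ ys⊆A) (here refl))))
  linked-⟶ x (y ∷ ys) z (αx∼y ∷ links) (x∈A ∷ ys⊆A) (there a∈ys) =
    let y⟶a , αa⟶z = linked-⟶ y ys z links ys⊆A a∈ys
    in ⟶-trans (⟶-≈ (∈⇒⟶α x∈A) (mk≈ αx∼y)) y⟶a , αa⟶z

  record Cycle (O : Vec Bool n) (h : Fin n) (rest : List (Fin n)) : Set where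
    constructor mkCycle
    field directedCycle : DirectedCycle O h rest

    tails : List (Fin n)
    tails = h ∷ rest

    tail∈O : ∀ {a} → a ∈ tails → a ∈ˢ O
    tail∈O = All.lookup (proj₁ directedCycle)

    return : ∀ {A} → All (_∈ˢ A) tails → ∀ {a} → a ∈ tails → A ⊢ α a ⟶ a
    return tails⊆A a∈ =
      let h⟶a , αa⟶h = linked-⟶ h rest h (proj₁ (proj₂ directedCycle)) tails⊆A a∈
      in ⟶-trans αa⟶h h⟶a

    predecessorClosed-cycle : ∀ {X} → PredecessorClosed O X → ∀ {a} → a ∈ tails → X a ≡ X (α a)
    predecessorClosed-cycle closed a∈ = ≡-via-true
      (closed-⟶ closed (return (proj₁ directedCycle) a∈)) (closed-tail closed (tail∈O a∈))

    leaves-again : ∀ {X : Fin n → Bool} → (∀ {x y} → x ≈ y → X x ≡ X y) → ∀ {a} → a ∈ tails →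
        X a ≡ false → X (α a) ≡ true → ∃ λ g → g ∈ tails × X g ≡ true × X (α g) ≡ false
    leaves-again {X} X-≈ {a} a∈ a∉X αa∈X with true⊎false (any (λ g → X g ∧ not (X (α g))) tails)
    ... | inj₁ some =
      let g , g∈ , p = any-true⁻ _ tails some
      in g , g∈ , ∧-conicalˡ _ _ p , not-injective (∧-conicalʳ (X g) _ p)
    ... | inj₂ none = contradiction a∉X (not-¬ (⟶-induction {A = A} (λ y → X y ≡ true) αa∈X
      (λ y∈X y≈z → trans (sym (X-≈ y≈z)) y∈X) stays (return (All.tabulate tail∈A) a∈)))
      where
      A : Vec Bool n
      A = tabulate λ x → any (x ==_) tails
      tail∈A : ∀ {x} → x ∈ tails → x ∈ˢ A
      tail∈A {x} x∈ = trans (lookup∘tabulate _ x) (any-true⁺ (x ==_) x∈ (==-refl x))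
      stays : ∀ {y} → X y ≡ true → y ∈ˢ A → X (α y) ≡ true
      stays {y} y∈X y∈A
          with x , x∈ , y==x ← any-true⁻ (y ==_) tails (trans (sym (lookup∘tabulate _ y)) y∈A)
          with refl ← ==⇒≡ {y} {x} y==x =
        ¬-not λ αy∉X → not-¬
          (any-true⁺ (λ g → X g ∧ not (X (α g))) x∈ (cong₂ _∧_ y∈X (cong not αy∉X))) none

  -- Loop erasure turns a directed walk from α q to q into a directed cycle through q.
  module LoopErasure (A : Vec Bool n) (q : Fin n) where

    data Chain : Fin n → List (Fin n) → Set where
      end  : ∀ {v} → v ≈ q → Chain v []
      step : ∀ {v w ws} → v ≈ w → Chain (α w) ws → Chain v (w ∷ ws)

    record SimplePath (v : Fin n) : Set where
      field
        tails : List (Fin n)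
        links : Chain v tails
        tails⊆A : All (_∈ˢ A) tails
        distinct : AllPairs (λ a b → sameV a b ≡ false) tails
        avoids-q : All (λ a → sameV q a ≡ false) tails

    chain-≈ : ∀ {v w ws} → v ≈ w → Chain w ws → Chain v ws
    chain-≈ v≈w (end w≈q) = end (≈-trans v≈w w≈q)
    chain-≈ v≈w (step w≈x c) = step (≈-trans v≈w w≈x) c

    simplePath-≈ : ∀ {v w} → v ≈ w → SimplePath w → SimplePath v
    simplePath-≈ v≈w p = record { SimplePath p ; links = chain-≈ v≈w (SimplePath.links p) }

    trivialPath : ∀ {v} → v ≈ q → SimplePath v
    trivialPath v≈q =
      record { tails = [] ; links = end v≈q ; tails⊆A = [] ; distinct = [] ; avoids-q = [] }

    shortcut : ∀ {v y} (p : SimplePath v) → any (sameV y) (SimplePath.tails p) ≡ true → SimplePath y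
    shortcut {y = y} p = cut (links p) (tails⊆A p) (distinct p) (avoids-q p)
      where
      open SimplePath
      cut : ∀ {v ws} → Chain v ws → All (_∈ˢ A) ws → AllPairs (λ a b → sameV a b ≡ false) ws →
            All (λ a → sameV q a ≡ false) ws → any (sameV y) ws ≡ true → SimplePath y
      cut {ws = w ∷ ws} (step v≈w c) (w∈A ∷ ws⊆A) (w≉ws ∷ ws-distinct) (q≉w ∷ q≉ws) meets
          with true⊎false (sameV y w)
      ... | inj₁ y∼w = record
        { tails = w ∷ ws
        ; links = step (mk≈ y∼w) c
        ; tails⊆A = w∈A ∷ ws⊆A
        ; distinct = w≉ws ∷ ws-distinct
        ; avoids-q = q≉w ∷ q≉ws
        }
      ... | inj₂ y≁w =
        cut c ws⊆A ws-distinct q≉ws (subst (λ b → b ∨ any (sameV y) ws ≡ true) y≁w meets)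

    prepend : ∀ {y} → y ∈ˢ A → SimplePath (α y) → SimplePath y
    prepend {y} y∈A p with true⊎false (sameV y q) | true⊎false (any (sameV y) (SimplePath.tails p))
    ... | inj₁ y∼q | _ = trivialPath (mk≈ y∼q)
    ... | inj₂ _ | inj₁ meets = shortcut p meets
    ... | inj₂ y≁q | inj₂ misses = record
      { tails = y ∷ tails
      ; links = step ≈-refl links
      ; tails⊆A = y∈A ∷ tails⊆A
      ; distinct = All.tabulate y≉tails ∷ distinct
      ; avoids-q = (¬-not λ q∼y → not-¬ (sameV≡true (≈-sym (mk≈ q∼y))) y≁q) ∷ avoids-q
      }
      where
      open SimplePath p
      y≉tails : ∀ {a} → a ∈ tails → sameV y a ≡ false
      y≉tails a∈ = ¬-not λ y∼a → not-¬ (any-true⁺ (sameV y) a∈ y∼a) misses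

    simplePath : ∀ {v} → A ⊢ v ⟶ q → SimplePath v
    simplePath {v} v⟶q = ⟶-induction (λ y → SimplePath y → SimplePath v) id
      (λ rest y≈z p → rest (simplePath-≈ y≈z p)) (λ rest y∈A p → rest (prepend y∈A p)) v⟶q
      (trivialPath ≈-refl)

    closed-chain : ∀ {x ws} → Chain (α x) ws → Linked (λ a b → sameV (α a) b ≡ true) ((x ∷ ws) ∷ʳ q)
    closed-chain (end αx≈q) = sameV≡true αx≈q ∷ [-]
    closed-chain (step αx≈w c) = sameV≡true αx≈w ∷ closed-chain c

    cycle-through : ∀ O → (∀ {a} → a ∈ˢ A → a ∈ˢ O) → q ∈ˢ O → (p : SimplePath (α q)) →
        DirectedCycle O q (SimplePath.tails p)
    cycle-through O A⊆O q∈O p = q∈O ∷ All.map A⊆O tails⊆A , closed-chain links , avoids-q ∷ distinct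
      where open SimplePath p

module MinimalOrientations {n : ℕ} (M : RootedMap n) {O : Vec Bool n} (π : Intervals.Preimage M O)
  where
  open RootedMap M
  open MapDefs M
  open HalfEdges M
  open Reachability M
  open DirectedCycles M
  open ToggledEdges M π

  module _ (none-toggled : NoneToggled external) {h : Fin n} {rest : List (Fin n)}
    (cycle : Cycle O h rest) where
    open Cycle cycle

    cycle-∉toggledCocycle : ∀ {c g} → g ∈ tails → Internal c → isToggled c ≡ true → ¬ Crosses c g
    cycle-∉toggledCocycle g∈ c-int c-tog crosses =
      ≡not⇒≢ crosses (predecessorClosed-cycle (subtree-predecessorClosed c-int c-tog) g∈)

    external-first-∉cycle : ∀ {g} → External g → g ∈ tails → ⊥
    external-first-∉cycle g-ext g∈ with externalState g-ext
    ... | toggled g-tog _ = not-¬ g-tog (none-toggled g-ext)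
    ... | untouched _ αg∈O _ = tail⇒¬head (tail∈O g∈) αg∈O
    ... | onToggledCocycle _ _ c-int c-tog leaves =
      cycle-∉toggledCocycle g∈ c-int c-tog (leaves⇒crosses leaves)

    internal-second-∉cycle : ∀ {g} → Internal (α g) → g ∈ tails → ⊥
    internal-second-∉cycle {g} αg-int g∈ with internalState αg-int
    ... | toggled αg-tog _ = cycle-∉toggledCocycle g∈ αg-int αg-tog
            (αα⁻ (Crosses (α g)) (crosses-α {α g} {α g} (crosses-self αg-int)))
    ... | untouched _ αg∈O = tail⇒¬head (tail∈O g∈) αg∈O
    ... | onToggledCycle _ _ a-ext a-tog _ = not-¬ a-tog (none-toggled a-ext)

    leaves-along-earlier-edge : ∀ {f a} → Internal f → a ∈ tails → subtree f a ≡ false →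
        subtree f (α a) ≡ true → ∃ λ g → g ∈ tails × rank g < time f
    leaves-along-earlier-edge {f} f-int a∈ a∉f αa∈f
      with g , g∈ , g∈f , αg∉f ← leaves-again (subtree-≈ f-int) a∈ a∉f αa∈f with kind g
    ... | internal-first g-int
        with refl ← crossing-internal-unique g-int f-int (leaves⇒crosses (g∈f , αg∉f)) =
      contradiction (b∉subtree f) (not-¬ g∈f)
    ... | internal-second αg-int = ⊥-elim (internal-second-∉cycle αg-int g∈)
    ... | external-first g-ext = ⊥-elim (external-first-∉cycle g-ext g∈)
    ... | external-second αg-ext =
      g , g∈ , subst (_< time f) (trans (sym (rank-first (external≺ αg-ext))) (rank-α g))
            (enters⇒≺ f-int αg-ext (leaves-α (g∈f , αg∉f)))

    minimal-edge : ∀ {m} → m ∈ tails → (∀ {g} → g ∈ tails → rank m ≤ rank g) →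
        External (α m) × isActive (α m) ≡ true
    minimal-edge {m} m∈ least = by-kind (kind m)
      where
      not-earlier : ∀ {f} → time f ≤ rank m → ¬ ∃ λ g → g ∈ tails × rank g < time f
      not-earlier f≤m (g , g∈ , g<f) = ℕₚ.<⇒≱ (<-≤-trans g<f f≤m) (least g∈)
      αm-active : External (α m) → isActive (α m) ≡ true
      αm-active αm-ext = ¬-not λ inactive →
        let f , f-int , αm∈f , ααm∉f = inactive-external αm-ext inactive
            αm≡m = trans (sym (rank-first (external≺ αm-ext))) (rank-α m)
        in not-earlier (≤-trans (<⇒≤ (subtree⇒≻ αm∈f)) (≤-reflexive αm≡m))
             (leaves-along-earlier-edge f-int m∈ (αα⁻ (λ x → subtree f x ≡ false) ααm∉f) αm∈f)
      by-kind : Kind m → External (α m) × isActive (α m) ≡ true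
      by-kind (internal-first m-int) = ⊥-elim
        (not-earlier (≤-reflexive (sym (rank-first (internal≺ m-int))))
          (leaves-along-earlier-edge m-int m∈ (b∉subtree m) (αb∈subtree (internal≺ m-int))))
      by-kind (internal-second αm-int) = ⊥-elim (internal-second-∉cycle αm-int m∈)
      by-kind (external-first m-ext) = ⊥-elim (external-first-∉cycle m-ext m∈)
      by-kind (external-second αm-ext) = αm-ext , αm-active αm-ext

  module _ {a : Fin n} (a-ext : External a) (a-tog : isToggled a ≡ true) where
    open ToggledCycle a-ext a-tog

    private
      onPath : Fin n → Bool
      onPath y =
        (lookup T y ∧ (time (α y) <ᵇ time y)) ∧ (not (subtree (α y) a) ∧ subtree (α y) (α a))

      -- The fundamental cycle of a, without a, as directed by O.
      path : Vec Bool n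
      path = tabulate onPath

      ∈-path⁺ : ∀ {f} → Internal f → Enters f a → α f ∈ˢ path
      ∈-path⁺ {f} f-int (a∉ , αa∈) = trans (lookup∘tabulate onPath (α f)) (αα-onPath)
        where
        αα-onPath : onPath (α f) ≡ true
        αα-onPath rewrite α-invol f =
          cong₂ _∧_ (cong₂ _∧_ (α∈ T-sub (internal∈ f-int)) (<⇒<ᵇ≡true (internal≺ f-int)))
            (cong₂ _∧_ (cong not a∉) αa∈)

      ∈-path⁻ : ∀ {y} → y ∈ˢ path → Internal (α y) × Enters (α y) a
      ∈-path⁻ {y} y∈ =
        mkInternal (α∈ T-sub (∧-conicalˡ _ _ in-T))
          (αα⁺ (α y ≺_) (<ᵇ≡true⇒< (∧-conicalʳ (lookup T y) _ in-T))) ,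
        not-injective (∧-conicalˡ _ _ enters) ,
        ∧-conicalʳ (not (subtree (α y) a)) _ enters
        where
        p : onPath y ≡ true
        p = trans (sym (lookup∘tabulate onPath y)) y∈
        in-T : lookup T y ∧ (time (α y) <ᵇ time y) ≡ true
        in-T = ∧-conicalˡ _ _ p
        enters : not (subtree (α y) a) ∧ subtree (α y) (α a) ≡ true
        enters = ∧-conicalʳ (lookup T y ∧ (time (α y) <ᵇ time y)) _ p

      path⊆O : ∀ {y} → y ∈ˢ path → y ∈ˢ O
      path⊆O {y} y∈ = let αy-int , enters = ∈-path⁻ y∈ in αα⁻ (_∈ˢ O) (enters⇒α-tail αy-int enters)

      path-returns : path ⊢ α a ⟶ a
      path-returns = ¬-not λ unreached → let open Exit (cycle-exit canReach-≈ ⟶-refl unreached) in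
        not-¬ (⟶-trans αf-inside (α∈⇒⟶ (∈-path⁺ f-internal f-enters))) f-outside

    toggled-directedCycle : ∃ λ rest → DirectedCycle O a rest × All (λ b → a ≺ b × a ≺ α b) rest
    toggled-directedCycle = tails , cycle-through O path⊆O a-tail p , All.map later tails⊆A
      where
      open LoopErasure path a
      p : SimplePath (α a)
      p = simplePath path-returns
      open SimplePath p
      later : ∀ {b} → b ∈ˢ path → a ≺ b × a ≺ α b
      later {b} b∈ =
        let αb-int , enters = ∈-path⁻ b∈
            a≺αb = enters⇒≺ αb-int a-ext enters
        in <-trans a≺αb (αα⁻ (α b ≺_) (internal≺ αb-int)) , a≺αb

  minimal⇔ : MinimalWrt T O ⇔ NoneToggled external
  minimal⇔ = mk⇔ to from
    where
    pos-≤ : ∀ {x y} → x ≼ y → pos T x ≤ pos T y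
    pos-≤ = subst₂ _≤_ (time≡pos _) (time≡pos _)
    ≤-pos : ∀ {x y} → pos T x ≤ pos T y → x ≼ y
    ≤-pos = subst₂ _≤_ (sym (time≡pos _)) (sym (time≡pos _))
    <-pos : ∀ {x y} → pos T x < pos T y → x ≺ y
    <-pos = subst₂ _<_ (sym (time≡pos _)) (sym (time≡pos _))
    pos-< : ∀ {x y} → x ≺ y → pos T x < pos T y
    pos-< = subst₂ _<_ (time≡pos _) (time≡pos _)
    to : MinimalWrt T O → NoneToggled external
    to minimal {a} a-ext = ¬-not λ a-tog →
      let rest , cycle , later = toggled-directedCycle a-ext a-tog
      in minimal a rest cycle (here ((≤-refl , pos-< (external≺ a-ext))
           ∷ All.map (λ (a≺b , a≺αb) → pos-≤ (<⇒≤ a≺b) , pos-< a≺αb) later))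
    from : NoneToggled external → MinimalWrt T O
    from none-toggled h rest cycle smallest =
      let m , m∈ , m-least = find smallest
          αm-ext , _ = minimal-edge none-toggled (mkCycle cycle) m∈ (rank-least m-least m∈)
      in <-asym (first m-least m∈) (αα⁻ (α m ≺_) (external≺ αm-ext))
      where
      Least : Fin n → Set
      Least m = All (λ b → (pos T m ≤ pos T b) × (pos T m < pos T (α b))) (h ∷ rest)
      first : ∀ {m} → Least m → m ∈ h ∷ rest → m ≺ α m
      first m-least m∈ = <-pos (proj₂ (All.lookup m-least m∈))
      rank-least : ∀ {m} → Least m → m ∈ h ∷ rest → ∀ {g} → g ∈ h ∷ rest → rank m ≤ rank g
      rank-least m-least m∈ {g} g∈ with first-or-second g | All.lookup m-least g∈
      ... | inj₁ g≺αg | m≤g , _ =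
        subst₂ _≤_ (sym (rank-first (first m-least m∈))) (sym (rank-first g≺αg)) (≤-pos m≤g)
      ... | inj₂ αg≺g | _ , m<αg =
        subst₂ _≤_ (sym (rank-first (first m-least m∈)))
          (trans (sym (rank-first (αα⁺ (α g ≺_) αg≺g))) (rank-α g)) (<⇒≤ (<-pos m<αg))

  acyclic⇒none-toggled : Acyclic O → NoneToggled external
  acyclic⇒none-toggled acyclic a-ext = ¬-not λ a-tog →
    let rest , cycle , _ = toggled-directedCycle a-ext a-tog in acyclic _ rest cycle

  active-external⇒⟶α : NoneToggled external → ∀ {e} → External e → isActive e ≡ true → O ⊢ e ⟶ α e
  active-external⇒⟶α none-toggled {e} e-ext e-act = ¬-not λ unreached →
    absurd unreached (separatingEdge canReach-≈ e (α e) (trans ⟶-refl (cong not (sym unreached))))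
    where
    absurd : canReach O e (α e) ≡ false → ¬ SeparatingEdge (canReach O e) e (α e)
    absurd _ (upwards f-int e∈f αe∉f _ _) = active-external e-ext e-act f-int (e∈f , αe∉f)
    absurd unreached (downwards f-int e∉f αe∈f f∼e αf∼αe) with internalState f-int
    ... | toggled f-tog _ = active-internal f-int (toggled⇒isActive f-tog) e-ext (e∉f , αe∈f)
    ... | untouched _ f∈O = not-¬ (⟶-α (trans f∼e ⟶-refl) f∈O) (trans αf∼αe unreached)
    ... | onToggledCycle _ _ a-ext a-tog _ = not-¬ a-tog (none-toggled a-ext)

  acyclic⇔ : Acyclic O ⇔ (∀ {e} → External e → isActive e ≡ false)
  acyclic⇔ = mk⇔ to from
    where
    active-untouched : ∀ {e} → External e → isActive e ≡ true → α e ∈ˢ O → ¬ Acyclic O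
    active-untouched {e} e-ext e-act αe∈O acyclic =
      acyclic (α e) (SimplePath.tails p) (cycle-through O id αe∈O p)
      where
      open LoopErasure O (α e)
      p : SimplePath (α (α e))
      p = αα⁺ SimplePath
        (simplePath (active-external⇒⟶α (acyclic⇒none-toggled acyclic) e-ext e-act))
    to : Acyclic O → ∀ {e} → External e → isActive e ≡ false
    to acyclic {e} e-ext = ¬-not λ e-act → absurd e-act (externalState e-ext)
      where
      absurd : isActive e ≡ true → ¬ ExternalState e
      absurd e-act (toggled e-tog _) = not-¬ e-tog (acyclic⇒none-toggled acyclic e-ext)
      absurd e-act (untouched _ αe∈O _) = active-untouched e-ext e-act αe∈O acyclic
      absurd e-act (onToggledCocycle _ _ c-int _ leaves) = active-external e-ext e-act c-int leaves
    from : (∀ {e} → External e → isActive e ≡ false) → Acyclic O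
    from none-active h rest cycle =
      let αm-ext , αm-act = minimal-edge none-toggled (mkCycle cycle) m∈ m≤
      in not-¬ αm-act (none-active αm-ext)
      where
      none-toggled : NoneToggled external
      none-toggled e-ext = ¬-not λ e-tog → not-¬ (toggled⇒isActive e-tog) (none-active e-ext)
      m : Fin n
      m = argmin rank h rest
      m∈ : m ∈ h ∷ rest
      m∈ = [ here , there ]′ (argmin-sel rank h rest)
      m≤ : ∀ {g} → g ∈ h ∷ rest → rank m ≤ rank g
      m≤ (here refl) = f[argmin]≤f[⊤] {f = rank} h rest
      m≤ (there g∈) = All.lookup (f[argmin]≤f[xs] {f = rank} h rest) g∈

module Bijection {n : ℕ} (M : RootedMap n) where
  open RootedMap M
  open MapDefs M
  open HalfEdges M
  open Reachability M
  open Intervals M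
  open Injectivity M

  orientations : List (Vec Bool n)
  orientations = filterᵇ isOrientation (allVecs n)

  ∈-allSubgraphs⁺ : ∀ {S} → Subgraph S → S ∈ allSubgraphs
  ∈-allSubgraphs⁺ {S} S-sub = ∈-filterᵇ⁺ isSubgraph (∈-allVecs S) (isSubgraph⁺ S-sub)

  ∈-allSubgraphs⁻ : ∀ {S} → S ∈ allSubgraphs → Subgraph S
  ∈-allSubgraphs⁻ i = isSubgraph⁻ (proj₂ (∈-filterᵇ⁻ isSubgraph (allVecs n) i))

  allSubgraphs-unique : Unique allSubgraphs
  allSubgraphs-unique = unique-filterᵇ isSubgraph (allVecs-unique n)

  ∈-orientations⁺ : ∀ {O} → isOrientation O ≡ true → O ∈ orientations
  ∈-orientations⁺ {O} = ∈-filterᵇ⁺ isOrientation (∈-allVecs O)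

  -- Comparing an orientation with a fixed one turns it into a subgraph.
  |orientations|≤|allSubgraphs| : length orientations ≤ length allSubgraphs
  |orientations|≤|allSubgraphs| =
    subst (_≤ length allSubgraphs) (Listₚ.length-map toSubgraph orientations)
      (unique-⊆⇒length-≤ (unique-map orientations-unique λ _ _ → toSubgraph-injective)
        ⊆-allSubgraphs)
    where
    orientations-unique : Unique orientations
    orientations-unique = unique-filterᵇ isOrientation (allVecs-unique n)
    toSubgraph : Vec Bool n → Vec Bool n
    toSubgraph O = tabulate λ h → lookup O h xor canonical h
    toSubgraph-injective : ∀ {O O′} → toSubgraph O ≡ toSubgraph O′ → O ≡ O′
    toSubgraph-injective e = lookup-extensional λ h → xor-cancelʳ (canonical h)
      (trans (sym (lookup∘tabulate _ h)) (trans (cong (λ S → lookup S h) e) (lookup∘tabulate _ h)))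
    toSubgraph-subgraph : ∀ {O} → isOrientation O ≡ true → Subgraph (toSubgraph O)
    toSubgraph-subgraph {O} oriented = mkSubgraph λ h → begin
      lookup (toSubgraph O) h
        ≡⟨ lookup∘tabulate _ h ⟩
      lookup O h xor canonical h
        ≡⟨ cong (_xor canonical h) (xor⇒≡not (lookup O h) (all-allFin⁻ _ oriented h)) ⟩
      not (lookup O (α h)) xor canonical h
        ≡⟨ 𝔹ₚ.not-distribˡ-xor (lookup O (α h)) (canonical h) ⟨
      not (lookup O (α h) xor canonical h)
        ≡⟨ 𝔹ₚ.not-distribʳ-xor (lookup O (α h)) (canonical h) ⟩
      lookup O (α h) xor not (canonical h)
        ≡⟨ cong (lookup O (α h) xor_) (canonical-halving h) ⟨
      lookup O (α h) xor canonical (α h)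
        ≡⟨ lookup∘tabulate _ (α h) ⟨
      lookup (toSubgraph O) (α h) ∎
      where open ≡-Reasoning
    ⊆-allSubgraphs : map toSubgraph orientations ⊆ allSubgraphs
    ⊆-allSubgraphs i with O , O∈ , refl ← ∈-map⁻ toSubgraph i =
      ∈-allSubgraphs⁺ (toSubgraph-subgraph {O} (proj₂ (∈-filterᵇ⁻ isOrientation (allVecs n) O∈)))

  opaque
    -- The junk value is S when S is not a subgraph.
    intervalTree : Vec Bool n → Vec Bool n
    intervalTree S with true⊎false (isSubgraph S)
    ... | inj₁ p = proj₁ (Covering.interval-exists M (isSubgraph⁻ {S} p))
    ... | inj₂ _ = S

    intervalTree-interval : ∀ {S} → Subgraph S → Interval (intervalTree S) S
    intervalTree-interval {S} S-sub with true⊎false (isSubgraph S)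
    ... | inj₁ p = proj₂ (Covering.interval-exists M (isSubgraph⁻ {S} p))
    ... | inj₂ ¬p = contradiction ¬p (not-¬ (isSubgraph⁺ S-sub))

  orientationOf : Vec Bool n → Vec Bool n
  orientationOf S = Φ (intervalTree S) S

  preimageOf : ∀ {S} → Subgraph S → Preimage (orientationOf S)
  preimageOf S-sub = mkPreimage (intervalTree-interval S-sub) refl

  Φ-isOrientation : ∀ {O} → Preimage O → isOrientation O ≡ true
  Φ-isOrientation {O} π = all-allFin⁺ _ λ h → ≡not⇒xor (Orientation.O-flip M π h)

  orientationOf-injective : ∀ {S S′} → Subgraph S → Subgraph S′ →
      orientationOf S ≡ orientationOf S′ → S ≡ S′
  orientationOf-injective S-sub S′-sub e =
    proj₂ (Φ-injective (intervalTree-interval S-sub) (intervalTree-interval S′-sub) e)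

  orientationOf-surjective : ∀ {O} → isOrientation O ≡ true →
      ∃ λ S → Subgraph S × orientationOf S ≡ O
  orientationOf-surjective oriented =
    let S , S∈ , O≡ = ∈-map⁻ orientationOf (all-hit (∈-orientations⁺ oriented))
    in S , ∈-allSubgraphs⁻ S∈ , sym O≡
    where
    images-oriented : map orientationOf allSubgraphs ⊆ orientations
    images-oriented i with S , S∈ , refl ← ∈-map⁻ orientationOf i =
      ∈-orientations⁺ (Φ-isOrientation (preimageOf (∈-allSubgraphs⁻ S∈)))
    all-hit : orientations ⊆ map orientationOf allSubgraphs
    all-hit = injective⇒surjective-on (≡-dec 𝔹ₚ._≟_) allSubgraphs-unique
      (λ i j → orientationOf-injective (∈-allSubgraphs⁻ i) (∈-allSubgraphs⁻ j))
      images-oriented |orientations|≤|allSubgraphs|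

  intervalTree-unique : ∀ {T S} → Interval T S → T ≡ intervalTree S
  intervalTree-unique iv =
    let S′ , S′-sub , e = orientationOf-surjective (Φ-isOrientation (mkPreimage iv refl))
        tree≡T , S′≡S = Φ-injective (intervalTree-interval S′-sub) iv e
    in trans (sym tree≡T) (cong intervalTree S′≡S)

  treeOf-unique : ∀ {T S} → Subgraph S → TreeOf (orientationOf S) T → T ≡ intervalTree S
  treeOf-unique {T} S-sub (S′ , iv , e) =
    proj₁ (Φ-injective (inInterval⁻ {T} {S′} iv) (intervalTree-interval S-sub) e)

  treeOf-intervalTree : ∀ {S} → Subgraph S → TreeOf (orientationOf S) (intervalTree S)
  treeOf-intervalTree {S} S-sub = S , inInterval⁺ (intervalTree-interval S-sub) , refl

module StateSums {n : ℕ} (M : RootedMap n) where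
  open RootedMap M
  open MapDefs M
  open HalfEdges M
  open Reachability M
  open Components M
  open Intervals M
  open Bijection M

  opaque
    toggledEdge activeEdge : EdgeKind → Vec Bool n → Fin n → Bool
    toggledEdge κ S h = ofKind κ (intervalTree S) h ∧ (lookup S h xor lookup (intervalTree S) h)
    activeEdge κ S h = ofKind κ (intervalTree S) h ∧ active (intervalTree S) h

    toggledEdge⇒activeEdge : ∀ κ {S} → Subgraph S → ∀ {h} → toggledEdge κ S h ≡ true →
        activeEdge κ S h ≡ true
    toggledEdge⇒activeEdge κ {S} S-sub {h} p = cong₂ _∧_ (∧-conicalˡ _ _ p)
      (Interval.toggled⇒active (intervalTree-interval S-sub) h
        (∧-conicalʳ (ofKind κ (intervalTree S) h) _ p))

  #toggled #active : EdgeKind → Vec Bool n → ℕ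
  #toggled κ S = edgeCount (toggledEdge κ S)
  #active κ S = edgeCount (activeEdge κ S)

  flip : Fin n → Vec Bool n → Vec Bool n
  flip e S = tabulate λ h → lookup S h xor sameEdge h e

  lookup-flip : ∀ e S h → lookup (flip e S) h ≡ lookup S h xor sameEdge h e
  lookup-flip e S = lookup∘tabulate _

  lookup-flip-other : ∀ e S {h} → sameEdge h e ≡ false → lookup (flip e S) h ≡ lookup S h
  lookup-flip-other e S {h} h≁e =
    trans (lookup-flip e S h) (trans (cong (lookup S h xor_) h≁e) (𝔹ₚ.xor-identityʳ _))

  flip-subgraph : ∀ {e S} → Subgraph S → Subgraph (flip e S)
  flip-subgraph {e} {S} S-sub = mkSubgraph λ h → begin
    lookup (flip e S) h
      ≡⟨ lookup-flip e S h ⟩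
    lookup S h xor sameEdge h e
      ≡⟨ cong₂ _xor_ (lookup-α S-sub h) (sym (sameEdge-αˡ h e)) ⟩
    lookup S (α h) xor sameEdge (α h) e
      ≡⟨ lookup-flip e S (α h) ⟨
    lookup (flip e S) (α h) ∎
    where open ≡-Reasoning

  flip-involutive : ∀ e S → flip e (flip e S) ≡ S
  flip-involutive e S = lookup-extensional λ h → begin
    lookup (flip e (flip e S)) h
      ≡⟨ lookup-flip e (flip e S) h ⟩
    lookup (flip e S) h xor sameEdge h e
      ≡⟨ cong (_xor sameEdge h e) (lookup-flip e S h) ⟩
    (lookup S h xor sameEdge h e) xor sameEdge h e
      ≡⟨ xor-xorʳ (lookup S h) (sameEdge h e) ⟩
    lookup S h ∎
    where open ≡-Reasoning

  module FlipActive {κ : EdgeKind} {S : Vec Bool n} (S-sub : Subgraph S) {e : Fin n}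
    (e-act : activeEdge κ S e ≡ true) where

    private
      T : Vec Bool n
      T = intervalTree S

      T-tree : SpanningTree T
      T-tree = Interval.tree (intervalTree-interval S-sub)

    opaque
      unfolding toggledEdge

      kind-e : ofKind κ T e ≡ true
      kind-e = ∧-conicalˡ _ _ e-act

      kind-sameEdge : ∀ {h} → sameEdge h e ≡ true → ofKind κ T h ≡ true
      kind-sameEdge {h} h∼e with sameEdge⁻ h e h∼e
      ... | inj₁ refl = kind-e
      ... | inj₂ refl = trans (sym (Tour.ofKind-α M T-tree κ e)) kind-e

      flip-interval : Interval T (flip e S)
      flip-interval = mkInterval T-tree (flip-subgraph S-sub) still-active
        where
        active-sameEdge : ∀ {h} → sameEdge h e ≡ true → active T h ≡ true
        active-sameEdge {h} h∼e with sameEdge⁻ h e h∼e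
        ... | inj₁ refl = ∧-conicalʳ (ofKind κ T e) _ e-act
        ... | inj₂ refl =
          trans (sym (isActive≡active (α e)))
            (trans (isActive-α e) (trans (isActive≡active e) (∧-conicalʳ (ofKind κ T e) _ e-act)))
          where open Activity M T-tree
        still-active : ∀ h → lookup (flip e S) h xor lookup T h ≡ true → active T h ≡ true
        still-active h h-tog with true⊎false (sameEdge h e)
        ... | inj₁ h∼e = active-sameEdge h∼e
        ... | inj₂ h≁e = Interval.toggled⇒active (intervalTree-interval S-sub) h
          (trans (cong (_xor lookup T h) (sym (lookup-flip-other e S h≁e))) h-tog)

      flip-intervalTree : intervalTree (flip e S) ≡ T
      flip-intervalTree = sym (intervalTree-unique flip-interval)

      flip-activeEdge : ∀ κ′ h → activeEdge κ′ (flip e S) h ≡ activeEdge κ′ S h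
      flip-activeEdge κ′ h = cong (λ T → ofKind κ′ T h ∧ active T h) flip-intervalTree

      flip-toggledEdge-other : ∀ κ′ {h} → sameEdge h e ≡ false →
          toggledEdge κ′ (flip e S) h ≡ toggledEdge κ′ S h
      flip-toggledEdge-other κ′ {h} h≁e =
        cong₂ (λ T b → ofKind κ′ T h ∧ (b xor lookup T h)) flip-intervalTree
          (lookup-flip-other e S h≁e)

      flip-toggledEdge-e : toggledEdge κ (flip e S) e ≡ not (toggledEdge κ S e)
      flip-toggledEdge-e = begin
        toggledEdge κ (flip e S) e
          ≡⟨ cong₂ (λ T b → ofKind κ T e ∧ (b xor lookup T e))
              flip-intervalTree (lookup-flip e S e) ⟩
        ofKind κ T e ∧ ((lookup S e xor sameEdge e e) xor lookup T e)
          ≡⟨ cong₂ (λ k b → k ∧ ((lookup S e xor b) xor lookup T e)) kind-e (sameEdge-refl e) ⟩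
        (lookup S e xor true) xor lookup T e
          ≡⟨ cong (_xor lookup T e) (𝔹ₚ.xor-comm (lookup S e) true) ⟩
        not (lookup S e) xor lookup T e
          ≡⟨ 𝔹ₚ.not-distribˡ-xor (lookup S e) (lookup T e) ⟨
        not (lookup S e xor lookup T e)
          ≡⟨ cong (λ k → not (k ∧ (lookup S e xor lookup T e))) kind-e ⟨
        not (toggledEdge κ S e) ∎
        where open ≡-Reasoning

      flip-toggledEdge-opposite : ∀ h →
          toggledEdge (opposite κ) (flip e S) h ≡ toggledEdge (opposite κ) S h
      flip-toggledEdge-opposite h with true⊎false (sameEdge h e)
      ... | inj₂ h≁e = flip-toggledEdge-other (opposite κ) h≁e
      ... | inj₁ h∼e = begin
        toggledEdge (opposite κ) (flip e S) h
          ≡⟨ cong (λ T → ofKind (opposite κ) T h ∧ (lookup (flip e S) h xor lookup T h))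
              flip-intervalTree ⟩
        ofKind (opposite κ) T h ∧ (lookup (flip e S) h xor lookup T h)
          ≡⟨ cong (_∧ (lookup (flip e S) h xor lookup T h)) not-opposite ⟩
        false
          ≡⟨ cong (_∧ (lookup S h xor lookup T h)) not-opposite ⟨
        toggledEdge (opposite κ) S h ∎
        where
        open ≡-Reasoning
        ofKind-opposite : ∀ κ → ofKind (opposite κ) T h ≡ not (ofKind κ T h)
        ofKind-opposite internal = refl
        ofKind-opposite external = sym (not-involutive _)
        not-opposite : ofKind (opposite κ) T h ≡ false
        not-opposite = trans (ofKind-opposite κ) (cong not (kind-sameEdge h∼e))

    flip-#toggled-opposite : #toggled (opposite κ) (flip e S) ≡ #toggled (opposite κ) S
    flip-#toggled-opposite = edgeCount-cong flip-toggledEdge-opposite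

    flip-#active : ∀ κ′ → #active κ′ (flip e S) ≡ #active κ′ S
    flip-#active κ′ = edgeCount-cong (flip-activeEdge κ′)

  edges : List (Fin n)
  edges = filterᵇ canonical H

  edgeCount≡count-edges : ∀ p → edgeCount p ≡ count p edges
  edgeCount≡count-edges p = count-∧-filterᵇ p canonical H

  edges-apart : AllPairs (λ e x → sameEdge x e ≡ false) edges
  edges-apart = unique⇒AllPairs (unique-filterᵇ canonical unique-allFin) λ {e} {x} e∈ x∈ e≢x →
    ≢⇒¬sameEdge (e≢x ∘ sym) (not-opposite e∈ x∈)
    where
    is-canonical : ∀ {h} → h ∈ edges → canonical h ≡ true
    is-canonical i = proj₂ (∈-filterᵇ⁻ canonical H i)
    not-opposite : ∀ {e x} → e ∈ edges → x ∈ edges → x ≢ α e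
    not-opposite {e} e∈ x∈ refl =
      not-¬ (is-canonical x∈) (trans (canonical-halving e) (cong not (is-canonical e∈)))

  -- If w u m stands for (z - 1)^u z^m, then summing (z - 1)^#toggled over the two states of each
  -- active edge leaves z^#active on the subgraphs without toggled edges.
  module SumOverStates (κ : EdgeKind) (w : Vec Bool n → ℕ → ℕ → ℤ)
    (w-rec : ∀ S u m → w S (suc u) m +ℤ w S u m ≡ w S u (suc m))
    (w-flip : ∀ {S e} → Subgraph S → activeEdge κ S e ≡ true → ∀ u m → w (flip e S) u m ≡ w S u m)
    where

    opaque
      term : Vec Bool n → ℕ → ℕ → ℕ → ℤ
      term S toggledDone toggledTodo activeDone =
        ⟦ toggledDone ℕₚ.≟ 0 ⟧ *ℤ w S toggledTodo activeDone

      term-initial : ∀ S u → term S 0 u 0 ≡ w S u 0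
      term-initial S u = ℤₚ.*-identityˡ _

      term-final : ∀ S d m → term S d 0 m ≡ ⟦ d ℕₚ.≟ 0 ⟧ *ℤ w S 0 m
      term-final S d m = refl

      term-flip : ∀ {S e} → Subgraph S → activeEdge κ S e ≡ true → ∀ d u m →
          term (flip e S) d u m ≡ term S d u m
      term-flip S-sub e-act d u m = cong (⟦ d ℕₚ.≟ 0 ⟧ *ℤ_) (w-flip S-sub e-act u m)

      -- b tells whether the active edge being processed is toggled.
      term-step : ∀ S b d u m → term S d (𝟙 b + u) m +ℤ term S d (𝟙 (not b) + u) m
                              ≡ term S (𝟙 b + d) u (suc m) +ℤ term S (𝟙 (not b) + d) u (suc m)
      term-step S true d u m = begin
        ⟦ d ℕₚ.≟ 0 ⟧ *ℤ w S (suc u) m +ℤ ⟦ d ℕₚ.≟ 0 ⟧ *ℤ w S u m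
          ≡⟨ ℤₚ.*-distribˡ-+ ⟦ d ℕₚ.≟ 0 ⟧ (w S (suc u) m) (w S u m) ⟨
        ⟦ d ℕₚ.≟ 0 ⟧ *ℤ (w S (suc u) m +ℤ w S u m)
          ≡⟨ cong (⟦ d ℕₚ.≟ 0 ⟧ *ℤ_) (w-rec S u m) ⟩
        ⟦ d ℕₚ.≟ 0 ⟧ *ℤ w S u (suc m)
          ≡⟨ ℤₚ.+-identityˡ (⟦ d ℕₚ.≟ 0 ⟧ *ℤ w S u (suc m)) ⟨
        + 0 +ℤ ⟦ d ℕₚ.≟ 0 ⟧ *ℤ w S u (suc m) ∎
        where open ≡-Reasoning
      term-step S false d u m = begin
        term S d u m +ℤ term S d (suc u) m
          ≡⟨ ℤₚ.+-comm (term S d u m) (term S d (suc u) m) ⟩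
        term S d (suc u) m +ℤ term S d u m
          ≡⟨ term-step S true d u m ⟩
        term S (suc d) u (suc m) +ℤ term S d u (suc m)
          ≡⟨ ℤₚ.+-comm (term S (suc d) u (suc m)) (term S d u (suc m)) ⟩
        term S d u (suc m) +ℤ term S (suc d) u (suc m) ∎
        where open ≡-Reasoning

    partialTerm : List (Fin n) → List (Fin n) → Vec Bool n → ℤ
    partialTerm done todo S =
      term S (count (toggledEdge κ S) done) (count (toggledEdge κ S) todo)
        (count (activeEdge κ S) done)

    module ProcessEdge (e : Fin n) (done todo : List (Fin n))
      (off-done : ∀ {x} → x ∈ done → sameEdge x e ≡ false)
      (off-todo : ∀ {x} → x ∈ todo → sameEdge x e ≡ false) where

      flipIfActive : Vec Bool n → Vec Bool n
      flipIfActive S = if activeEdge κ S e then flip e S else S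

      module _ {S : Vec Bool n} (S-sub : Subgraph S) where

        module _ (e-inact : activeEdge κ S e ≡ false) where

          inactive-fixed : flipIfActive S ≡ S
          inactive-fixed = cong (if_then flip e S else S) e-inact

          inactive-unchanged : partialTerm done (e ∷ todo) S ≡ partialTerm (e ∷ done) todo S
          inactive-unchanged =
            trans (cong (λ k → term S _ k _) (not-counted (toggledEdge κ S) e-untog todo))
              (sym (cong₂ (λ d m → term S d _ m) (not-counted (toggledEdge κ S) e-untog done)
                (not-counted (activeEdge κ S) e-inact done)))
            where
            e-untog : toggledEdge κ S e ≡ false
            e-untog = ¬-not λ e-tog → not-¬ (toggledEdge⇒activeEdge κ S-sub e-tog) e-inact
            not-counted : ∀ p → p e ≡ false → ∀ xs → count p (e ∷ xs) ≡ count p xs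
            not-counted p ¬pe xs = trans (count-∷ p e xs) (cong (λ b → 𝟙 b + count p xs) ¬pe)

        module _ (e-act : activeEdge κ S e ≡ true) where
          open FlipActive S-sub e-act

          active-flipped : flipIfActive S ≡ flip e S
          active-flipped = cong (if_then flip e S else S) e-act

          flip-count-toggled : ∀ {xs} → (∀ {x} → x ∈ xs → sameEdge x e ≡ false) →
                               count (toggledEdge κ (flip e S)) xs ≡ count (toggledEdge κ S) xs
          flip-count-toggled {xs} off = count-cong xs λ i → flip-toggledEdge-other κ (off i)

          flip-count-toggled-∷ : ∀ {xs} → (∀ {x} → x ∈ xs → sameEdge x e ≡ false) →
            count (toggledEdge κ (flip e S)) (e ∷ xs)
              ≡ 𝟙 (not (toggledEdge κ S e)) + count (toggledEdge κ S) xs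
          flip-count-toggled-∷ {xs} off = trans (count-∷ (toggledEdge κ (flip e S)) e xs)
            (cong₂ (λ b k → 𝟙 b + k) flip-toggledEdge-e (flip-count-toggled off))

          flip-count-active : ∀ xs → count (activeEdge κ (flip e S)) xs ≡ count (activeEdge κ S) xs
          flip-count-active xs = count-cong xs λ {x} _ → flip-activeEdge κ x

          count-active-∷ : count (activeEdge κ S) (e ∷ done) ≡ suc (count (activeEdge κ S) done)
          count-active-∷ =
            trans (count-∷ (activeEdge κ S) e done)
              (cong (λ b → 𝟙 b + count (activeEdge κ S) done) e-act)

          active-paired : partialTerm done (e ∷ todo) S +ℤ partialTerm done (e ∷ todo) (flip e S)
                        ≡ partialTerm (e ∷ done) todo S +ℤ partialTerm (e ∷ done) todo (flip e S)
          active-paired =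
            trans (cong₂ _+ℤ_ before before-flip)
              (trans (term-step S (toggledEdge κ S e) d u m) (sym (cong₂ _+ℤ_ after after-flip)))
            where
            d u m : ℕ
            d = count (toggledEdge κ S) done
            u = count (toggledEdge κ S) todo
            m = count (activeEdge κ S) done
            term-cong : ∀ {d d′ u u′ m m′} → d ≡ d′ → u ≡ u′ → m ≡ m′ →
                term S d u m ≡ term S d′ u′ m′
            term-cong refl refl refl = refl
            before : partialTerm done (e ∷ todo) S ≡ term S d (𝟙 (toggledEdge κ S e) + u) m
            before = term-cong refl (count-∷ (toggledEdge κ S) e todo) refl
            before-flip :
                partialTerm done (e ∷ todo) (flip e S)
                  ≡ term S d (𝟙 (not (toggledEdge κ S e)) + u) m
            before-flip = trans (term-flip S-sub e-act _ _ _)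
              (term-cong (flip-count-toggled off-done) (flip-count-toggled-∷ off-todo)
                (flip-count-active done))
            after : partialTerm (e ∷ done) todo S ≡ term S (𝟙 (toggledEdge κ S e) + d) u (suc m)
            after = term-cong (count-∷ (toggledEdge κ S) e done) refl count-active-∷
            after-flip :
                partialTerm (e ∷ done) todo (flip e S)
                  ≡ term S (𝟙 (not (toggledEdge κ S e)) + d) u (suc m)
            after-flip = trans (term-flip S-sub e-act _ _ _)
              (term-cong (flip-count-toggled-∷ off-done) (flip-count-toggled off-todo)
                (trans (flip-count-active (e ∷ done)) count-active-∷))

        flipIfActive-subgraph : Subgraph (flipIfActive S)
        flipIfActive-subgraph with activeEdge κ S e
        ... | true = flip-subgraph S-sub
        ... | false = S-sub

        flipIfActive-involutive : flipIfActive (flipIfActive S) ≡ S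
        flipIfActive-involutive with true⊎false (activeEdge κ S e)
        ... | inj₂ e-inact =
          trans (cong flipIfActive (inactive-fixed e-inact)) (inactive-fixed e-inact)
        ... | inj₁ e-act = begin
          flipIfActive (flipIfActive S)
            ≡⟨ cong flipIfActive (active-flipped e-act) ⟩
          flipIfActive (flip e S)
            ≡⟨ cong (if_then flip e (flip e S) else flip e S)
                (trans (FlipActive.flip-activeEdge S-sub e-act κ e) e-act) ⟩
          flip e (flip e S)
            ≡⟨ flip-involutive e S ⟩
          S ∎
          where open ≡-Reasoning

        paired : partialTerm done (e ∷ todo) S +ℤ partialTerm done (e ∷ todo) (flipIfActive S)
               ≡ partialTerm (e ∷ done) todo S +ℤ partialTerm (e ∷ done) todo (flipIfActive S)
        paired with true⊎false (activeEdge κ S e)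
        ... | inj₁ e-act rewrite active-flipped e-act = active-paired e-act
        ... | inj₂ e-inact rewrite inactive-fixed e-inact =
          cong₂ _+ℤ_ (inactive-unchanged e-inact) (inactive-unchanged e-inact)

      processed :
          sumOver (partialTerm done (e ∷ todo)) allSubgraphs
            ≡ sumOver (partialTerm (e ∷ done) todo) allSubgraphs
      processed = sumOver-involution allSubgraphs-unique
        (λ i → ∈-allSubgraphs⁺ (flipIfActive-subgraph (∈-allSubgraphs⁻ i)))
        (λ i → flipIfActive-involutive (∈-allSubgraphs⁻ i))
        (λ i → paired (∈-allSubgraphs⁻ i))

    all-processed : ∀ {todo done} → AllPairs (λ e x → sameEdge x e ≡ false) todo →
      (∀ {e x} → e ∈ todo → x ∈ done → sameEdge x e ≡ false) →
      sumOver (partialTerm done todo) allSubgraphs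
        ≡ sumOver (partialTerm (todo ʳ++ done) []) allSubgraphs
    all-processed [] _ = refl
    all-processed {e ∷ todo} {done} (e-apart ∷ apart) disjoint = trans
      (ProcessEdge.processed e done todo (disjoint (here refl)) (All.lookup e-apart))
      (all-processed apart disjoint′)
      where
      disjoint′ : ∀ {f x} → f ∈ todo → x ∈ e ∷ done → sameEdge x f ≡ false
      disjoint′ {f} f∈ (here refl) = trans (sameEdge-comm e f) (All.lookup e-apart f∈)
      disjoint′ f∈ (there x∈) = disjoint (there f∈) x∈

    sum-over-states : sumOver (λ S → w S (#toggled κ S) 0) allSubgraphs ≡
                      sumOver (λ S → ⟦ #toggled κ S ℕₚ.≟ 0 ⟧ *ℤ w S 0 (#active κ S)) allSubgraphs
    sum-over-states = begin
      sumOver (λ S → w S (#toggled κ S) 0) allSubgraphs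
        ≡⟨ sumOver-cong allSubgraphs (λ {S} _ → initial S) ⟩
      sumOver (partialTerm [] edges) allSubgraphs
        ≡⟨ all-processed edges-apart (λ _ ()) ⟩
      sumOver (partialTerm (edges ʳ++ []) []) allSubgraphs
        ≡⟨ sumOver-cong allSubgraphs (λ {S} _ → final S) ⟩
      sumOver (λ S → ⟦ #toggled κ S ℕₚ.≟ 0 ⟧ *ℤ w S 0 (#active κ S)) allSubgraphs ∎
      where
      open ≡-Reasoning
      initial : ∀ S → w S (#toggled κ S) 0 ≡ partialTerm [] edges S
      initial S =
        trans (cong (λ k → w S k 0) (edgeCount≡count-edges (toggledEdge κ S)))
              (sym (term-initial S _))
      count-reversed : ∀ p → count p (edges ʳ++ []) ≡ edgeCount p
      count-reversed p = trans (count-↭ p (↭-reverse edges)) (sym (edgeCount≡count-edges p))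
      final : ∀ S → partialTerm (edges ʳ++ []) [] S ≡ ⟦ #toggled κ S ℕₚ.≟ 0 ⟧ *ℤ w S 0 (#active κ S)
      final S =
        trans (cong₂ (λ d m → term S d 0 m)
                (count-reversed (toggledEdge κ S)) (count-reversed (activeEdge κ S)))
              (term-final S _ _)

infixr 4 _×-⇔-given_

_×-⇔-given_ : ∀ {A A′ B B′ : Set} → A ⇔ A′ → (A′ → B ⇔ B′) → (A × B) ⇔ (A′ × B′)
A⇔A′ ×-⇔-given B⇔B′ = mk⇔
  (λ (a , b) → let a′ = Equivalence.to A⇔A′ a in a′ , Equivalence.to (B⇔B′ a′) b)
  (λ (a′ , b′) → Equivalence.from A⇔A′ a′ , Equivalence.from (B⇔B′ a′) b′)

×-exchange : ∀ {A B C : Set} → (A × B × C) ⇔ (B × A × C)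
×-exchange = mk⇔ (λ (a , b , c) → b , a , c) (λ (b , a , c) → a , b , c)

≡-cong-⇔ : ∀ {A : Set} {x y z : A} → x ≡ y → (x ≡ z) ⇔ (y ≡ z)
≡-cong-⇔ x≡y = mk⇔ (trans (sym x≡y)) (trans x≡y)

suc-≡-⇔ : ∀ {j k i} → j ≡ suc k → (j ≡ suc i) ⇔ (k ≡ i)
suc-≡-⇔ refl = mk⇔ ℕₚ.suc-injective (cong suc)

module Statistics {n : ℕ} (M : RootedMap n) where
  open MapDefs M
  open HalfEdges M
  open Reachability M
  open Intervals M
  open Bijection M
  open StateSums M

  module _ {S : Vec Bool n} (S-sub : Subgraph S) where

    private
      π : Preimage (orientationOf S)
      π = preimageOf S-sub

      module S = ToggledEdges M π

      T : Vec Bool n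
      T = intervalTree S

    opaque
      unfolding toggledEdge

      #toggled≡ : ∀ κ → S.#toggled κ ≡ #toggled κ S
      #toggled≡ κ = refl

      #active≡ : ∀ κ → S.#active κ ≡ #active κ S
      #active≡ κ = refl

    noneToggled⇔ : ∀ κ → S.NoneToggled κ ⇔ #toggled κ S ≡ 0
    noneToggled⇔ κ = ≡-cong-⇔ (#toggled≡ κ) ⇔-∘ ⇔-sym (S.#toggled≡0 κ)

    noneActive⇔ : ∀ κ → (∀ {x} → S.FirstOfKind κ x → S.isActive x ≡ false) ⇔ #active κ S ≡ 0
    noneActive⇔ κ =
      ≡-cong-⇔ same-count ⇔-∘ ⇔-sym (S.edgeCount-ofKind≡0 κ λ h → sym (S.isActive-α h))
      where
      same-count : edgeCount (λ h → ofKind κ T h ∧ S.isActive h) ≡ #active κ S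
      same-count =
        trans (edgeCount-cong λ h → cong (ofKind κ T h ∧_) (S.isActive≡active h)) (#active≡ κ)

    numComp∸1 : numComp S ∸ 1 ≡ #toggled internal S
    numComp∸1 = trans (cong (_∸ 1) S.numComp-S) (#toggled≡ internal)

    nullity : numE S + numComp S ∸ numV ≡ #toggled external S
    nullity = trans S.nullity-S (#toggled≡ external)

    #active≡0⇒#toggled≡0 : ∀ κ → #active κ S ≡ 0 → #toggled κ S ≡ 0
    #active≡0⇒#toggled≡0 κ none = Equivalence.to (noneToggled⇔ κ) λ first → ¬-not λ tog →
      not-¬ (S.toggled⇒isActive tog) (Equivalence.from (noneActive⇔ κ) none first)

    at-intervalTree : (P : Vec Bool n → Set) → (∃ λ T → TreeOf (orientationOf S) T × P T) ⇔ P T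
    at-intervalTree P = mk⇔ (λ (T′ , treeOf , p) → subst P (treeOf-unique S-sub treeOf) p)
                            (λ p → T , treeOf-intervalTree S-sub , p)

    rootComps⇔ : ∀ {i} → RC i (orientationOf S) ⇔ #toggled internal S ≡ i
    rootComps⇔ {i} =
      suc-≡-⇔ (trans (RootComponents.numRootComps≡ M π) (cong suc (#toggled≡ internal)))
      ⇔-∘ at-intervalTree (λ T → numRootComps T (orientationOf S) ≡ suc i)

    v0Connected⇔ : v0Connected (orientationOf S) ≡ true ⇔ #toggled internal S ≡ 0
    v0Connected⇔ = noneToggled⇔ internal ⇔-∘ S.v0Connected⇔

    rootStrongComps⇔ : ∀ {i} → #toggled internal S ≡ 0 →
        RSC i (orientationOf S) ⇔ #active internal S ≡ i
    rootStrongComps⇔ {i} none =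
      suc-≡-⇔ (trans (numRootStrongComps≡ (Equivalence.from (noneToggled⇔ internal) none))
        (cong suc (#active≡ internal)))
      ⇔-∘ at-intervalTree (λ T → numRootStrongComps T (orientationOf S) ≡ suc i)
      where open RootStrongComponents M π

    minimal⇔ : Minimal (orientationOf S) ⇔ #toggled external S ≡ 0
    minimal⇔ = noneToggled⇔ external
      ⇔-∘ (MinimalOrientations.minimal⇔ M π
        ⇔-∘ at-intervalTree (λ T → MinimalWrt T (orientationOf S)))

    acyclic⇔ : Acyclic (orientationOf S) ⇔ #active external S ≡ 0
    acyclic⇔ = noneActive⇔ external ⇔-∘ MinimalOrientations.acyclic⇔ M π

    connectedRootStrongComps⇔ : ∀ {i} →
        (v0Connected (orientationOf S) ≡ true × RSC i (orientationOf S)) ⇔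
        (#toggled internal S ≡ 0 × #active internal S ≡ i)
    connectedRootStrongComps⇔ = v0Connected⇔ ×-⇔-given rootStrongComps⇔

module Coefficients {n : ℕ} (M : RootedMap n) where
  open MapDefs M
  open Reachability M
  open Bijection M
  open StateSums M
  open Statistics M

  coeff-tutteAt : ∀ X y i → coeff (tutteAt X y) i ≡
    sumOver (λ S → coeff ((X +P constP (- + 1)) ^P #toggled internal S) i
      *ℤ (y -ℤ + 1) ^ℤ #toggled external S) allSubgraphs
  coeff-tutteAt X y i = trans (coeff-sumP _ allSubgraphs i) (sumOver-cong allSubgraphs λ {S} S∈ →
    trans (coeff-*constP ((X +P constP (- + 1)) ^P (numComp S ∸ 1)) _ i)
      (cong₂ (λ c k → coeff ((X +P constP (- + 1)) ^P c) i *ℤ (y -ℤ + 1) ^ℤ k)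
        (numComp∸1 (∈-allSubgraphs⁻ S∈)) (nullity (∈-allSubgraphs⁻ S∈))))

  sumOver-[x-1]^ : ∀ (v : ℕ → ℤ) i →
    sumOver (λ S → coeff (x-1 ^P #toggled internal S) i *ℤ v (#toggled external S)) allSubgraphs ≡
    sumOver (λ S → ⟦ #toggled internal S ℕₚ.≟ 0 ×-dec #active internal S ℕₚ.≟ i ⟧
      *ℤ v (#toggled external S)) allSubgraphs
  sumOver-[x-1]^ v i = begin
    sumOver (λ S → coeff (x-1 ^P #toggled internal S) i *ℤ v (#toggled external S)) allSubgraphs
      ≡⟨ sumOver-cong allSubgraphs
          (λ {S} _ → cong (_*ℤ v (#toggled external S)) (coeff-[x-1]^ (#toggled internal S) i)) ⟩
    sumOver (λ S → w S (#toggled internal S) 0) allSubgraphs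
      ≡⟨ SumOverStates.sum-over-states internal w w-rec w-flip ⟩
    sumOver (λ S → ⟦ #toggled internal S ℕₚ.≟ 0 ⟧ *ℤ w S 0 (#active internal S)) allSubgraphs
      ≡⟨ sumOver-cong allSubgraphs (λ {S} _ → final S) ⟩
    sumOver (λ S → ⟦ #toggled internal S ℕₚ.≟ 0 ×-dec #active internal S ℕₚ.≟ i ⟧
      *ℤ v (#toggled external S)) allSubgraphs ∎
    where
    open ≡-Reasoning
    w : Vec Bool n → ℕ → ℕ → ℤ
    w S u m = mixedCoeff u m i *ℤ v (#toggled external S)
    w-rec : ∀ S u m → w S (suc u) m +ℤ w S u m ≡ w S u (suc m)
    w-rec S u m = trans
      (sym (ℤₚ.*-distribʳ-+ (v (#toggled external S)) (mixedCoeff (suc u) m i) (mixedCoeff u m i)))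
      (cong (_*ℤ v (#toggled external S)) (mixedCoeff-rec u m i))
    w-flip : ∀ {S e} → Subgraph S → activeEdge internal S e ≡ true → ∀ u m →
        w (flip e S) u m ≡ w S u m
    w-flip S-sub e-act u m =
      cong (λ k → mixedCoeff u m i *ℤ v k) (FlipActive.flip-#toggled-opposite S-sub e-act)
    final : ∀ S →
        ⟦ #toggled internal S ℕₚ.≟ 0 ⟧ *ℤ w S 0 (#active internal S) ≡
        ⟦ #toggled internal S ℕₚ.≟ 0 ×-dec #active internal S ℕₚ.≟ i ⟧ *ℤ v (#toggled external S)
    final S = trans
      (sym (ℤₚ.*-assoc ⟦ #toggled internal S ℕₚ.≟ 0 ⟧ ⟦ #active internal S ℕₚ.≟ i ⟧ _))
      (cong (_*ℤ v (#toggled external S))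
        (sym (⟦⟧-× (#toggled internal S ℕₚ.≟ 0) (#active internal S ℕₚ.≟ i))))

  noToggledExternal? : ∀ S → Dec (#toggled external S ≡ 0)
  noToggledExternal? S = #toggled external S ℕₚ.≟ 0

  noActiveExternal? : ∀ S → Dec (#active external S ≡ 0)
  noActiveExternal? S = #active external S ℕₚ.≟ 0

  module _ {P : Vec Bool n → Set} (P? : ∀ S → Dec (P S)) where

    sumOver-1^ : sumOver (λ S → ⟦ P? S ⟧ *ℤ (+ 1) ^ℤ #toggled external S) allSubgraphs ≡
                 sumOver (λ S → ⟦ P? S ⟧) allSubgraphs
    sumOver-1^ = sumOver-cong allSubgraphs λ {S} _ →
      trans (cong (⟦ P? S ⟧ *ℤ_) (ℤₚ.^-zeroˡ (#toggled external S))) (ℤₚ.*-identityʳ ⟦ P? S ⟧)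

    sumOver-0^ : sumOver (λ S → ⟦ P? S ⟧ *ℤ (+ 0) ^ℤ #toggled external S) allSubgraphs ≡
                 sumOver (λ S → ⟦ noToggledExternal? S ×-dec P? S ⟧) allSubgraphs
    sumOver-0^ = sumOver-cong allSubgraphs λ {S} _ → begin
      ⟦ P? S ⟧ *ℤ (+ 0) ^ℤ #toggled external S
        ≡⟨ cong (⟦ P? S ⟧ *ℤ_) (0^ (#toggled external S)) ⟩
      ⟦ P? S ⟧ *ℤ ⟦ noToggledExternal? S ⟧
        ≡⟨ ℤₚ.*-comm ⟦ P? S ⟧ ⟦ noToggledExternal? S ⟧ ⟩
      ⟦ noToggledExternal? S ⟧ *ℤ ⟦ P? S ⟧
        ≡⟨ ⟦⟧-× (noToggledExternal? S) (P? S) ⟨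
      ⟦ noToggledExternal? S ×-dec P? S ⟧ ∎
      where open ≡-Reasoning

    module _ (P-flip : ∀ {S e} → Subgraph S → activeEdge external S e ≡ true →
                       ⟦ P? (flip e S) ⟧ ≡ ⟦ P? S ⟧) where

      sumOver-[y-1]^ : ∀ y →
        sumOver (λ S → ⟦ P? S ⟧ *ℤ (y -ℤ + 1) ^ℤ #toggled external S) allSubgraphs ≡
        sumOver (λ S → ⟦ noToggledExternal? S ⟧ *ℤ (⟦ P? S ⟧ *ℤ y ^ℤ #active external S))
          allSubgraphs
      sumOver-[y-1]^ y = begin
        sumOver (λ S → ⟦ P? S ⟧ *ℤ (y -ℤ + 1) ^ℤ #toggled external S) allSubgraphs
          ≡⟨ sumOver-cong allSubgraphs (λ {S} _ →
              cong (⟦ P? S ⟧ *ℤ_) (sym (ℤₚ.*-identityʳ ((y -ℤ + 1) ^ℤ #toggled external S)))) ⟩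
        sumOver (λ S → w S (#toggled external S) 0) allSubgraphs
          ≡⟨ SumOverStates.sum-over-states external w w-rec w-flip ⟩
        sumOver (λ S → ⟦ noToggledExternal? S ⟧ *ℤ w S 0 (#active external S)) allSubgraphs
          ≡⟨ sumOver-cong allSubgraphs (λ {S} _ →
              cong (λ z → ⟦ noToggledExternal? S ⟧ *ℤ (⟦ P? S ⟧ *ℤ z))
                (ℤₚ.*-identityˡ (y ^ℤ #active external S))) ⟩
        sumOver (λ S → ⟦ noToggledExternal? S ⟧ *ℤ (⟦ P? S ⟧ *ℤ y ^ℤ #active external S))
          allSubgraphs ∎
        where
        open ≡-Reasoning
        w : Vec Bool n → ℕ → ℕ → ℤ
        w S u m = ⟦ P? S ⟧ *ℤ mixedPower y u m
        w-rec : ∀ S u m → w S (suc u) m +ℤ w S u m ≡ w S u (suc m)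
        w-rec S u m = trans
          (sym (ℤₚ.*-distribˡ-+ ⟦ P? S ⟧ (mixedPower y (suc u) m) (mixedPower y u m)))
          (cong (⟦ P? S ⟧ *ℤ_) (mixedPower-rec y u m))
        w-flip : ∀ {S e} → Subgraph S → activeEdge external S e ≡ true → ∀ u m →
            w (flip e S) u m ≡ w S u m
        w-flip S-sub e-act u m = cong (_*ℤ mixedPower y u m) (P-flip S-sub e-act)

      sumOver-[-1]^ : sumOver (λ S → ⟦ P? S ⟧ *ℤ (- + 1) ^ℤ #toggled external S) allSubgraphs ≡
                      sumOver (λ S → ⟦ noActiveExternal? S ×-dec P? S ⟧) allSubgraphs
      sumOver-[-1]^ = trans (sumOver-[y-1]^ (+ 0))
        (sumOver-cong allSubgraphs λ S∈ → noActive (∈-allSubgraphs⁻ S∈))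
        where
        open ≡-Reasoning
        untoggled : ∀ {S} → Subgraph S →
            (#toggled external S ≡ 0 × P S × #active external S ≡ 0) ⇔
            (#active external S ≡ 0 × P S)
        untoggled S-sub = mk⇔ (λ (_ , p , none) → none , p)
          (λ (none , p) → #active≡0⇒#toggled≡0 S-sub external none , p , none)
        noActive : ∀ {S} → Subgraph S →
            ⟦ noToggledExternal? S ⟧ *ℤ (⟦ P? S ⟧ *ℤ (+ 0) ^ℤ #active external S)
              ≡ ⟦ noActiveExternal? S ×-dec P? S ⟧
        noActive {S} S-sub = begin
          ⟦ noToggledExternal? S ⟧ *ℤ (⟦ P? S ⟧ *ℤ (+ 0) ^ℤ #active external S)
            ≡⟨ cong (λ z → ⟦ noToggledExternal? S ⟧ *ℤ (⟦ P? S ⟧ *ℤ z)) (0^ (#active external S)) ⟩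
          ⟦ noToggledExternal? S ⟧ *ℤ (⟦ P? S ⟧ *ℤ ⟦ noActiveExternal? S ⟧)
            ≡⟨ cong (⟦ noToggledExternal? S ⟧ *ℤ_) (⟦⟧-× (P? S) (noActiveExternal? S)) ⟨
          ⟦ noToggledExternal? S ⟧ *ℤ ⟦ P? S ×-dec noActiveExternal? S ⟧
            ≡⟨ ⟦⟧-× (noToggledExternal? S) (P? S ×-dec noActiveExternal? S) ⟨
          ⟦ noToggledExternal? S ×-dec P? S ×-dec noActiveExternal? S ⟧
            ≡⟨ ⟦⟧-cong (noToggledExternal? S ×-dec P? S ×-dec noActiveExternal? S)
                (noActiveExternal? S ×-dec P? S) (untoggled S-sub) ⟩
          ⟦ noActiveExternal? S ×-dec P? S ⟧ ∎

  module _ (i : ℕ) where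

    toggledInternal≟ : ∀ S → Dec (#toggled internal S ≡ i)
    toggledInternal≟ S = #toggled internal S ℕₚ.≟ i

    onlyActiveInternal≟ : ∀ S → Dec (#toggled internal S ≡ 0 × #active internal S ≡ i)
    onlyActiveInternal≟ S = #toggled internal S ℕₚ.≟ 0 ×-dec #active internal S ℕₚ.≟ i

    coeff-tutteAt-1+x : ∀ y → coeff (tutteAt onePlusX y) i ≡
      sumOver (λ S → ⟦ toggledInternal≟ S ⟧ *ℤ (y -ℤ + 1) ^ℤ #toggled external S) allSubgraphs
    coeff-tutteAt-1+x y = trans (coeff-tutteAt onePlusX y i) (sumOver-cong allSubgraphs λ {S} _ →
      cong (_*ℤ (y -ℤ + 1) ^ℤ #toggled external S) (coeff-x^ (#toggled internal S) i))

    coeff-tutteAt-x : ∀ y → coeff (tutteAt varX y) i ≡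
      sumOver (λ S → ⟦ onlyActiveInternal≟ S ⟧ *ℤ (y -ℤ + 1) ^ℤ #toggled external S) allSubgraphs
    coeff-tutteAt-x y = trans (coeff-tutteAt varX y i) (sumOver-[x-1]^ ((y -ℤ + 1) ^ℤ_) i)

    toggledInternal-flip : ∀ {S e} → Subgraph S → activeEdge external S e ≡ true →
                           ⟦ toggledInternal≟ (flip e S) ⟧ ≡ ⟦ toggledInternal≟ S ⟧
    toggledInternal-flip S-sub e-act =
      cong (λ k → ⟦ k ℕₚ.≟ i ⟧) (FlipActive.flip-#toggled-opposite S-sub e-act)

    onlyActiveInternal-flip : ∀ {S e} → Subgraph S → activeEdge external S e ≡ true →
                              ⟦ onlyActiveInternal≟ (flip e S) ⟧ ≡ ⟦ onlyActiveInternal≟ S ⟧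
    onlyActiveInternal-flip S-sub e-act = cong₂ (λ j k → ⟦ j ℕₚ.≟ 0 ×-dec k ℕₚ.≟ i ⟧)
      (FlipActive.flip-#toggled-opposite S-sub e-act) (FlipActive.flip-#active S-sub e-act internal)

  tutteCoeffsCount : ∀ X y {Q R : ℕ → Vec Bool n → Set} (R? : ∀ i S → Dec (R i S)) →
    (∀ i → coeff (tutteAt X y) i ≡ sumOver (λ S → ⟦ R? i S ⟧) allSubgraphs) →
    (∀ {i S} → Subgraph S → Q i (orientationOf S) ⇔ R i S) →
    CoeffsCount (tutteAt X y) (λ i O → isOrientation O ≡ true × Q i O)
  tutteCoeffsCount X y {Q} {R} R? coeff≡ Q⇔R i = count r allSubgraphs ,
    (map orientationOf counted , unique-map (unique-filterᵇ r allSubgraphs-unique) injective ,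
      (λ O → mk⇔ (to O) (from O)) ,
      Listₚ.length-map orientationOf counted) ,
    trans (coeff≡ i) (sumOver-⟦⟧ (R? i) allSubgraphs)
    where
    r : Vec Bool n → Bool
    r S = does (R? i S)
    counted : List (Vec Bool n)
    counted = filterᵇ r allSubgraphs
    counted⁻ : ∀ {S} → S ∈ counted → Subgraph S × R i S
    counted⁻ {S} S∈ with S∈all , rS ← ∈-filterᵇ⁻ r allSubgraphs S∈ with R? i S
    ... | yes RS = ∈-allSubgraphs⁻ S∈all , RS
    counted⁺ : ∀ {S} → Subgraph S → R i S → S ∈ counted
    counted⁺ {S} S-sub RS = ∈-filterᵇ⁺ r (∈-allSubgraphs⁺ S-sub) (dec-true (R? i S) RS)
    injective : ∀ {S S′} → S ∈ counted → S′ ∈ counted → orientationOf S ≡ orientationOf S′ → S ≡ S′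
    injective S∈ S′∈ = orientationOf-injective (proj₁ (counted⁻ S∈)) (proj₁ (counted⁻ S′∈))
    to : ∀ O → O ∈ map orientationOf counted → isOrientation O ≡ true × Q i O
    to O O∈ with S , S∈ , refl ← ∈-map⁻ orientationOf O∈ =
      let S-sub , RS = counted⁻ S∈
      in Φ-isOrientation (preimageOf S-sub) , Equivalence.from (Q⇔R S-sub) RS
    from : ∀ O → isOrientation O ≡ true × Q i O → O ∈ map orientationOf counted
    from O (oriented , QO) =
      let S , S-sub , e = orientationOf-surjective {O} oriented
          RS = Equivalence.to (Q⇔R S-sub) (subst (Q i) (sym e) QO)
      in subst (_∈ map orientationOf counted) e (∈-map⁺ orientationOf (counted⁺ S-sub RS))

theorem47 : ∀ {n : ℕ} (M : RootedMap n) → let open MapDefs M in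
  CoeffsCount (tutteAt onePlusX (+ 2)) (λ i O → isOrientation O ≡ true × RC i O)
  × CoeffsCount (tutteAt onePlusX (+ 1)) (λ i O → isOrientation O ≡ true × Minimal O × RC i O)
  × CoeffsCount (tutteAt onePlusX (+ 0)) (λ i O → isOrientation O ≡ true × Acyclic O × RC i O)
  × CoeffsCount (tutteAt varX (+ 2)) (λ i O → isOrientation O ≡ true × v0Connected O ≡ true × RSC i O)
  × CoeffsCount (tutteAt varX (+ 1)) (λ i O → isOrientation O ≡ true × v0Connected O ≡ true × Minimal O × RSC i O)
  × CoeffsCount (tutteAt varX (+ 0)) (λ i O → isOrientation O ≡ true × v0Connected O ≡ true × Acyclic O × RSC i O)
theorem47 M =
    tutteCoeffsCount onePlusX (+ 2) toggledInternal≟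
      (λ i → trans (coeff-tutteAt-1+x i (+ 2)) (sumOver-1^ (toggledInternal≟ i)))
      (λ S-sub → rootComps⇔ S-sub)
  , tutteCoeffsCount onePlusX (+ 1) (λ i S → noToggledExternal? S ×-dec toggledInternal≟ i S)
      (λ i → trans (coeff-tutteAt-1+x i (+ 1)) (sumOver-0^ (toggledInternal≟ i)))
      (λ S-sub → minimal⇔ S-sub ×-⇔ rootComps⇔ S-sub)
  , tutteCoeffsCount onePlusX (+ 0) (λ i S → noActiveExternal? S ×-dec toggledInternal≟ i S)
      (λ i → trans (coeff-tutteAt-1+x i (+ 0))
        (sumOver-[-1]^ (toggledInternal≟ i) (toggledInternal-flip i)))
      (λ S-sub → acyclic⇔ S-sub ×-⇔ rootComps⇔ S-sub)
  , tutteCoeffsCount varX (+ 2) onlyActiveInternal≟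
      (λ i → trans (coeff-tutteAt-x i (+ 2)) (sumOver-1^ (onlyActiveInternal≟ i)))
      (λ S-sub → connectedRootStrongComps⇔ S-sub)
  , tutteCoeffsCount varX (+ 1) (λ i S → noToggledExternal? S ×-dec onlyActiveInternal≟ i S)
      (λ i → trans (coeff-tutteAt-x i (+ 1)) (sumOver-0^ (onlyActiveInternal≟ i)))
      (λ S-sub → (minimal⇔ S-sub ×-⇔ connectedRootStrongComps⇔ S-sub) ⇔-∘ ×-exchange)
  , tutteCoeffsCount varX (+ 0) (λ i S → noActiveExternal? S ×-dec onlyActiveInternal≟ i S)
      (λ i → trans (coeff-tutteAt-x i (+ 0))
        (sumOver-[-1]^ (onlyActiveInternal≟ i) (onlyActiveInternal-flip i)))
      (λ S-sub → (acyclic⇔ S-sub ×-⇔ connectedRootStrongComps⇔ S-sub) ⇔-∘ ×-exchange)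
  where
  open Statistics M
  open Coefficients M
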